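{- Fix constants $k\ge1$ and a finite set of node labels. There is an FOM-computable function which maps a $k$-ordered tree $\mathcal{T}$ of size $n$ to a hierarchical definition $(\mathcal{T},P)$ in normal form where $P$ has depth $O(\log n)$ and $O(n/\log n)$ inequivalent patterns.
   Context: A $k$-ordered tree is a structure $(V,(E_i)_{1\le i\le k},(P_a)_{a\in A})$ such that $(V,\bigcup_iE_i)$ is a rooted tree, the $E_i$ are pairwise disjoint, and each node has at most one $i$-th child for each $i$; it is given in ancestor representation. Patterns: a subtree pattern is a node $v$, covering all descendants of $v$ (including $v$); a context pattern is a pair $(v,w)$ with $w$ a proper descendant of $v$, covering all descendants of $v$ that are not descendants of $w$. $V[p]$ is the set of covered nodes, $\mathcal{T}[p]$ the induced subtree, and the root of $p$ is the root of $\mathcal{T}[p]$; $q\le p$ iff $V[q]\subseteq V[p]$. A hierarchical definition of $\mathcal{T}$ is a set $P$ of patterns containing the root of $\mathcal{T}$ such that any two patterns of $P$ are disjoint or comparable; represented as the structure $(\mathcal{T},P\cap V,P\cap V^2)$. Direct subpatterns of $p$ are the $q\in P$ with $q<p$ and no $r\in P$ strictly between; the pattern tree has node set $P$ with children the direct subpatterns, and the depth of $P$ is its height. The boundary is $\partial p=V[p]\setminus\bigcup_{q\text{ direct subpattern of }p}V[q]$. $(\mathcal{T},P)$ is in normal form if every $p\in P$ satisfies one of: (1) with $u$ the root of $p$, $\partial p=\{u\}$ and every direct subpattern of $p$ is a subtree pattern; or (2) $p$ has exactly two direct subpatterns $p_1,p_2$ and $V[p]$ is the disjoint union of $V[p_1]$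 and $V[p_2]$. For $p\in P$ let $P[p]=\{q\in P\mid q\le p\}$; $p_1,p_2\in P$ are equivalent if $(\mathcal{T}[p_1],P[p_1])$ and $(\mathcal{T}[p_2],P[p_2])$ are isomorphic. Structures have domain $\{1,\dots,n\}$ with built-in $<$ and $\mathrm{BIT}$; FOM-computable functions are those given by first-order interpretations with majority quantifiers (equivalently DLOGTIME-uniform $\mathrm{TC}^0$). -}

module Defs where

open import Data.Nat using (ℕ; zero; suc; _+_; _*_; _≤_; _%_; _≡ᵇ_; _<ᵇ_; ⌊_/2⌋)
open import Data.Bool using (Bool; true; false; not; _∧_; _∨_; if_then_else_; T)
open import Data.Fin using (Fin; zero; suc; toℕ)
open import Data.List using (List; []; _∷_; length; map; concatMap; lookup; allFin)
open import Data.Bool.ListAction using (any; all)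
open import Data.List.Relation.Unary.All using (All)
open import Data.List.Relation.Unary.Any using (Any)
open import Data.Vec using (Vec; []; _∷_; concat) renaming (lookup to vlookup; map to vmap)
open import Data.Product using (Σ; _×_; _,_)
open import Data.Sum using (_⊎_)
open import Data.Empty using (⊥)
open import Data.Unit using (⊤)
open import Relation.Nullary using (¬_)
open import Relation.Binary.PropositionalEquality using (_≡_; _≢_)
open import Relation.Binary.Construct.Closure.ReflexiveTransitive using (Star)

_⇔_ : Set → Set → Set
A ⇔ B = (A → B) × (B → A)
infix 3 _⇔_

record Sig : Set₁ where
  field
    Sym : Set
    ar  : Sym → ℕ
open Sig public

Struct : Sig → ℕ → Set
Struct σ n = (s : Sym σ) → Vec (Fin n) (ar σ s) → Bool

data Fm (σ : Sig) : ℕ → Set where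
  rel            : ∀ {m} (s : Sym σ) → Vec (Fin m) (ar σ s) → Fm σ m
  eqF ltF bitF   : ∀ {m} → Fin m → Fin m → Fm σ m
  negF           : ∀ {m} → Fm σ m → Fm σ m
  andF orF       : ∀ {m} → Fm σ m → Fm σ m → Fm σ m
  exF allF majF  : ∀ {m} → Fm σ (suc m) → Fm σ m

testBit : ℕ → ℕ → Bool
testBit x zero    = x % 2 ≡ᵇ 1
testBit x (suc j) = testBit ⌊ x /2⌋ j

countTrue : List Bool → ℕ
countTrue []           = 0
countTrue (true ∷ bs)  = suc (countTrue bs)
countTrue (false ∷ bs) = countTrue bs

extend : ∀ {m n} → Fin n → (Fin m → Fin n) → Fin (suc m) → Fin n
extend x ρ zero    = x
extend x ρ (suc j) = ρ j

eval : ∀ {σ n m} → Struct σ n → (Fin m → Fin n) → Fm σ m → Bool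
eval A ρ (rel s xs)  = A s (vmap ρ xs)
eval A ρ (eqF x y)   = toℕ (ρ x) ≡ᵇ toℕ (ρ y)
eval A ρ (ltF x y)   = toℕ (ρ x) <ᵇ toℕ (ρ y)
eval A ρ (bitF x y)  = testBit (toℕ (ρ x)) (toℕ (ρ y))
eval A ρ (negF φ)    = not (eval A ρ φ)
eval A ρ (andF φ ψ)  = eval A ρ φ ∧ eval A ρ ψ
eval A ρ (orF φ ψ)   = eval A ρ φ ∨ eval A ρ ψ
eval {n = n} A ρ (exF φ)  = any (λ x → eval A (extend x ρ) φ) (allFin n)
eval {n = n} A ρ (allF φ) = all (λ x → eval A (extend x ρ) φ) (allFin n)
eval {n = n} A ρ (majF φ) =
  n <ᵇ 2 * countTrue (map (λ x → eval A (extend x ρ) φ) (allFin n))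

-- FOM interpretations (= FOM-computable functions)
-- The output domain is the set of dim-tuples satisfying domF, ordered
-- lexicographically and renumbered as Fin N.

record Interp (σ τ : Sig) : Set where
  field
    dim  : ℕ
    domF : Fm σ dim
    relF : (s : Sym τ) → Fm σ (ar τ s * dim)
open Interp public

allTuples : (n d : ℕ) → List (Vec (Fin n) d)
allTuples n zero    = [] ∷ []
allTuples n (suc d) = concatMap (λ x → map (x ∷_) (allTuples n d)) (allFin n)

filterB : ∀ {A : Set} → (A → Bool) → List A → List A
filterB p []       = []
filterB p (x ∷ xs) = if p x then x ∷ filterB p xs else filterB p xs

outList : ∀ {σ τ n} (I : Interp σ τ) → Struct σ n → List (Vec (Fin n) (dim I))
outList {n = n} I A = filterB (λ t → eval A (vlookup t) (domF I)) (allTuples n (dim I))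

outSize : ∀ {σ τ n} → Interp σ τ → Struct σ n → ℕ
outSize I A = length (outList I A)

outStruct : ∀ {σ τ n} (I : Interp σ τ) (A : Struct σ n) → Struct τ (outSize I A)
outStruct I A s xs =
  eval A (vlookup (concat (vmap (lookup (outList I A)) xs))) (relF I s)

-- k-ordered trees with labels Fin L, ancestor representation:
-- anc x y : x is an ancestor of y (reflexive), edge i x y : y is the
-- i-th child of x, lab a x : x carries label a.

data TSym (k L : ℕ) : Set where
  anc  : TSym k L
  edge : Fin k → TSym k L
  lab  : Fin L → TSym k L

tar : ∀ {k L} → TSym k L → ℕ
tar anc      = 2
tar (edge _) = 2
tar (lab _)  = 1

TreeSig : ℕ → ℕ → Sig
TreeSig k L = record { Sym = TSym k L ; ar = tar }

-- hierarchical definitions: tree symbols + P ∩ V (subS) + P ∩ V² (ctxS)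
data HSym (k L : ℕ) : Set where
  tsym : TSym k L → HSym k L
  subS : HSym k L
  ctxS : HSym k L

har : ∀ {k L} → HSym k L → ℕ
har (tsym s) = tar s
har subS     = 1
har ctxS     = 2

HSig : ℕ → ℕ → Sig
HSig k L = record { Sym = HSym k L ; ar = har }

reduct : ∀ {k L n} → Struct (HSig k L) n → Struct (TreeSig k L) n
reduct B s = B (tsym s)

module _ {k L n : ℕ} (A : Struct (TreeSig k L) n) where

  Anc : Fin n → Fin n → Set
  Anc x y = T (A anc (x ∷ y ∷ []))

  E : Fin k → Fin n → Fin n → Set
  E i x y = T (A (edge i) (x ∷ y ∷ []))

  Lab : Fin L → Fin n → Set
  Lab a x = T (A (lab a) (x ∷ []))

  Edge : Fin n → Fin n → Set
  Edge x y = Σ (Fin k) λ i → E i x y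

  record IsKOTree : Set where
    field
      root        : Fin n
      rootAnc     : ∀ v → Anc root v
      rootNoPar   : ∀ i x → ¬ E i x root
      parent      : ∀ v → v ≢ root → Σ (Fin k) λ i → Σ (Fin n) λ x → E i x v
      parentUniq  : ∀ i j x y v → E i x v → E j y v → (i ≡ j) × (x ≡ y)
      childUniq   : ∀ i x y z → E i x y → E i x z → y ≡ z
      ancIsStar   : ∀ x y → Anc x y ⇔ Star Edge x y

TreeIso : ∀ {k L N n} → Struct (TreeSig k L) N → Struct (TreeSig k L) n → Set
TreeIso {k} {L} {N} {n} B A =
  Σ (Fin N → Fin n) λ f → Σ (Fin n → Fin N) λ g →
    (∀ x → g (f x) ≡ x) × (∀ y → f (g y) ≡ y) ×
    (∀ x y → Anc B x y ⇔ Anc A (f x) (f y)) ×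
    (∀ i x y → E B i x y ⇔ E A i (f x) (f y)) ×
    (∀ a x → Lab B a x ⇔ Lab A a (f x))

data Pat (n : ℕ) : Set where
  spat : Fin n → Pat n
  cpat : Fin n → Fin n → Pat n

patRoot : ∀ {n} → Pat n → Fin n
patRoot (spat v)   = v
patRoot (cpat v w) = v

IsSubtreePat : ∀ {n} → Pat n → Set
IsSubtreePat (spat _)   = ⊤
IsSubtreePat (cpat _ _) = ⊥

module _ {k L n : ℕ} (B : Struct (HSig k L) n) where

  private
    Anc' = Anc (reduct B)

  Cov : Pat n → Fin n → Set
  Cov (spat v)   u = Anc' v u
  Cov (cpat v w) u = Anc' v u × ¬ Anc' w u

  InP : Pat n → Set
  InP (spat v)   = T (B subS (v ∷ []))
  InP (cpat v w) = T (B ctxS (v ∷ w ∷ []))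

  _≤P_ : Pat n → Pat n → Set
  q ≤P p = ∀ u → Cov q u → Cov p u

  _<P_ : Pat n → Pat n → Set
  q <P p = q ≤P p × ¬ (p ≤P q)

  DisjointP : Pat n → Pat n → Set
  DisjointP p q = ∀ u → Cov p u → ¬ Cov q u

  Direct : Pat n → Pat n → Set
  Direct q p = InP q × q <P p × ¬ (Σ (Pat n) λ r → InP r × q <P r × r <P p)

  Boundary : Pat n → Fin n → Set
  Boundary p u = Cov p u × (∀ q → Direct q p → ¬ Cov q u)

  record IsHierDef : Set where
    field
      ctxWF      : ∀ v w → InP (cpat v w) → Anc' v w × v ≢ w
      rootIn     : ∀ r → (∀ v → Anc' r v) → InP (spat r)
      laminar    : ∀ p q → InP p → InP q → DisjointP p q ⊎ (p ≤P q ⊎ q ≤P p)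

  NF1 : Pat n → Set
  NF1 p = (∀ u → Boundary p u ⇔ u ≡ patRoot p) × (∀ q → Direct q p → IsSubtreePat q)

  NF2 : Pat n → Set
  NF2 p = Σ (Pat n) λ p₁ → Σ (Pat n) λ p₂ →
    Direct p₁ p × Direct p₂ p × p₁ ≢ p₂ ×
    (∀ q → Direct q p → q ≡ p₁ ⊎ q ≡ p₂) ×
    (∀ u → Cov p u ⇔ (Cov p₁ u ⊎ Cov p₂ u)) ×
    DisjointP p₁ p₂

  NormalForm : Set
  NormalForm = ∀ p → InP p → NF1 p ⊎ NF2 p

  data Chain : Pat n → ℕ → Set where
    here : ∀ {p} → Chain p 0
    step : ∀ {p q m} → Direct q p → Chain q m → Chain p (suc m)

  DepthLE : ℕ → Set
  DepthLE D = ∀ p m → InP p → Chain p m → m ≤ D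

  -- (T[p₁], P[p₁]) ≅ (T[p₂], P[p₂])
  Equiv : Pat n → Pat n → Set
  Equiv p₁ p₂ =
    Σ (Fin n → Fin n) λ f → Σ (Fin n → Fin n) λ g →
      (∀ u → Cov p₁ u → Cov p₂ (f u) × g (f u) ≡ u) ×
      (∀ u → Cov p₂ u → Cov p₁ (g u) × f (g u) ≡ u) ×
      (∀ u u' → Cov p₁ u → Cov p₁ u' →
         (Anc' u u' ⇔ Anc' (f u) (f u')) ×
         (∀ i → E (reduct B) i u u' ⇔ E (reduct B) i (f u) (f u'))) ×
      (∀ u → Cov p₁ u → ∀ a → Lab (reduct B) a u ⇔ Lab (reduct B) a (f u)) ×
      (∀ q → InP q → q ≤P p₁ → Σ (Pat n) λ q' → InP q' × q' ≤P p₂ ×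
         (∀ u → Cov p₁ u → Cov q u ⇔ Cov q' (f u))) ×
      (∀ q' → InP q' → q' ≤P p₂ → Σ (Pat n) λ q → InP q × q ≤P p₁ ×
         (∀ u → Cov p₂ u → Cov q' u ⇔ Cov q (g u)))

  AtMostClasses : ℕ → Set
  AtMostClasses M = Σ (List (Pat n)) λ reps →
    length reps ≤ M × All InP reps × (∀ p → InP p → Any (Equiv p) reps)

module Submission where

open import Defs
open import Data.Nat using (ℕ; zero; suc; _+_; _*_; _∸_; _^_; _≤_; _<_; z≤n; s≤s; s≤s⁻¹; ⌊_/2⌋; ⌈_/2⌉; _≤?_; _<?_; _≡ᵇ_; _<ᵇ_; nonZero; _/_; _%_)
open import Data.Nat.Properties using (_≟_; ≤-refl; ≤-trans; ≤-reflexive; ≤-antisym; ≤-total; ≤-pred; <-trans; <⇒≤; <⇒≢; <⇒≱; ≮⇒≥; <-≤-trans; ≤-<-trans; n<1+n; n≤1+n; m≤n⇒m≤1+n; <-irrefl; +-comm; +-assoc; +-suc; +-identityʳ; +-mono-≤; +-monoˡ-≤; +-monoʳ-≤; +-cancelʳ-≤; m≤m+n; m≤n+m; m+n∸m≡n; m∸n+n≡m; m+[n∸m]≡n; ∸-monoˡ-≤; m∸n≤m; ∸-cancelʳ-≡; m+n≤o⇒m≤o∸n; *-comm; *-assoc; *-suc; *-zeroʳ; *-identityʳ; *-distribˡ-+; *-distribʳ-+; *-mono-≤; *-monoˡ-≤; *-monoʳ-≤; *-cancelˡ-≡; *-cancelˡ-<; m^n>0; m^n≢0; ^-distribˡ-+-*;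 ^-monoʳ-≤; ≡ᵇ⇒≡; ≡⇒≡ᵇ; <ᵇ⇒<; <⇒<ᵇ; ⌊n/2⌋+⌈n/2⌉≡n; ⌊n/2⌋≤⌈n/2⌉; ⌊n/2⌋-mono; ⌊n/2⌋≤n; +-monoˡ-<; module ≤-Reasoning; suc-injective; m≤n⇒m<n∨m≡n; <-cmp; even≢odd)
open import Data.Nat.Logarithm using (⌊log₂_⌋; ⌊log₂⌋-mono-≤; ⌊log₂[2^n]⌋≡n; ⌊log₂⌊n/2⌋⌋≡⌊log₂n⌋∸1)
open import Data.Nat.Solver using (module +-*-Solver)
open import Data.Bool using (Bool; true; false; not; _∧_; _∨_; T; T?) renaming (_≟_ to _≟B_)
open import Data.Bool.Properties using (T-irrelevant; T-∧; T-∨; T-≡)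
open import Data.Bool.ListAction using (or; and)
open import Data.Fin using (Fin; zero; suc; toℕ; fromℕ<; combine; splitAt; inject≤; cast; _↑ˡ_; _↑ʳ_)
open import Data.Fin.Properties using (toℕ<n; toℕ-injective; toℕ-fromℕ<; fromℕ<-injective; cast-is-id; inject≤-injective; any?; all?; injective⇒≤; combine-injective; ↑ˡ-injective; ↑ʳ-injective; splitAt-↑ˡ; splitAt-↑ʳ) renaming (_≟_ to _≟F_)
open import Data.List using (cartesianProduct; List; []; _∷_; _++_; length; map; concat; concatMap; filter; tabulate; lookup; allFin)
open import Data.List.Properties using (length-tabulate; map-tabulate; map-cong; length-++; ++-assoc; ∷-injective)
open import Data.List.Relation.Unary.All using (All; []; _∷_; universal) renaming (lookup to lookupAll; map to mapAll)
open import Data.List.Relation.Unary.Any using (Any; here; there; satisfied) renaming (map to mapAny)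
open import Data.List.Relation.Unary.AllPairs using ([]; _∷_)
open import Data.List.Relation.Unary.Unique.Propositional using (Unique)
open import Data.List.Membership.Propositional using (_∈_; lose)
open import Data.List.Membership.Propositional.Properties using (∈-allFin; ∈-lookup; ∈-cartesianProduct⁺; ∈-map⁺)
open import Data.List.Relation.Unary.All.Properties using (all-filter; all⁺; all⁻) renaming (map⁺ to All-map⁺; ++⁺ to All-++⁺; concat⁺ to All-concat⁺; tabulate⁺ to All-tabulate⁺)
open import Data.List.Relation.Unary.Unique.Propositional.Properties using (filter⁺; allFin⁺; cartesianProduct⁺; map⁺) renaming (++⁺ to Unique-++⁺; concat⁺ to Unique-concat⁺)
open import Data.Maybe using (Maybe; just; nothing)
open import Data.Maybe.Properties using (just-injective; ≡-dec)
open import Data.Vec using (Vec; []; _∷_) renaming (lookup to vlookup; map to vmap; concat to vconcat)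
open import Data.Product using (Σ; ∃; _×_; _,_; proj₁; proj₂)
open import Data.Sum using (_⊎_; inj₁; inj₂; [_,_]′; swap) renaming (map to ⊎-map)
open import Data.Empty using (⊥; ⊥-elim)
open import Data.Unit using (tt)
open import Function using (_∘_; id)
open import Function.Bundles using (module Equivalence)
open import Relation.Nullary using (¬_; Dec; yes; no)
open import Relation.Nullary.Decidable using (map′; _×-dec_; _⊎-dec_; _→-dec_; ¬?; toWitness; fromWitness; isYes)
open import Relation.Binary.PropositionalEquality using (_≡_; _≢_; refl; sym; trans; cong; cong₂; subst; subst₂; module ≡-Reasoning)
open import Relation.Binary.Construct.Closure.ReflexiveTransitive using (Star; ε; _◅_; _◅◅_)
open import Relation.Binary.Definitions using (Tri; tri<; tri≈; tri>)
open import Data.List.Relation.Unary.AllPairs.Properties using () renaming (tabulate⁺ to AllPairs-tabulate⁺)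
open import Data.List.Relation.Unary.Any.Properties using (any⁺; any⁻)
open import Data.Nat.DivMod using (m/n*n≤m; m≡m%n+[m/n]*n; m%n<n)

{-
Number the nodes in preorder.  For every l choose about n / 2^l marked nodes, nested in l, such that every interval of
the preorder without marks of level l has O(2^l) nodes and every interval without marks of level l + 1 has O(1) marks
of level l.  Let the nodes of level l be the lowest common ancestors of the marks of level l, and order all nodes by
level, ties being broken by the preorder.  Then the lowest common ancestor of two nodes is at least as high in this
priority order as one of them, hence a connected component of the nodes below some priority is a subtree or a context.
Splitting each component at its node t of highest priority produces the patterns: the component itself, the part of it
below t, and, if this part has a hole, t with the children that do not lead to the hole.

A component without nodes of level l has O(2^l) nodes, and one without nodes of level l + 1 has O(1) nodes of level l.
This bounds the depth by O(log n) and the number of patterns that contain a node of level l by O(n / 2^l).  A pattern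
of s nodes is determined up to equivalence by the shape of its decomposition, which has a code of O(s) bits, so if 2^l
is a small multiple of log n, the patterns without nodes of level l have O(√n) classes.
-}

-- A centroid decomposition would find its splitting nodes one after the other; here a total order
-- on the nodes is fixed beforehand, and a pattern is recognised by a condition on its root and hole
-- alone (`Selected`). The recursion reappears only in the correctness proof, as `decompose`.
--
-- A component has at most one hole because the lowest common ancestor of two incomparable holes
-- would lie inside the component, while the order puts it at least as high as one of the holes.
-- Closing the marks under lowest common ancestors costs only a constant factor: a pattern contains
-- at most three nodes of a level per mark of that level in it.
--
-- The majority quantifier compares a count with half of the domain only. Padding of adjustable
-- size, disjoint from the counted nodes, turns this into a comparison with a variable threshold
-- `y`. The thresholds of level `l` are those for which `suc y` is a multiple of `2 ^ l`, which
-- `BIT` can express.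

-- Cardinality bounds by injections, and counting over finite types.

record AtMost {A : Set} (P : A → Set) (m : ℕ) : Set where
  field
    idx : ∀ {a} → P a → Fin m
    inj : ∀ {a b} (p : P a) (q : P b) → idx p ≡ idx q → a ≡ b
open AtMost

module _ {A : Set} where
  atMost-⊆ : ∀ {P Q : A → Set} {m} → (∀ {a} → P a → Q a) → AtMost Q m → AtMost P m
  atMost-⊆ f M .idx p = idx M (f p)
  atMost-⊆ f M .inj p q = inj M (f p) (f q)

  -- Each element is charged to some `b` in one of `r` ways, and `b` together with the way gives the
  -- element back. The bounds on marks, on nodes of a level and on patterns are all charged like
  -- this.
  atMost-fibred : ∀ {B : Set} {P : A → Set} {Q : B → Set} {r m} (F : Fin r → A → B → Set) →
    (∀ {a} → P a → Σ (Fin r) λ i → Σ B λ b → Q b × F i a b) →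
    (∀ i {a a' b} → F i a b → F i a' b → a ≡ a') →
    AtMost Q m → AtMost P (r * m)
  atMost-fibred F cover uniq M .idx p =
    let (i , b , q , _) = cover p in combine i (idx M q)
  atMost-fibred F cover uniq M .inj p p' e with cover p | cover p'
  ... | i , b , q , f | i' , b' , q' , f' with combine-injective i (idx M q) i' (idx M q') e
  ... | refl , e' with inj M q q' e'
  ... | refl = uniq i f f'

  atMost-∪ : ∀ {P Q R : A → Set} {m m'} → (∀ {a} → P a → Q a ⊎ R a) →
    AtMost Q m → AtMost R m' → AtMost P (m + m')
  atMost-∪ {P} {Q} {R} {m} {m'} f M N = record { idx = λ p → ix (f p) ; inj = λ p q → ij (f p) (f q) }
    where
    ix : ∀ {a} → Q a ⊎ R a → Fin (m + m')
    ix (inj₁ q) = idx M q ↑ˡ m'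
    ix (inj₂ r) = m ↑ʳ idx N r
    apart : ∀ {i : Fin m} {j : Fin m'} → i ↑ˡ m' ≢ m ↑ʳ j
    apart {i} {j} e with trans (sym (splitAt-↑ˡ m i m')) (trans (cong (splitAt m) e) (splitAt-↑ʳ m m' j))
    ... | ()
    ij : ∀ {a b} (p : Q a ⊎ R a) (q : Q b ⊎ R b) → ix p ≡ ix q → a ≡ b
    ij (inj₁ p) (inj₁ q) e = inj M p q (↑ˡ-injective m' _ _ e)
    ij (inj₂ p) (inj₂ q) e = inj N p q (↑ʳ-injective m _ _ e)
    ij (inj₁ p) (inj₂ q) e = ⊥-elim (apart e)
    ij (inj₂ p) (inj₁ q) e = ⊥-elim (apart (sym e))

  atMost-≤ : ∀ {P : A → Set} {m m'} → m ≤ m' → AtMost P m → AtMost P m'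
  atMost-≤ m≤m' M .idx p = inject≤ (idx M p) m≤m'
  atMost-≤ m≤m' M .inj p q e = inj M p q (inject≤-injective m≤m' m≤m' _ _ e)

  length≤ : ∀ {P : A → Set} {m} → AtMost P m → ∀ xs → Unique xs → All P xs → length xs ≤ m
  length≤ {P} {m} M xs u ps = injective⇒≤ {f = f} f-inj
    where
    at : ∀ {ys} → All P ys → ∀ i → P (lookup ys i)
    at (p ∷ _) zero = p
    at (_ ∷ ps) (suc i) = at ps i
    lookup-inj : ∀ {ys} → Unique ys → ∀ i j → lookup ys i ≡ lookup ys j → i ≡ j
    lookup-inj (_ ∷ _) zero zero _ = refl
    lookup-inj (d ∷ _) zero (suc j) e = ⊥-elim (lookupAll d (∈-lookup j) e)
    lookup-inj (d ∷ _) (suc i) zero e = ⊥-elim (lookupAll d (∈-lookup i) (sym e))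
    lookup-inj (_ ∷ u) (suc i) (suc j) e = cong suc (lookup-inj u i j e)
    f : Fin (length xs) → Fin m
    f i = idx M (at ps i)
    f-inj : ∀ {i j} → f i ≡ f j → i ≡ j
    f-inj {i} {j} e = lookup-inj u i j (inj M (at ps i) (at ps j) e)

atMost-ℕ : ∀ {A : Set} {P : A → Set} {m} (f : ∀ {a} → P a → ℕ) → (∀ {a} (p : P a) → f p < m) →
  (∀ {a b} (p : P a) (q : P b) → f p ≡ f q → a ≡ b) → AtMost P m
atMost-ℕ f bound f-inj .idx p = fromℕ< (bound p)
atMost-ℕ f bound f-inj .inj p q e = f-inj p q (fromℕ<-injective (f p) (f q) (bound p) (bound q) e)

count : ∀ {A : Set} → (A → Bool) → List A → ℕ
count f xs = countTrue (map f xs)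

module _ {A : Set} where
  count-mono : (f g : A → Bool) → (∀ x → T (f x) → T (g x)) → ∀ xs → count f xs ≤ count g xs
  count-mono f g h [] = z≤n
  count-mono f g h (x ∷ xs) with f x | g x | h x
  ... | true  | true  | _ = s≤s (count-mono f g h xs)
  ... | true  | false | k = ⊥-elim (k tt)
  ... | false | true  | _ = m≤n⇒m≤1+n (count-mono f g h xs)
  ... | false | false | _ = count-mono f g h xs

  count-cong : (f g : A → Bool) → (∀ x → T (f x) ⇔ T (g x)) → ∀ xs → count f xs ≡ count g xs
  count-cong f g h xs = ≤-antisym (count-mono f g (proj₁ ∘ h) xs) (count-mono g f (proj₂ ∘ h) xs)

  count-strict : (f g : A → Bool) → (∀ x → T (f x) → T (g x)) →
    ∀ {x xs} → x ∈ xs → ¬ T (f x) → T (g x) → count f xs < count g xs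
  count-strict f g h {x} {_ ∷ xs} (here refl) nf gx with f x | g x
  ... | true  | _ = ⊥-elim (nf tt)
  ... | false | true = s≤s (count-mono f g h xs)
  count-strict f g h {xs = y ∷ xs} (there m) nf gx with f y | g y | h y
  ... | true  | true  | _ = s≤s (count-strict f g h m nf gx)
  ... | true  | false | k = ⊥-elim (k tt)
  ... | false | true  | _ = m≤n⇒m≤1+n (count-strict f g h m nf gx)
  ... | false | false | _ = count-strict f g h m nf gx

  count-∪ : (f g h : A → Bool) → (∀ x → T (h x) ⇔ (T (f x) ⊎ T (g x))) → (∀ x → T (f x) → ¬ T (g x)) →
    ∀ xs → count h xs ≡ count f xs + count g xs
  count-∪ f g h e d [] = refl
  count-∪ f g h e d (x ∷ xs) with f x | g x | h x | e x | d x
  ... | true  | true  | _     | _ | k = ⊥-elim (k tt tt)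
  ... | true  | false | true  | _ | _ = cong suc (count-∪ f g h e d xs)
  ... | true  | false | false | k | _ = ⊥-elim (proj₂ k (inj₁ tt))
  ... | false | true  | true  | _ | _ = trans (cong suc (count-∪ f g h e d xs)) (sym (+-suc _ _))
  ... | false | true  | false | k | _ = ⊥-elim (proj₂ k (inj₂ tt))
  ... | false | false | true  | k | _ = [ (λ ()) , (λ ()) ]′ (proj₁ k tt)
  ... | false | false | false | _ | _ = count-∪ f g h e d xs

  count-length : (f : A → Bool) → ∀ xs → count f xs ≡ length (filter (T? ∘ f) xs)
  count-length f [] = refl
  count-length f (x ∷ xs) with f x
  ... | true = cong suc (count-length f xs)
  ... | false = count-length f xs

  count-all : (f : A → Bool) → (∀ x → T (f x)) → ∀ xs → count f xs ≡ length xs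
  count-all f h [] = refl
  count-all f h (x ∷ xs) with f x | h x
  ... | true | _ = cong suc (count-all f h xs)

  count-none : (f : A → Bool) → (∀ x → ¬ T (f x)) → ∀ xs → count f xs ≡ 0
  count-none f h [] = refl
  count-none f h (x ∷ xs) with f x | h x
  ... | true | k = ⊥-elim (k tt)
  ... | false | _ = count-none f h xs

  count-positive : (f : A → Bool) → ∀ {x xs} → x ∈ xs → T (f x) → 0 < count f xs
  count-positive f m fx =
    ≤-<-trans z≤n (count-strict (λ _ → false) f (λ _ ()) m (λ ()) fx)

  count≤ : (f : A → Bool) → ∀ {m} → AtMost (T ∘ f) m → ∀ xs → Unique xs → count f xs ≤ m
  count≤ f M xs u = subst (_≤ _) (sym (count-length f xs))
    (length≤ M (filter (T? ∘ f) xs) (filter⁺ (T? ∘ f) u)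
      (all-filter (T? ∘ f) xs))

# : ∀ {n} → (Fin n → Bool) → ℕ
# {n} f = count f (allFin n)

#≤ : ∀ {n m} {f : Fin n → Bool} → AtMost (T ∘ f) m → # f ≤ m
#≤ {n} {f = f} M = count≤ f M (allFin n) (allFin⁺ n)

least : ∀ {n} {P : Fin n → Set} {_R_ : Fin n → Fin n → Set} → (∀ x → Dec (P x)) →
  (∀ {x y z} → x R y → y R z → x R z) → (∀ {x y} → P x → P y → x R y ⊎ y R x) →
  ∀ {x} → P x → ∃ λ x → P x × (∀ {y} → P y → x R y)
least {n} {P} {_R_} P? tr total {x} px = go n P P? _R_ tr total (x , px)
  where
  go : ∀ n (P : Fin n → Set) → (∀ x → Dec (P x)) → (_R_ : Fin n → Fin n → Set) →
    (∀ {x y z} → x R y → y R z → x R z) → (∀ {x y} → P x → P y → x R y ⊎ y R x) →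
    ∃ P → ∃ λ x → P x × (∀ {y} → P y → x R y)
  go (suc n) P P? _R_ tr total w with any? (P? ∘ suc)
  ... | no none = zero , p0 w , only
    where
    p0 : ∃ P → P zero
    p0 (zero , p) = p
    p0 (suc i , p) = ⊥-elim (none (i , p))
    only : ∀ {y} → P y → zero R y
    only {zero} p = [ id , id ]′ (total p p)
    only {suc i} p = ⊥-elim (none (i , p))
  ... | yes w' with go n (P ∘ suc) (P? ∘ suc) (λ x y → suc x R suc y) tr total w'
  ... | m , pm , min with P? zero
  ... | no np = suc m , pm , all-above
    where
    all-above : ∀ {y} → P y → suc m R y
    all-above {zero} p = ⊥-elim (np p)
    all-above {suc i} p = min p
  ... | yes p with total p pm
  ... | inj₁ r = zero , p , all-above
    where
    all-above : ∀ {y} → P y → zero R y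
    all-above {zero} q = [ id , id ]′ (total q q)
    all-above {suc i} q = tr r (min q)
  ... | inj₂ r = suc m , pm , all-above
    where
    all-above : ∀ {y} → P y → suc m R y
    all-above {zero} q = r
    all-above {suc i} q = min q

-- Tree orders and their preorder traversal.

-- Laminarity, the normal form and the counting by levels see the tree only through this order; edge
-- numbers and labels matter again when patterns are encoded.
record TreeOrder (n : ℕ) : Set₁ where
  infix 4 _≼_ _≼?_
  field
    _≼_     : Fin n → Fin n → Set
    _≼?_    : ∀ x y → Dec (x ≼ y)
    ≼-refl  : ∀ {x} → x ≼ x
    ≼-trans : ∀ {x y z} → x ≼ y → y ≼ z → x ≼ z
    ≼-antisym : ∀ {x y} → x ≼ y → y ≼ x → x ≡ y
    ≼-chain : ∀ {x y z} → x ≼ z → y ≼ z → x ≼ y ⊎ y ≼ x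
    rt      : Fin n
    rt≼     : ∀ v → rt ≼ v

  Par : Fin n → Fin n → Set
  Par x v = (x ≼ v × x ≢ v) × (∀ z → z ≼ v → z ≡ v ⊎ z ≼ x)

  IsLca : Fin n → Fin n → Fin n → Set
  IsLca a x y = (a ≼ x × a ≼ y) × (∀ z → z ≼ x → z ≼ y → z ≼ a)

  Par-unique : ∀ {x y v} → Par x v → Par y v → x ≡ y
  Par-unique ((x≼v , x≢v) , mx) ((y≼v , y≢v) , my) with mx _ y≼v | my _ x≼v
  ... | inj₁ e | _ = ⊥-elim (y≢v e)
  ... | inj₂ _ | inj₁ e = ⊥-elim (x≢v e)
  ... | inj₂ p | inj₂ q = ≼-antisym q p

  siblings-incomparable : ∀ {x c d} → Par x c → Par x d → c ≼ d → c ≡ d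
  siblings-incomparable ((x≼c , x≢c) , _) ((_ , _) , md) c≼d with md _ c≼d
  ... | inj₁ e = e
  ... | inj₂ c≼x = ⊥-elim (x≢c (≼-antisym x≼c c≼x))

  lowest : ∀ {P : Fin n → Set} {x y} → (∀ z → Dec (P z)) → (∀ {z} → P z → z ≼ y) → P x →
    ∃ λ z → P z × (∀ {z'} → P z' → z' ≼ z)
  lowest P? h p = least {_R_ = λ x y → y ≼ x} P? (λ p q → ≼-trans q p)
    (λ p q → swap (≼-chain (h p) (h q))) p

  highest : ∀ {P : Fin n → Set} {x y} → (∀ z → Dec (P z)) → (∀ {z} → P z → z ≼ y) → P x →
    ∃ λ z → P z × (∀ {z'} → P z' → z ≼ z')
  highest P? h p = least P? ≼-trans (λ p q → ≼-chain (h p) (h q)) p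

  parent : ∀ {v t} → v ≼ t → v ≢ t → ∃ λ x → Par x t × v ≼ x
  parent {v} {t} v≼t v≢t with lowest {P = λ z → z ≼ t × z ≢ t} (λ z → (z ≼? t) ×-dec ¬? (z ≟F t)) proj₁ (v≼t , v≢t)
  ... | x , (x≼t , x≢t) , m = x , ((x≼t , x≢t) , λ z z≼t → below z z≼t) , m (v≼t , v≢t)
    where
    below : ∀ z → z ≼ t → z ≡ t ⊎ z ≼ x
    below z z≼t with z ≟F t
    ... | yes e = inj₁ e
    ... | no ne = inj₂ (m (z≼t , ne))

  child : ∀ {x u} → x ≼ u → x ≢ u → ∃ λ c → Par x c × c ≼ u
  child {x} {u} x≼u x≢u with highest {P = λ z → (x ≼ z × x ≢ z) × z ≼ u}
      (λ z → ((x ≼? z) ×-dec ¬? (x ≟F z)) ×-dec (z ≼? u)) proj₂ ((x≼u , x≢u) , ≼-refl)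
  ... | c , ((x≼c , x≢c) , c≼u) , m = c , ((x≼c , x≢c) , below) , c≼u
    where
    below : ∀ z → z ≼ c → z ≡ c ⊎ z ≼ x
    below z z≼c with ≼-chain z≼c x≼c
    ... | inj₁ z≼x = inj₂ z≼x
    ... | inj₂ x≼z with x ≟F z
    ... | yes refl = inj₂ ≼-refl
    ... | no x≢z = inj₁ (≼-antisym z≼c (m ((x≼z , x≢z) , ≼-trans z≼c c≼u)))

  lca : ∀ x y → ∃ λ a → IsLca a x y
  lca x y with lowest {P = λ z → z ≼ x × z ≼ y} (λ z → (z ≼? x) ×-dec (z ≼? y)) proj₁ (rt≼ x , rt≼ y)
  ... | a , common , m = a , common , λ z p q → m (p , q)

  -- Common ancestors of `x'` and `y'` cannot lie below the point where `x` and `y` separate. This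
  -- is the bridge to the priority order in all cases where the nodes of known priority, or the
  -- marks, lie somewhere below the two branches in question.
  lca-of-descendants : ∀ {x y a x' y'} → ¬ x ≼ y → ¬ y ≼ x → IsLca a x y → x ≼ x' → y ≼ y' → IsLca a x' y'
  lca-of-descendants {x} {y} ¬xy ¬yx ((a≼x , a≼y) , m) x≼x' y≼y' =
    (≼-trans a≼x x≼x' , ≼-trans a≼y y≼y') , below
    where
    below : ∀ z → _ → _ → _
    below z p q with ≼-chain p x≼x' | ≼-chain q y≼y'
    ... | inj₁ z≼x | inj₁ z≼y = m z z≼x z≼y
    ... | inj₁ z≼x | inj₂ y≼z = ⊥-elim (¬yx (≼-trans y≼z z≼x))
    ... | inj₂ x≼z | inj₁ z≼y = ⊥-elim (¬xy (≼-trans x≼z z≼y))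
    ... | inj₂ x≼z | inj₂ y≼z with ≼-chain x≼z y≼z
    ...   | inj₁ xy = ⊥-elim (¬xy xy)
    ...   | inj₂ yx = ⊥-elim (¬yx yx)

module FromTree {k L n : ℕ} (A : Struct (TreeSig k L) n) (K : IsKOTree A) where
  open IsKOTree K

  private
    _↝*_ : Fin n → Fin n → Set
    _↝*_ = Star (Edge A)

    unsnoc : ∀ {x z} → x ↝* z → x ≡ z ⊎ ∃ λ y → x ↝* y × Edge A y z
    unsnoc ε = inj₁ refl
    unsnoc (e ◅ s) with unsnoc s
    ... | inj₁ refl = inj₂ (_ , ε , e)
    ... | inj₂ (y , s' , e') = inj₂ (y , e ◅ s' , e')

    Edge-unique : ∀ {x y v} → Edge A x v → Edge A y v → x ≡ y
    Edge-unique (i , e) (j , e') = proj₂ (parentUniq i j _ _ _ e e')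

    OnCycle : Fin n → Set
    OnCycle x = ∃ λ y → Edge A x y × y ↝* x

    -- The predecessor on a cycle is the unique parent, so the cycle passes through the parent as
    -- well. Pushed up along the path from the root it reaches the root, which has no parent.
    cycle-up : ∀ {x' x} → Edge A x' x → OnCycle x → OnCycle x'
    cycle-up e (y , e' , s) with unsnoc s
    ... | inj₁ refl rewrite Edge-unique e e' = _ , e' , ε
    ... | inj₂ (z , s' , e'') rewrite Edge-unique e e'' = _ , e'' , (e' ◅ s')

    root-acyclic : ¬ OnCycle root
    root-acyclic (y , e , s) with unsnoc s
    ... | inj₁ refl = rootNoPar (proj₁ e) _ (proj₂ e)
    ... | inj₂ (_ , _ , e') = rootNoPar (proj₁ e') _ (proj₂ e')

    cycle-to-top : ∀ {x y} → x ↝* y → OnCycle y → OnCycle x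
    cycle-to-top ε c = c
    cycle-to-top (e ◅ s) c = cycle-up e (cycle-to-top s c)

    acyclic : ∀ x → ¬ OnCycle x
    acyclic x c = root-acyclic (cycle-to-top (proj₁ (ancIsStar _ _) (rootAnc x)) c)

    antisym* : ∀ {x y} → x ↝* y → y ↝* x → x ≡ y
    antisym* ε _ = refl
    antisym* (e ◅ s) t = ⊥-elim (acyclic _ (_ , e , s ◅◅ t))

    chain* : ∀ {x y z} → x ↝* z → y ↝* z → x ↝* y ⊎ y ↝* x
    chain* ε t = inj₂ t
    chain* (e ◅ s) t with chain* s t
    ... | inj₁ s' = inj₁ (e ◅ s')
    ... | inj₂ t' with unsnoc t'
    ... | inj₁ refl = inj₁ (e ◅ ε)
    ... | inj₂ (_ , t'' , e') rewrite Edge-unique e e' = inj₂ t''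

    to : ∀ {x y} → Anc A x y → x ↝* y
    to = proj₁ (ancIsStar _ _)
    from : ∀ {x y} → x ↝* y → Anc A x y
    from = proj₂ (ancIsStar _ _)

  order : TreeOrder n
  order = record
    { _≼_ = Anc A ; _≼?_ = λ x y → T? _
    ; ≼-refl = from ε ; ≼-trans = λ p q → from (to p ◅◅ to q)
    ; ≼-antisym = λ p q → antisym* (to p) (to q)
    ; ≼-chain = λ p q → ⊎-map from from (chain* (to p) (to q))
    ; rt = root ; rt≼ = rootAnc }

  open TreeOrder order using (Par)

  Edge⇒Par : ∀ {x v} → Edge A x v → Par x v
  Edge⇒Par {x} {v} e = (from (e ◅ ε) , λ { refl → acyclic x (_ , e , ε) }) , below
    where
    below : ∀ z → Anc A z v → z ≡ v ⊎ Anc A z x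
    below z p with unsnoc (to p)
    ... | inj₁ q = inj₁ q
    ... | inj₂ (y , s , e') rewrite Edge-unique e e' = inj₂ (from s)

  Par⇒Edge : ∀ {x v} → Par x v → Edge A x v
  Par⇒Edge {x} {v} ((x≼v , x≢v) , m) with unsnoc (to x≼v)
  ... | inj₁ q = ⊥-elim (x≢v q)
  ... | inj₂ (y , s , e) with m y (from (e ◅ ε))
  ... | inj₁ refl = ⊥-elim (acyclic _ (_ , e , ε))
  ... | inj₂ p = subst (λ y → Edge A y v) (antisym* (to p) s) e

-- The depth-first traversal order; siblings are visited in the order of their numbers.
module Preorder {n : ℕ} (O : TreeOrder n) where
  open TreeOrder O

  _≺_ : Fin n → Fin n → Set
  x ≺ y = x ≼ y × x ≢ y

  -- Comparing proper ancestors instead of parents needs no parent to be named and gives an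
  -- equivalence by construction.
  Sibling : Fin n → Fin n → Set
  Sibling a b = ∀ z → (z ≺ a → z ≺ b) × (z ≺ b → z ≺ a)

  infix 4 _⊑_ _⊑?_
  _⊑_ : Fin n → Fin n → Set
  x ⊑ y = x ≼ y ⊎ ∃ λ a → ∃ λ b → (a ≼ x × b ≼ y) × Sibling a b × toℕ a < toℕ b

  ≺? : ∀ x y → Dec (x ≺ y)
  ≺? x y = (x ≼? y) ×-dec ¬? (x ≟F y)

  _⊑?_ : ∀ x y → Dec (x ⊑ y)
  x ⊑? y = (x ≼? y) ⊎-dec any? λ a → any? λ b → ((a ≼? x) ×-dec (b ≼? y)) ×-dec
    ((all? λ z → (≺? z a →-dec ≺? z b) ×-dec (≺? z b →-dec ≺? z a)) ×-dec (toℕ a <? toℕ b))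

  private
    Left : Fin n → Fin n → Set
    Left x y = ∃ λ a → ∃ λ b → (a ≼ x × b ≼ y) × Sibling a b × toℕ a < toℕ b

    ¬≺-self : ∀ {a} → ¬ a ≺ a
    ¬≺-self (_ , ne) = ne refl

    sib-≡ : ∀ {a b} → Sibling a b → a ≼ b → a ≡ b
    sib-≡ {a} {b} s p with a ≟F b
    ... | yes e = e
    ... | no ne = ⊥-elim (¬≺-self (proj₂ (s a) (p , ne)))

    sib-sym : ∀ {a b} → Sibling a b → Sibling b a
    sib-sym s z = proj₂ (s z) , proj₁ (s z)

    Left-irrefl : ∀ {x} → ¬ Left x x
    Left-irrefl (a , b , (p , q) , s , a<b) with ≼-chain p q
    ... | inj₁ r = <⇒≢ a<b (cong toℕ (sib-≡ s r))
    ... | inj₂ r = <⇒≢ a<b (cong toℕ (sym (sib-≡ (sib-sym s) r)))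

    ≼-Left : ∀ {x y z} → x ≼ y → Left y z → x ⊑ z
    ≼-Left {x} x≼y (a , b , (p , q) , s , a<b) with ≼-chain x≼y p
    ... | inj₂ a≼x = inj₂ (a , b , (a≼x , q) , s , a<b)
    ... | inj₁ x≼a with x ≟F a
    ... | yes refl = inj₂ (a , b , (≼-refl , q) , s , a<b)
    ... | no ne = inj₁ (≼-trans (proj₁ (proj₁ (s x) (x≼a , ne))) q)

    Left-≼ : ∀ {x y z} → Left x y → y ≼ z → Left x z
    Left-≼ (a , b , (p , q) , r) y≼z = a , b , (p , ≼-trans q y≼z) , r

    Left-trans : ∀ {x y z} → Left x y → Left y z → Left x z
    Left-trans {x} {y} {z} (a , b , (a≼x , b≼y) , s , a<b) (b' , c , (b'≼y , c≼z) , s' , b'<c)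
      with b ≟F b'
    ... | yes refl = a , c , (a≼x , c≼z) , (λ w → proj₁ (s' w) ∘ proj₁ (s w) , proj₂ (s w) ∘ proj₂ (s' w)) , <-trans a<b b'<c
    ... | no ne with ≼-chain b≼y b'≼y
    ... | inj₁ b≼b' = a , b , (a≼x , ≼-trans (proj₁ (proj₁ (s' b) (b≼b' , ne))) c≼z) , s , a<b
    ... | inj₂ b'≼b = b' , c , (≼-trans (proj₁ (proj₂ (s b') (b'≼b , ne ∘ sym))) a≼x , c≼z) , s' , b'<c

    highest-difference : ∀ {x y} → ¬ x ≼ y → ∃ λ a → (a ≼ x × ¬ a ≼ y) × (∀ {z} → z ≼ x × ¬ z ≼ y → a ≼ z)
    highest-difference {x} {y} ¬p = highest (λ z → (z ≼? x) ×-dec ¬? (z ≼? y)) proj₁ (≼-refl , ¬p)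

  ⊑-refl : ∀ {x} → x ⊑ x
  ⊑-refl = inj₁ ≼-refl

  ⊑-trans : ∀ {x y z} → x ⊑ y → y ⊑ z → x ⊑ z
  ⊑-trans (inj₁ p) (inj₁ q) = inj₁ (≼-trans p q)
  ⊑-trans (inj₁ p) (inj₂ q) = ≼-Left p q
  ⊑-trans (inj₂ p) (inj₁ q) = inj₂ (Left-≼ p q)
  ⊑-trans (inj₂ p) (inj₂ q) = inj₂ (Left-trans p q)

  ⊑-antisym : ∀ {x y} → x ⊑ y → y ⊑ x → x ≡ y
  ⊑-antisym (inj₁ p) (inj₁ q) = ≼-antisym p q
  ⊑-antisym (inj₁ p) (inj₂ q) = ⊥-elim (Left-irrefl (Left-≼ q p))
  ⊑-antisym (inj₂ p) (inj₁ q) = ⊥-elim (Left-irrefl (Left-≼ p q))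
  ⊑-antisym (inj₂ p) (inj₂ q) = ⊥-elim (Left-irrefl (Left-trans p q))

  -- The highest ancestor of `x` that is not an ancestor of `y` and the highest ancestor of `y` that
  -- is not an ancestor of `x` are siblings, and their numbers decide.
  ⊑-total : ∀ x y → x ⊑ y ⊎ y ⊑ x
  ⊑-total x y with x ≼? y | y ≼? x
  ... | yes p | _ = inj₁ (inj₁ p)
  ... | no _ | yes q = inj₂ (inj₁ q)
  ... | no ¬p | no ¬q with highest-difference ¬p | highest-difference ¬q
  ... | a , (a≼x , a⋠y) , ma | b , (b≼y , b⋠x) , mb = by-numbers (<-cmp (toℕ a) (toℕ b))
    where
    half : ∀ {a b x y} → a ≼ x → (∀ {z} → z ≼ x × ¬ z ≼ y → a ≼ z) → b ≼ y → ¬ b ≼ x → ∀ {z} → z ≺ a → z ≺ b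
    half {a} {b} {x} {y} a≼x ma b≼y b⋠x {z} (p , ne) with z ≼? y
    ... | no nq = ⊥-elim (ne (≼-antisym p (ma (≼-trans p a≼x , nq))))
    ... | yes q with ≼-chain b≼y q
    ... | inj₁ b≼z = ⊥-elim (b⋠x (≼-trans b≼z (≼-trans p a≼x)))
    ... | inj₂ z≼b = z≼b , λ { refl → b⋠x (≼-trans p a≼x) }
    sib : Sibling a b
    sib z = half a≼x ma b≼y b⋠x , half b≼y mb a≼x a⋠y
    by-numbers : Tri (toℕ a < toℕ b) (toℕ a ≡ toℕ b) (toℕ b < toℕ a) → x ⊑ y ⊎ y ⊑ x
    by-numbers (tri< a<b _ _) = inj₁ (inj₂ (a , b , (a≼x , b≼y) , sib , a<b))
    by-numbers (tri≈ _ e _) = ⊥-elim (a⋠y (subst (_≼ y) (sym (toℕ-injective e)) b≼y))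
    by-numbers (tri> _ _ b<a) = inj₂ (inj₂ (b , a , (b≼y , a≼x) , sib-sym sib , b<a))

  -- Subtrees are intervals of the preorder: if `z` branched off to the right of `x`, all nodes
  -- after `z` would do so too, in particular `y`, which lies below `x`.
  ⊑-convex : ∀ {x z y} → x ⊑ z → z ⊑ y → x ≼ y → x ≼ z
  ⊑-convex (inj₁ p) _ _ = p
  ⊑-convex (inj₂ p) (inj₁ q) r = ⊥-elim (Left-irrefl (≼-L r (Left-≼ p q)))
    where
    ≼-L : ∀ {x y} → x ≼ y → Left x y → Left y y
    ≼-L r (a , b , (p , q) , s) = a , b , (≼-trans p r , q) , s
  ⊑-convex (inj₂ p) (inj₂ q) r with Left-trans p q
  ... | a , b , (p , q) , s = ⊥-elim (Left-irrefl (a , b , (≼-trans p r , q) , s))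

-- Numbers whose last binary digits are ones.

odd? : ℕ → Bool
odd? x = testBit x 0

odd-half : ∀ x → T (odd? x) → x ≡ suc (2 * ⌊ x /2⌋)
odd-half (suc zero) _ = refl
odd-half (suc (suc x)) h = trans (cong (2 +_) (odd-half x h)) (cong (2 +_) (sym (+-suc ⌊ x /2⌋ (⌊ x /2⌋ + 0))))

even-half : ∀ x → ¬ T (odd? x) → x ≡ 2 * ⌊ x /2⌋
even-half zero _ = refl
even-half (suc zero) h = ⊥-elim (h tt)
even-half (suc (suc x)) h = trans (cong (2 +_) (even-half x h)) (cong suc (sym (+-suc ⌊ x /2⌋ (⌊ x /2⌋ + 0))))

odd-1+2* : ∀ m → T (odd? (suc (2 * m)))
odd-1+2* zero = tt
odd-1+2* (suc m) = subst (λ k → T (odd? (suc (suc k)))) (sym (+-suc m (m + 0))) (odd-1+2* m)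

⌊1+2*m/2⌋ : ∀ m → ⌊ suc (2 * m) /2⌋ ≡ m
⌊1+2*m/2⌋ zero = refl
⌊1+2*m/2⌋ (suc m) = trans (cong (λ k → ⌊ suc (suc k) /2⌋) (+-suc m (m + 0))) (cong suc (⌊1+2*m/2⌋ m))

-- Ones rather than zeros: `suc y` is a positive multiple of `2 ^ l`, so for `y < n` the level is
-- bounded by `2 ^ l ≤ n`. With zeros, `y = 0` would belong to every level.
Ones : ℕ → ℕ → Set
Ones l y = ∀ j → j < l → T (testBit y j)

ones⇒multiple : ∀ l y → Ones l y → ∃ λ q → suc y ≡ 2 ^ l * q
ones⇒multiple zero y h = suc y , sym (+-identityʳ _)
ones⇒multiple (suc l) y h with ones⇒multiple l ⌊ y /2⌋ (λ j j<l → h (suc j) (s≤s j<l))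
... | q , e = q , (begin
    suc y                     ≡⟨ cong suc (odd-half y (h 0 (s≤s z≤n))) ⟩
    suc (suc (2 * ⌊ y /2⌋))   ≡⟨ *-suc 2 ⌊ y /2⌋ ⟨
    2 * suc ⌊ y /2⌋           ≡⟨ cong (2 *_) e ⟩
    2 * (2 ^ l * q)           ≡⟨ *-assoc 2 (2 ^ l) q ⟨
    2 ^ suc l * q             ∎)
  where open ≡-Reasoning

multiple⇒ones : ∀ l y q → suc y ≡ 2 ^ l * q → Ones l y
multiple⇒ones (suc l) y q e j j<l = bit j j<l
  where
  nonzero : ∃ λ m → 2 ^ l * q ≡ suc m
  nonzero with 2 ^ l * q in r
  ... | suc m = m , refl
  ... | zero with trans e (trans (*-assoc 2 (2 ^ l) q) (cong (2 *_) r))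
  ... | ()
  m = proj₁ nonzero
  y≡ : y ≡ suc (2 * m)
  y≡ = suc-injective (trans e (trans (*-assoc 2 (2 ^ l) q) (trans (cong (2 *_) (proj₂ nonzero)) (*-suc 2 m))))
  half≡ : ⌊ y /2⌋ ≡ m
  half≡ = trans (cong ⌊_/2⌋ y≡) (⌊1+2*m/2⌋ m)
  bit : ∀ j → j < suc l → T (testBit y j)
  bit zero _ = subst (T ∘ odd?) (sym y≡) (odd-1+2* m)
  bit (suc j) (s≤s j<l) = multiple⇒ones l ⌊ y /2⌋ q (trans (cong suc half≡) (sym (proj₂ nonzero))) j j<l

ones-pred : ∀ l y → Ones (suc l) y → Ones l y
ones-pred l y h j j<l = h j (m≤n⇒m≤1+n j<l)

module _ where
  open ≤-Reasoning

  ones-in-window : ∀ l y → ∃ λ z → (y ≤ z × z < y + 2 ^ l) × Ones l z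
  ones-in-window zero y = y , (≤-refl , ≤-reflexive (+-comm 1 y)) , λ _ ()
  ones-in-window (suc l) y with ones-in-window l ⌊ y /2⌋
  ... | z , (lo , hi) , o = suc (2 * z) , (lo' , hi') , o'
    where
    q,e = ones⇒multiple l z o
    lo' : y ≤ suc (2 * z)
    lo' with T? (odd? y)
    ... | yes h = begin
      y                     ≡⟨ odd-half y h ⟩
      suc (2 * ⌊ y /2⌋)     ≤⟨ s≤s (*-monoʳ-≤ 2 lo) ⟩
      suc (2 * z)           ∎
    ... | no h = begin
      y                     ≡⟨ even-half y h ⟩
      2 * ⌊ y /2⌋           ≤⟨ *-monoʳ-≤ 2 lo ⟩
      2 * z                 ≤⟨ n≤1+n _ ⟩
      suc (2 * z)           ∎
    half≤ : 2 * ⌊ y /2⌋ ≤ y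
    half≤ with T? (odd? y)
    ... | yes h = ≤-trans (n≤1+n _) (≤-reflexive (sym (odd-half y h)))
    ... | no h = ≤-reflexive (sym (even-half y h))
    hi' : suc (suc (2 * z)) ≤ y + 2 ^ suc l
    hi' = begin
      suc (suc (2 * z))              ≡⟨ *-suc 2 z ⟨
      2 * suc z                      ≤⟨ *-monoʳ-≤ 2 hi ⟩
      2 * (⌊ y /2⌋ + 2 ^ l)          ≡⟨ *-distribˡ-+ 2 ⌊ y /2⌋ (2 ^ l) ⟩
      2 * ⌊ y /2⌋ + 2 ^ suc l        ≤⟨ +-monoˡ-≤ (2 ^ suc l) half≤ ⟩
      y + 2 ^ suc l                  ∎
    o' : Ones (suc l) (suc (2 * z))
    o' = multiple⇒ones (suc l) _ (proj₁ q,e) (trans (sym (*-suc 2 z)) (trans (cong (2 *_) (proj₂ q,e)) (sym (*-assoc 2 (2 ^ l) (proj₁ q,e)))))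

  -- At `l = 0` one of two consecutive numbers is odd. Above, both ends are odd and halving them
  -- lowers the level by one; `2 * z + 1` leads back.
  ones-between : ∀ l y y' → Ones l y → Ones l y' → y < y' →
    ∃ λ z → (y ≤ z × z ≤ y') × Ones (suc l) z
  ones-between zero y y' _ _ y<y' with ones-in-window 1 y
  ... | z , (lo , hi) , o = z , (lo , ≤-trans (≤-pred (≤-trans hi (≤-reflexive (+-comm y 2)))) y<y') , o
  ones-between (suc l) y y' o o' y<y'
    with ones-between l ⌊ y /2⌋ ⌊ y' /2⌋ (λ j p → o (suc j) (s≤s p)) (λ j p → o' (suc j) (s≤s p)) halves
    where
    halves : ⌊ y /2⌋ < ⌊ y' /2⌋
    halves = *-cancelˡ-< 2 _ _ (s≤s⁻¹ (subst₂ _<_ (odd-half y (o 0 (s≤s z≤n))) (odd-half y' (o' 0 (s≤s z≤n))) y<y'))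
  ... | z , (lo , hi) , oz = suc (2 * z) ,
      ( ≤-trans (≤-reflexive (odd-half y (o 0 (s≤s z≤n)))) (s≤s (*-monoʳ-≤ 2 lo))
      , ≤-trans (s≤s (*-monoʳ-≤ 2 hi)) (≤-reflexive (sym (odd-half y' (o' 0 (s≤s z≤n)))))) , oz'
    where
    q,e = ones⇒multiple (suc l) z oz
    oz' : Ones (suc (suc l)) (suc (2 * z))
    oz' = multiple⇒ones (suc (suc l)) _ (proj₁ q,e) (trans (sym (*-suc 2 z)) (trans (cong (2 *_) (proj₂ q,e)) (sym (*-assoc 2 (2 ^ suc l) (proj₁ q,e)))))

-- Marks: thinning out the preorder with the majority quantifier.

true-or-false : ∀ b → b ≡ true ⊎ b ≡ false
true-or-false true = inj₁ refl
true-or-false false = inj₂ refl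

-- Marks are thinned out dyadically.  Counting up to n with the majority quantifier needs room for padding, so the
-- nodes are split into two classes of about n/2 nodes each, and a node is compared with the other class.
module Marks {n : ℕ} (O : TreeOrder n) where
  open TreeOrder O
  open Preorder O

  class : Fin n → Bool
  class x = odd? (toℕ x)

  -- A record keeps the two nodes visible to unification; a bare pair of implications between
  -- booleans would hide them.
  record _~_ (x y : Fin n) : Set where
    constructor same-class
    field class-⇔ : T (class x) ⇔ T (class y)
  open _~_ public

  ~-dec : ∀ x y → Dec (x ~ y)
  ~-dec x y = map′ same-class class-⇔ ((T? _ →-dec T? _) ×-dec (T? _ →-dec T? _))

  ~-refl : ∀ {x} → x ~ x
  ~-refl = same-class (id , id)
  ~-sym : ∀ {x y} → x ~ y → y ~ x
  ~-sym (same-class (f , g)) = same-class (g , f)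
  ~-trans : ∀ {x y z} → x ~ y → y ~ z → x ~ z
  ~-trans (same-class (f , g)) (same-class (h , k)) = same-class (h ∘ f , g ∘ k)
  ~-≡ : ∀ {x y} → class x ≡ class y → x ~ y
  ~-≡ e = same-class (subst T e , subst T (sym e))

  before : Fin n → Fin n → Bool
  before v x = isYes (~-dec x v ×-dec (x ⊑? v))

  beyond : Fin n → ℕ → Fin n → Bool
  beyond v y x = isYes (¬? (~-dec x v) ×-dec (y ≤? toℕ x))

  open ≤-Reasoning

  abstract
    position : Fin n → ℕ
    position v = # (before v)

    padding : Fin n → ℕ → ℕ
    padding v y = # (beyond v y)

    position-mono : ∀ {u v} → u ~ v → u ⊑ v → position u ≤ position v
    position-mono {u} {v} e p = count-mono (before u) (before v) (λ x t → let (a , b) = toWitness t in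
      fromWitness (~-trans a e , ⊑-trans b p)) (allFin n)

    position-strict : ∀ {u v} → u ~ v → u ⊑ v → u ≢ v → position u < position v
    position-strict {u} {v} e p ne = count-strict (before u) (before v) (λ x t → let (a , b) = toWitness t in
      fromWitness (~-trans a e , ⊑-trans b p)) (∈-allFin v)
      (λ t → ne (⊑-antisym p (proj₂ (toWitness t)))) (fromWitness (~-refl , ⊑-refl))

    padding-antitone : ∀ {v y y'} → y' ≤ y → padding v y ≤ padding v y'
    padding-antitone {v} {y} {y'} p = count-mono (beyond v y) (beyond v y') (λ x t → let (a , b) = toWitness t in
      fromWitness (a , ≤-trans p b)) (allFin n)

    padding-cong : ∀ {u v} → u ~ v → ∀ y → padding u y ≡ padding v y
    padding-cong {u} {v} e y = count-cong (beyond u y) (beyond v y) (λ x →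
      (λ t → let (a , b) = toWitness t in fromWitness ((λ c → a (~-trans c (~-sym e))) , b)) ,
      (λ t → let (a , b) = toWitness t in fromWitness ((λ c → a (~-trans c e)) , b))) (allFin n)

    padding-step : ∀ v y → padding v y ≤ suc (padding v (suc y))
    padding-step v y = begin
      padding v y                          ≡⟨ count-∪ at (beyond v (suc y)) (beyond v y) split apart (allFin n) ⟩
      # at + padding v (suc y)             ≤⟨ +-monoˡ-≤ _ (#≤ {f = at} at-one) ⟩
      suc (padding v (suc y))              ∎
      where
      at : Fin n → Bool
      at x = isYes (¬? (~-dec x v) ×-dec (toℕ x ≟ y))
      split : ∀ x → T (beyond v y x) ⇔ (T (at x) ⊎ T (beyond v (suc y) x))
      split x = to , [ (λ t → let (a , b) = toWitness t in fromWitness (a , ≤-reflexive (sym b)))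
                     , (λ t → let (a , b) = toWitness t in fromWitness (a , <⇒≤ b)) ]′
        where
        to : T (beyond v y x) → T (at x) ⊎ T (beyond v (suc y) x)
        to t with toWitness t
        ... | a , b with m≤n⇒m<n∨m≡n b
        ... | inj₁ c = inj₂ (fromWitness (a , c))
        ... | inj₂ c = inj₁ (fromWitness (a , sym c))
      apart : ∀ x → T (at x) → ¬ T (beyond v (suc y) x)
      apart x t t' = <-irrefl (sym (proj₂ (toWitness t))) (proj₂ (toWitness t'))
      at-one : AtMost (T ∘ at) 1
      at-one = atMost-ℕ (λ _ → 0) (λ _ → s≤s z≤n)
        (λ p q _ → toℕ-injective (trans (proj₂ (toWitness p)) (sym (proj₂ (toWitness q)))))

    padding-end : ∀ v → padding v n ≡ 0
    padding-end v = count-none (beyond v n) (λ x t → <⇒≱ (toℕ<n x) (proj₂ (toWitness t))) (allFin n)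

    padding-positive : ∀ v y → 0 < padding v y → y < n
    padding-positive v y h with y <? n
    ... | yes p = p
    ... | no p = ⊥-elim (<⇒≱ h (≤-trans (padding-antitone {v} (≮⇒≥ p)) (≤-reflexive (padding-end v))))

    own : Fin n → Fin n → Bool
    own v x = isYes (~-dec x v)

    own≤ : ∀ v → # (own v) ≤ ⌈ n /2⌉
    own≤ v = #≤ {f = own v} (atMost-ℕ (λ {x} _ → ⌊ toℕ x /2⌋)
      (λ {x} _ → half< (toℕ x) (toℕ<n x)) (λ {x} {x'} p q → same (~-trans (toWitness p) (~-sym (toWitness q)))))
      where
      half< : ∀ x {n} → x < n → ⌊ x /2⌋ < ⌈ n /2⌉
      half< x x<n = ⌊n/2⌋-mono (s≤s x<n)
      same : ∀ {x x'} → x ~ x' → ⌊ toℕ x /2⌋ ≡ ⌊ toℕ x' /2⌋ → x ≡ x'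
      same {x} {x'} (same-class (f , g)) e with T? (class x)
      ... | yes h = toℕ-injective (trans (odd-half (toℕ x) h) (trans (cong (λ k → suc (2 * k)) e) (sym (odd-half (toℕ x') (f h)))))
      ... | no h = toℕ-injective (trans (even-half (toℕ x) h) (trans (cong (2 *_) e) (sym (even-half (toℕ x') (h ∘ g)))))

    position≤ : ∀ v → position v ≤ ⌈ n /2⌉
    position≤ v = ≤-trans (count-mono (before v) (own v) (λ x t → fromWitness (proj₁ (toWitness t))) (allFin n)) (own≤ v)

    ≤padding : ∀ v → ⌊ n /2⌋ ≤ padding v 0
    ≤padding v = +-cancelʳ-≤ ⌈ n /2⌉ _ _ (begin
      ⌊ n /2⌋ + ⌈ n /2⌉          ≡⟨ ⌊n/2⌋+⌈n/2⌉≡n n ⟩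
      n                          ≡⟨ length-tabulate id ⟨
      length (allFin n)          ≡⟨ count-all (λ _ → true) (λ _ → tt) (allFin n) ⟨
      # (λ (_ : Fin n) → true)   ≡⟨ count-∪ (beyond v 0) (own v) (λ _ → true) split (λ x t t' → proj₁ (toWitness t) (toWitness t')) (allFin n) ⟩
      padding v 0 + # (own v)    ≤⟨ +-monoʳ-≤ (padding v 0) (own≤ v) ⟩
      padding v 0 + ⌈ n /2⌉      ∎)
      where
      split : ∀ x → T true ⇔ (T (beyond v 0 x) ⊎ T (own v x))
      split x = (λ _ → which) , λ _ → tt
        where
        which : T (beyond v 0 x) ⊎ T (own v x)
        which with ~-dec x v
        ... | yes _ = inj₂ tt
        ... | no _ = inj₁ tt

    position+padding : ∀ v y (f : Fin n → Bool) →
      (∀ x → T (f x) ⇔ ((x ~ v × x ⊑ v) ⊎ (¬ x ~ v × y ≤ toℕ x))) → # f ≡ position v + padding v y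
    position+padding v y f h = count-∪ (before v) (beyond v y) f
      (λ x → ⊎-map fromWitness fromWitness ∘ proj₁ (h x) , proj₂ (h x) ∘ ⊎-map toWitness toWitness)
      (λ x t t' → proj₁ (toWitness t') (proj₁ (toWitness t))) (allFin n)

  -- `padding` depends only on the class of `v` and does not increase with `y`. Within a class this
  -- therefore says that the position of `v` exceeds a threshold which does not decrease with `y`.
  Majority : Fin n → ℕ → Set
  Majority v y = n < 2 * (position v + padding v y)

  MarkedBy : Fin n → ℕ → Set
  MarkedBy v y = Majority v y × (∀ u → (u ~ v × u ⊑ v) × Majority u y → u ≡ v)

  Mark : ℕ → Fin n → Set
  Mark l v = ∃ λ (y : Fin n) → Ones l (toℕ y) × MarkedBy v (toℕ y)

  Majority? : ∀ v y → Dec (Majority v y)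
  Majority? v y = n <? _

  Mark? : ∀ l v → Dec (Mark l v)
  Mark? l v = any? λ y → Ones? l (toℕ y) ×-dec (Majority? v (toℕ y) ×-dec
      all? λ u → ((~-dec u v ×-dec (u ⊑? v)) ×-dec Majority? u (toℕ y)) →-dec (u ≟F v))
    where
    Ones? : ∀ l y → Dec (Ones l y)
    Ones? l y = map′ (λ h j j<l → subst (T ∘ testBit y) (toℕ-fromℕ< j<l) (h (fromℕ< j<l)))
      (λ h j → h (toℕ j) (toℕ<n j)) (all? {n = l} λ j → T? (testBit y (toℕ j)))

  Mark-pred : ∀ {l v} → Mark (suc l) v → Mark l v
  Mark-pred {l} (y , o , m) = y , ones-pred l _ o , m

  Majority-mono : ∀ {u v y} → u ~ v → u ⊑ v → Majority u y → Majority v y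
  Majority-mono {u} {v} {y} e p m = ≤-trans m (*-monoʳ-≤ 2 (+-mono-≤ (position-mono e p) (≤-reflexive (padding-cong e y))))

  Majority-antitone : ∀ {v y y'} → y' ≤ y → Majority v y → Majority v y'
  Majority-antitone {v} p m = ≤-trans m (*-monoʳ-≤ 2 (+-monoʳ-≤ (position v) (padding-antitone {v} p)))

  markedBy-first : ∀ {u v y} → MarkedBy v y → u ~ v → Majority u y → v ⊑ u
  markedBy-first {u} {v} (_ , first) e m with ⊑-total u v
  ... | inj₂ q = q
  ... | inj₁ q = subst (_⊑ u) (first u ((e , q) , m)) ⊑-refl

  marked : ∀ {v y} → Majority v y → ∃ λ u → u ~ v × MarkedBy u y
  marked {v} {y} m with least {P = λ u → u ~ v × Majority u y} {_R_ = _⊑_}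
      (λ u → ~-dec u v ×-dec Majority? u y) ⊑-trans (λ {x} {z} _ _ → ⊑-total x z) (~-refl , m)
  ... | u , (e , mu) , first = u , e , mu , λ w ((e' , p) , mw) → ⊑-antisym p (first (~-trans e' e , mw))

  -- A mark is the first node of its class that passes some threshold `y`, so `y` and the class
  -- determine it. The thresholds of level `l` satisfy `suc y ≡ 2 ^ l * q` with `1 ≤ q ≤ m`.
  atMost-marks : ∀ l {m} → n < suc m * 2 ^ l → AtMost (Mark l) (2 * m)
  atMost-marks l {m} n< = atMost-fibred {Q = λ y → Ones l (toℕ y)} OfClass cover uniq
    (atMost-ℕ (λ {y} o → quotient (ones⇒multiple l (toℕ y) o)) bound (λ {y} {y'} o o' → same (ones⇒multiple l (toℕ y) o) (ones⇒multiple l (toℕ y') o')))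
    where
    OfClass : Fin 2 → Fin n → Fin n → Set
    OfClass zero v y = T (class v) × MarkedBy v (toℕ y)
    OfClass (suc _) v y = ¬ T (class v) × MarkedBy v (toℕ y)
    cover : ∀ {v} → Mark l v → Σ (Fin 2) λ i → Σ (Fin n) λ y → Ones l (toℕ y) × OfClass i v y
    cover {v} (y , o , m) = by-class (T? (class v))
      where
      by-class : Dec (T (class v)) → _
      by-class (yes c) = zero , y , o , c , m
      by-class (no c) = suc zero , y , o , c , m
    first-≡ : ∀ {v v' y} → v ~ v' → MarkedBy v y → MarkedBy v' y → v ≡ v'
    first-≡ e m m' = ⊑-antisym (markedBy-first m (~-sym e) (proj₁ m')) (markedBy-first m' e (proj₁ m))
    uniq : ∀ i {v v' y} → OfClass i v y → OfClass i v' y → v ≡ v'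
    uniq zero (c , m) (c' , m') = first-≡ (same-class ((λ _ → c') , λ _ → c)) m m'
    uniq (suc _) (c , m) (c' , m') = first-≡ (same-class ((λ d → ⊥-elim (c d)) , λ d → ⊥-elim (c' d))) m m'
    quotient : ∀ {y} → (∃ λ q → suc y ≡ 2 ^ l * q) → ℕ
    quotient (q , _) = q ∸ 1
    positive : ∀ {y} q → suc y ≡ 2 ^ l * q → ∃ λ q' → q ≡ suc q'
    positive zero e with trans e (*-zeroʳ (2 ^ l))
    ... | ()
    positive (suc q) e = q , refl
    bound : ∀ {y : Fin n} (o : Ones l (toℕ y)) → quotient (ones⇒multiple l (toℕ y) o) < m
    bound {y} o with ones⇒multiple l (toℕ y) o
    ... | q , e with positive q e
    ... | q' , refl = ≤-pred (*-cancelˡ-< (2 ^ l) _ _ (≤-<-trans (≤-trans (≤-reflexive (sym e)) (toℕ<n y))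
        (<-≤-trans n< (≤-reflexive (*-comm (suc m) (2 ^ l))))))
    same : ∀ {y y' : Fin n} (w : ∃ λ q → suc (toℕ y) ≡ 2 ^ l * q) (w' : ∃ λ q → suc (toℕ y') ≡ 2 ^ l * q) →
      quotient w ≡ quotient w' → y ≡ y'
    same (q , e) (q' , e') r with positive q e | positive q' e'
    ... | p , refl | p' , refl = toℕ-injective (suc-injective (trans e (trans (cong (λ k → 2 ^ l * suc k) r) (sym e'))))

  Mark⇒2^l≤n : ∀ {l v} → Mark l v → 2 ^ l ≤ n
  Mark⇒2^l≤n {l} (y , o , _) with ones⇒multiple l (toℕ y) o
  ... | zero , e with trans e (*-zeroʳ (2 ^ l))
  ... | ()
  Mark⇒2^l≤n {l} (y , o , _) | suc q , e = ≤-trans (m≤m+n (2 ^ l) (2 ^ l * q))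
    (≤-trans (≤-reflexive (trans (sym (*-suc (2 ^ l) q)) (sym e))) (toℕ<n y))

  private
    discrete-ivt : ∀ (f : ℕ → ℕ) {c} → (∀ y → f y ≤ suc (f (suc y))) → ∀ m → c ≤ f 0 → f m ≤ c → ∃ λ y → f y ≡ c
    discrete-ivt f slow zero lo hi = 0 , ≤-antisym hi lo
    discrete-ivt f {c} slow (suc m) lo hi with m≤n⇒m<n∨m≡n hi
    ... | inj₂ e = suc m , e
    ... | inj₁ lt = discrete-ivt f slow m lo (≤-trans (slow m) lt)

  -- Take `y` such that `u` just fails to have a majority, and a threshold `z` of level `l` among
  -- the next `2 ^ l` numbers. Going from `y` to `z` loses fewer than `2 ^ l` padding nodes, while
  -- `v` is more than `2 ^ l` positions ahead of `u`. So `v` passes `z` and `u` does not, and the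
  -- first node of the class to pass lies between them.
  mark-in-gap : ∀ l {u v} → u ~ v → u ⊑ v → position u + 2 ^ l < position v →
    ∃ λ w → (w ~ v × Mark l w) × u ⊑ w × w ⊑ v
  mark-in-gap l {u} {v} e p far = found
    where
    H = ⌊ n /2⌋
    near-half : ⌈ n /2⌉ ≤ suc H
    near-half = ⌊n/2⌋-mono (n≤1+n (suc n))
    -- Positions are at most `suc H`; the strict inequality in `far` makes up for the difference.
    room : position u + 2 ^ l ≤ H
    room = ≤-pred (≤-trans far (≤-trans (position≤ v) near-half))
    -- With this padding the count for `u` is exactly `⌊ n /2⌋`, the largest count that is not a
    -- majority.
    c = H ∸ position u
    u≤H : position u ≤ H
    u≤H = ≤-trans (m≤m+n _ _) room
    2^l≤c : 2 ^ l ≤ c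
    2^l≤c = m+n≤o⇒m≤o∸n (2 ^ l) (≤-trans (≤-reflexive (+-comm (2 ^ l) (position u))) room)
    onset : ∃ λ y → padding u y ≡ c
    onset = discrete-ivt (padding u) (padding-step u) n (≤-trans (m∸n≤m H (position u)) (≤padding u))
      (≤-trans (≤-reflexive (padding-end u)) z≤n)
    y = proj₁ onset
    drop : ∀ d → c ≤ padding u (d + y) + d
    drop zero = ≤-reflexive (trans (sym (proj₂ onset)) (sym (+-identityʳ _)))
    drop (suc d) = begin
      c                                  ≤⟨ drop d ⟩
      padding u (d + y) + d              ≤⟨ +-monoˡ-≤ d (padding-step u (d + y)) ⟩
      suc (padding u (suc d + y)) + d    ≡⟨ +-suc _ d ⟨
      padding u (suc d + y) + suc d      ∎
    window = ones-in-window l y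
    z = proj₁ window
    y≤z = proj₁ (proj₁ (proj₂ window))
    d = z ∸ y
    d+y≡z : d + y ≡ z
    d+y≡z = m∸n+n≡m y≤z
    d<2^l : d < 2 ^ l
    d<2^l = +-cancelʳ-≤ y _ _ (begin
      suc d + y   ≡⟨ cong suc d+y≡z ⟩
      suc z       ≤⟨ proj₂ (proj₁ (proj₂ window)) ⟩
      y + 2 ^ l   ≡⟨ +-comm y (2 ^ l) ⟩
      2 ^ l + y   ∎)
    c≤ : c ≤ padding u z + d
    c≤ = subst (λ k → c ≤ padding u k + d) d+y≡z (drop d)
    -- At least `2 ^ l` padding nodes are left at `y`, and fewer are lost up to `z`. So some remain,
    -- and `z` is the number of a node, as a quantified threshold has to be.
    z<n : z < n
    z<n = padding-positive u z (+-cancelʳ-≤ d _ _ (≤-trans d<2^l (≤-trans 2^l≤c c≤)))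
    2H≤n : 2 * H ≤ n
    2H≤n = begin
      H + (H + 0)     ≡⟨ cong (H +_) (+-identityʳ H) ⟩
      H + H           ≤⟨ +-monoʳ-≤ H (⌊n/2⌋≤⌈n/2⌉ n) ⟩
      H + ⌈ n /2⌉     ≡⟨ ⌊n/2⌋+⌈n/2⌉≡n n ⟩
      n               ∎
    n<2[1+H] : n < 2 * suc H
    n<2[1+H] = begin
      suc n                   ≡⟨ cong suc (⌊n/2⌋+⌈n/2⌉≡n n) ⟨
      suc (H + ⌈ n /2⌉)       ≤⟨ s≤s (+-monoʳ-≤ H near-half) ⟩
      suc H + suc H           ≡⟨ cong (suc H +_) (+-identityʳ (suc H)) ⟨
      2 * suc H               ∎
    major : Majority v z
    major = ≤-trans n<2[1+H] (*-monoʳ-≤ 2 (begin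
      suc H                                 ≡⟨ cong suc (m+[n∸m]≡n u≤H) ⟨
      suc (position u + c)                  ≤⟨ s≤s (+-monoʳ-≤ (position u) c≤) ⟩
      suc (position u + (padding u z + d))  ≡⟨ cong (λ k → suc (position u + k)) (+-comm _ d) ⟩
      suc (position u + (d + padding u z))  ≡⟨ cong suc (+-assoc (position u) d _) ⟨
      suc (position u + d) + padding u z    ≤⟨ +-monoˡ-≤ _ (≤-trans (s≤s (+-monoʳ-≤ (position u) (<⇒≤ d<2^l))) far) ⟩
      position v + padding u z              ≡⟨ cong (position v +_) (padding-cong e z) ⟩
      position v + padding v z              ∎))
    minor : ¬ Majority u z
    minor m = <⇒≱ m (begin
      2 * (position u + padding u z)  ≤⟨ *-monoʳ-≤ 2 (+-monoʳ-≤ (position u) (begin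
        padding u z   ≤⟨ padding-antitone {u} y≤z ⟩
        padding u y   ≡⟨ proj₂ onset ⟩
        c             ∎)) ⟩
      2 * (position u + c)            ≡⟨ cong (2 *_) (m+[n∸m]≡n u≤H) ⟩
      2 * H                           ≤⟨ 2H≤n ⟩
      n                               ∎)
    ones-z : Ones l z
    ones-z = proj₂ (proj₂ window)
    found : ∃ λ w → (w ~ v × Mark l w) × u ⊑ w × w ⊑ v
    found with marked {v} {z} major
    ... | w , w~v , mw = w , (w~v , fromℕ< z<n , subst (Ones l) (sym (toℕ-fromℕ< z<n)) ones-z
                                  , subst (MarkedBy w) (sym (toℕ-fromℕ< z<n)) mw)
      , above , markedBy-first mw (~-sym w~v) major
      where
      above : u ⊑ w
      above with ⊑-total u w
      ... | inj₁ q = q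
      ... | inj₂ q = ⊥-elim (minor (Majority-mono (~-trans w~v (~-sym e)) q (proj₁ mw)))

  -- A lower threshold is passed no later, hence `y < y'`. Between them, ends included, lies a
  -- threshold of the next level, and the node that passes it first lies between `v` and `v'`; it
  -- may be one of the two.
  mark-between : ∀ l {v v'} → v ~ v' → v ⊑ v' → v ≢ v' → Mark l v → Mark l v' →
    ∃ λ w → Mark (suc l) w × v ⊑ w × w ⊑ v'
  mark-between l {v} {v'} e p ne (y , o , m) (y' , o' , m')
    with ones-between l (toℕ y) (toℕ y') o o' y<y'
    where
    y<y' : toℕ y < toℕ y'
    y<y' with toℕ y <? toℕ y'
    ... | yes q = q
    ... | no q = ⊥-elim (ne (⊑-antisym p (markedBy-first m' e (Majority-antitone {v} (≮⇒≥ q) (proj₁ m)))))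
  ... | z , (lo , hi) , oz with marked {v'} {z} (Majority-antitone {v'} hi (proj₁ m'))
  ... | w , w~v' , mw = w
    , (fromℕ< z<n , subst (Ones (suc l)) (sym (toℕ-fromℕ< z<n)) oz , subst (MarkedBy w) (sym (toℕ-fromℕ< z<n)) mw)
    , markedBy-first m (~-trans w~v' (~-sym e)) (Majority-antitone {w} lo (proj₁ mw))
    , markedBy-first mw (~-sym w~v') (Majority-antitone {v'} hi (proj₁ m'))
    where
    z<n : z < n
    z<n = ≤-<-trans hi (toℕ<n y')

  Convex : (Fin n → Set) → Set
  Convex S = ∀ {u z w} → S u → S w → u ⊑ z → z ⊑ w → S z

  module _ {S : Fin n → Set} (convex : Convex S) where
    -- In each class, elements are numbered by their distance from the first element in `S`. A
    -- distance above `2 ^ l` would produce a mark of level `l` in between, and convexity places it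
    -- in `S`.
    convex-unmarked : (∀ x → Dec (S x)) → ∀ {l} → (∀ {x} → S x → ¬ Mark l x) → AtMost S (2 * suc (2 ^ l))
    convex-unmarked S? {l} unmarked = atMost-≤ (≤-reflexive (cong (suc (2 ^ l) +_) (sym (+-identityʳ _))))
      (atMost-∪ by-class (bound true) (bound false))
      where
      In : Bool → Fin n → Set
      In c x = S x × class x ≡ c
      by-class : ∀ {x} → S x → In true x ⊎ In false x
      by-class {x} s = ⊎-map (s ,_) (s ,_) (true-or-false (class x))
      In? : ∀ c x → Dec (In c x)
      In? c x = S? x ×-dec (class x ≟B c)
      after : ∀ {c u} → In c u → (∀ {x} → In c x → u ⊑ x) → AtMost (In c) (suc (2 ^ l))
      bound : ∀ c → AtMost (In c) (suc (2 ^ l))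
      bound c = by-emptiness (any? (In? c))
        where
        by-emptiness : Dec (∃ (In c)) → AtMost (In c) (suc (2 ^ l))
        by-emptiness (no none) = record { idx = λ p → ⊥-elim (none (_ , p)) ; inj = λ p → ⊥-elim (none (_ , p)) }
        by-emptiness (yes (_ , p)) = let (u , q , first) = least {_R_ = _⊑_} (In? c) ⊑-trans (λ {x} {y} _ _ → ⊑-total x y) p
          in after q first
      after {c} {u} (su , cu) first = atMost-ℕ (λ {x} _ → position x ∸ position u) near
          (λ q q' r → same q q' (∸-cancelʳ-≡ (lower q) (lower q') r))
        where
        alike : ∀ {x y} → In c x → In c y → x ~ y
        alike (_ , e) (_ , e') = ~-≡ (trans e (sym e'))
        lower : ∀ {x} → In c x → position u ≤ position x
        lower q = position-mono (alike (su , cu) q) (first q)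
        near : ∀ {x} (q : In c x) → position x ∸ position u < suc (2 ^ l)
        near {x} q = by-distance (position u + 2 ^ l <? position x)
          where
          by-distance : Dec (position u + 2 ^ l < position x) → position x ∸ position u < suc (2 ^ l)
          by-distance (no ¬far) = s≤s (≤-trans (∸-monoˡ-≤ (position u) (≮⇒≥ ¬far)) (≤-reflexive (m+n∸m≡n (position u) (2 ^ l))))
          by-distance (yes far) = let (w , (_ , mw) , lo , hi) = mark-in-gap l (alike (su , cu) q) (first q) far
            in ⊥-elim (unmarked (convex su (proj₁ q) lo hi) mw)
        same : ∀ {x y} → In c x → In c y → position x ≡ position y → x ≡ y
        same {x} {y} q q' e with x ≟F y
        ... | yes r = r
        ... | no ne with ⊑-total x y
        ... | inj₁ le = ⊥-elim (<⇒≢ (position-strict (alike q q') le ne) e)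
        ... | inj₂ le = ⊥-elim (<⇒≢ (position-strict (alike q' q) le (ne ∘ sym)) (sym e))

    -- One mark per class, since two of them would enclose a mark of the next level, again inside
    -- `S`.
    convex-marks : ∀ {l} → (∀ {x} → S x → ¬ Mark (suc l) x) → AtMost (λ x → S x × Mark l x) 2
    convex-marks {l} unmarked = atMost-∪ by-class (bound true) (bound false)
      where
      In : Bool → Fin n → Set
      In c x = (S x × Mark l x) × class x ≡ c
      by-class : ∀ {x} → S x × Mark l x → In true x ⊎ In false x
      by-class {x} s = ⊎-map (s ,_) (s ,_) (true-or-false (class x))
      same : ∀ {c x y} → In c x → In c y → x ⊑ y → x ≡ y
      same {x = x} {y} ((sx , mx) , ex) ((sy , my) , ey) p = by-equality (x ≟F y)
        where
        by-equality : Dec (x ≡ y) → x ≡ y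
        by-equality (yes r) = r
        by-equality (no ne) = let (w , mw , lo , hi) = mark-between l (~-≡ (trans ex (sym ey))) p ne mx my
          in ⊥-elim (unmarked (convex sx sy lo hi) mw)
      bound : ∀ c → AtMost (In c) 1
      bound c = record { idx = λ _ → zero ; inj = λ {x} {y} p q _ → [ same p q , (λ r → sym (same q p r)) ]′ (⊑-total x y) }

-- Priority orders, and the levels that define one.

-- `lca-⪰` alone ties the order to the tree. Laminarity, decomposition and normal form hold for
-- every such order; the particular one built from levels enters only in the bounds on depth and
-- number of classes.
record Priority {n : ℕ} (O : TreeOrder n) : Set₁ where
  open TreeOrder O
  infix 4 _⪰_ _≻_
  field
    _⪰_      : Fin n → Fin n → Set
    _⪰?_     : ∀ x y → Dec (x ⪰ y)
    ⪰-trans  : ∀ {x y z} → x ⪰ y → y ⪰ z → x ⪰ z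
    ⪰-antisym : ∀ {x y} → x ⪰ y → y ⪰ x → x ≡ y
    ⪰-total  : ∀ x y → x ⪰ y ⊎ y ⪰ x
    lca-⪰    : ∀ {a x y} → IsLca a x y → a ⪰ x ⊎ a ⪰ y

  _≻_ : Fin n → Fin n → Set
  x ≻ y = ¬ y ⪰ x

  ≻⇒⪰ : ∀ {x y} → x ≻ y → x ⪰ y
  ≻⇒⪰ {x} {y} p = [ id , (λ q → ⊥-elim (p q)) ]′ (⪰-total x y)

  ⪰∧≢⇒≻ : ∀ {x y} → x ⪰ y → x ≢ y → x ≻ y
  ⪰∧≢⇒≻ p ne q = ne (⪰-antisym p q)

module Levels {n : ℕ} (O : TreeOrder n) where
  open TreeOrder O
  open Preorder O
  open Marks O

  Level : ℕ → Fin n → Set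
  Level l x = ∃ λ m → ∃ λ m' → (Mark l m × Mark l m') × IsLca x m m'

  abstract
    IsLca? : ∀ a x y → Dec (IsLca a x y)
    IsLca? a x y = ((a ≼? x) ×-dec (a ≼? y)) ×-dec all? λ z → (z ≼? x) →-dec ((z ≼? y) →-dec (z ≼? a))

    Level? : ∀ l x → Dec (Level l x)
    Level? l x = any? λ m → any? λ m' → (Mark? l m ×-dec Mark? l m') ×-dec IsLca? x m m'

  Level-pred : ∀ {l x} → Level (suc l) x → Level l x
  Level-pred (m , m' , (p , p') , a) = m , m' , (Mark-pred p , Mark-pred p') , a

  Level-down : ∀ {l l' x} → l ≤ l' → Level l' x → Level l x
  Level-down {l} {l'} le c = go (l' ∸ l) (subst (λ k → Level k _) (sym (m∸n+n≡m le)) c)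
    where
    go : ∀ d {x} → Level (d + l) x → Level l x
    go zero c = c
    go (suc d) c = go d (Level-pred c)

  Level⇒2^l≤n : ∀ {l x} → Level l x → 2 ^ l ≤ n
  Level⇒2^l≤n (_ , _ , (p , _) , _) = Mark⇒2^l≤n p

  Level⇒<n : ∀ {l x} → Level l x → l < n
  Level⇒<n {l} c = <-≤-trans (l<2^l l) (Level⇒2^l≤n c)
    where
    l<2^l : ∀ l → l < 2 ^ l
    l<2^l zero = s≤s z≤n
    l<2^l (suc l) = +-mono-≤ (m^n>0 2 l) (≤-trans (l<2^l l) (≤-reflexive (sym (+-identityʳ _))))

  Mark⇒Level : ∀ {l x} → Mark l x → Level l x
  Mark⇒Level m = _ , _ , (m , m) , (≼-refl , ≼-refl) , λ _ p _ → p

  -- If `x` and `y` are comparable, `a` is one of them. Otherwise a mark below `x` and a mark below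
  -- `y` have the same lowest common ancestor as `x` and `y`.
  Level-lca : ∀ {l a x y} → IsLca a x y → Level l x → Level l y → Level l a
  Level-lca {l} {a} {x} {y} i c@(m , _ , (mk , _) , (x≼m , _) , _) c'@(m' , _ , (mk' , _) , (y≼m' , _) , _) =
    cases (x ≼? y) (y ≼? x)
    where
    cases : Dec (x ≼ y) → Dec (y ≼ x) → Level l a
    cases (yes p) _ = subst (Level l) (≼-antisym (proj₂ i _ ≼-refl p) (proj₁ (proj₁ i))) c
    cases (no _) (yes p) = subst (Level l) (≼-antisym (proj₂ i _ p ≼-refl) (proj₂ (proj₁ i))) c'
    cases (no p) (no q) = m , m' , (mk , mk') , lca-of-descendants p q i x≼m y≼m'

  -- Levels are closed downwards, so the first alternative compares highest levels and the second
  -- settles ties. The level is an element of `Fin n` so that a formula can quantify over it; by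
  -- `Level⇒<n` no level is missed.
  _⪰ˡ_ : Fin n → Fin n → Set
  x ⪰ˡ y = (∃ λ (l : Fin n) → Level (toℕ l) x × ¬ Level (toℕ l) y) ⊎
           ((∀ (l : Fin n) → Level (toℕ l) y → Level (toℕ l) x) × x ⊑ y)

  Level-⪰ : ∀ {l x y} → x ⪰ˡ y → Level l y → Level l x
  Level-⪰ {l} {x} (inj₁ (k , cx , ¬cy)) c with ≤-total l (toℕ k)
  ... | inj₁ p = Level-down p cx
  ... | inj₂ p = ⊥-elim (¬cy (Level-down p c))
  Level-⪰ {l} {x} (inj₂ (h , _)) c =
    subst (λ k → Level k x) (toℕ-fromℕ< _) (h (fromℕ< (Level⇒<n c)) (subst (λ k → Level k _) (sym (toℕ-fromℕ< _)) c))

  private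
    difference : ∀ x y → (∃ λ (l : Fin n) → Level (toℕ l) x × ¬ Level (toℕ l) y) ⊎ (∀ (l : Fin n) → Level (toℕ l) x → Level (toℕ l) y)
    difference x y = cases (any? λ l → Level? (toℕ l) x ×-dec ¬? (Level? (toℕ l) y))
      where
      cases : Dec (∃ λ (l : Fin n) → Level (toℕ l) x × ¬ Level (toℕ l) y) → _
      cases (yes d) = inj₁ d
      cases (no nd) = inj₂ λ l c → inner l c (Level? (toℕ l) y)
        where
        inner : ∀ l → Level (toℕ l) x → Dec (Level (toℕ l) y) → Level (toℕ l) y
        inner l c (yes q) = q
        inner l c (no nq) = ⊥-elim (nd (l , c , nq))

    trans' : ∀ {x y z} → x ⪰ˡ y → y ⪰ˡ z → x ⪰ˡ z
    trans' p (inj₁ (l , cy , ¬cz)) = inj₁ (l , Level-⪰ p cy , ¬cz)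
    trans' (inj₁ (l , cx , ¬cy)) (inj₂ (h , _)) = inj₁ (l , cx , ¬cy ∘ h l)
    trans' (inj₂ (h , q)) (inj₂ (h' , q')) = inj₂ ((λ l c → h l (h' l c)) , ⊑-trans q q')

    antisym' : ∀ {x y} → x ⪰ˡ y → y ⪰ˡ x → x ≡ y
    antisym' (inj₁ (l , cx , ¬cy)) q = ⊥-elim (¬cy (Level-⪰ q cx))
    antisym' p@(inj₂ _) (inj₁ (l , cy , ¬cx)) = ⊥-elim (¬cx (Level-⪰ p cy))
    antisym' (inj₂ (_ , p)) (inj₂ (_ , q)) = ⊑-antisym p q

    total' : ∀ x y → x ⪰ˡ y ⊎ y ⪰ˡ x
    total' x y with difference x y | difference y x
    ... | inj₁ d | _ = inj₁ (inj₁ d)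
    ... | inj₂ _ | inj₁ d = inj₂ (inj₁ d)
    ... | inj₂ h | inj₂ h' = ⊎-map (λ p → inj₂ (h' , p)) (λ p → inj₂ (h , p)) (⊑-total x y)

    -- The lower of `x` and `y` has only levels that the other one has too, so `a` inherits them by
    -- `Level-lca`. The tie goes to `a` because ancestors come first in preorder.
    lca' : ∀ {a x y} → IsLca a x y → a ⪰ˡ x ⊎ a ⪰ˡ y
    lca' {a} {x} {y} i with total' x y
    ... | inj₁ p = inj₂ (inj₂ ((λ l c → Level-lca i (Level-⪰ p c) c) , inj₁ (proj₂ (proj₁ i))))
    ... | inj₂ p = inj₁ (inj₂ ((λ l c → Level-lca i c (Level-⪰ p c)) , inj₁ (proj₁ (proj₁ i))))

  priority : Priority O
  priority = record
    { _⪰_ = _⪰ˡ_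
    ; _⪰?_ = λ x y → (any? λ l → Level? (toℕ l) x ×-dec ¬? (Level? (toℕ l) y)) ⊎-dec
                     ((all? λ l → Level? (toℕ l) y →-dec Level? (toℕ l) x) ×-dec (x ⊑? y))
    ; ⪰-trans = trans' ; ⪰-antisym = antisym' ; ⪰-total = total' ; lca-⪰ = lca' }

-- Selected patterns: laminarity and decomposition.

-- A pattern is a root together with an optional hole.
module Selection {n : ℕ} (O : TreeOrder n) (R : Priority O) where
  open TreeOrder O
  open Priority R

  Hole : Set
  Hole = Maybe (Fin n)

  Outside : Hole → Fin n → Set
  Outside h u = ∀ w → h ≡ just w → ¬ w ≼ u

  In : Fin n → Hole → Fin n → Set
  In v h u = v ≼ u × Outside h u

  Outside? : ∀ h u → Dec (Outside h u)
  Outside? nothing u = yes λ _ ()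
  Outside? (just w) u = map′ (λ { p _ refl → p }) (λ p → p w refl) (¬? (w ≼? u))

  In? : ∀ v h u → Dec (In v h u)
  In? v h u = (v ≼? u) ×-dec Outside? h u

  -- `HoleDominates` with `ParentDominates` describes a component of the nodes below some priority:
  -- all neighbours outside are higher. `HoleDominates` with `RootDominates` describes the part of a
  -- component below its highest node. `Cut` describes a node `v` with all its branches except the
  -- one that contains a node higher than `v`. None of the conditions refers to other patterns, so
  -- each is a first-order formula over the priority order.
  HoleBelow HoleDominates RootDominates ParentDominates Cut Selected : Fin n → Hole → Set
  HoleBelow v h = ∀ w → h ≡ just w → v ≼ w × v ≢ w
  HoleDominates v h = ∀ w → h ≡ just w → ∀ u → In v h u → w ≻ u
  RootDominates v h = ∀ u → In v h u → v ⪰ u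
  ParentDominates v h = ∀ x → Par x v → ∀ u → In v h u → x ≻ u
  Cut v h = ∃ λ w → h ≡ just w × Par v w × ∃ λ u → w ≼ u × u ≻ v
  Selected v h = HoleBelow v h × ((HoleDominates v h × (RootDominates v h ⊎ ParentDominates v h)) ⊎ Cut v h)

  root-In : ∀ {v h} → HoleBelow v h → In v h v
  root-In hb = ≼-refl , λ w e p → proj₂ (hb w e) (≼-antisym (proj₁ (hb w e)) p)

  In-lower-root : ∀ {v t h u} → v ≼ t → In t h u → In v h u
  In-lower-root v≼t (p , o) = ≼-trans v≼t p , o

  child-In : ∀ {v h c u} → (∀ w → h ≡ just w → Par v w) → Par v c → h ≢ just c → c ≼ u → In v h u
  child-In holes pc ne c≼u = ≼-trans (proj₁ (proj₁ pc)) c≼u , apart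
    where
    apart : ∀ w → _ → ¬ w ≼ _
    apart w refl w≼u with ≼-chain w≼u c≼u
    ... | inj₁ p = ne (cong just (siblings-incomparable (holes w refl) pc p))
    ... | inj₂ p = ne (cong just (sym (siblings-incomparable pc (holes w refl) p)))

  -- A covered `u` and the node `e` that exceeds `v` lie in different branches, so `v` is their
  -- lowest common ancestor and is at least as high as one of them. This cannot be `e`.
  Cut⇒RootDominates : ∀ {v h} → Cut v h → RootDominates v h
  Cut⇒RootDominates {v} (w , refl , pw , e , w≼e , e≻v) u (v≼u , out) =
    [ id , (λ p → ⊥-elim (e≻v p)) ]′ (lca-⪰ {v} {u} {e} ((v≼u , ≼-trans (proj₁ (proj₁ pw)) w≼e) , below))
    where
    below : ∀ z → z ≼ u → z ≼ e → z ≼ v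
    below z z≼u z≼e with ≼-chain z≼e w≼e
    ... | inj₂ w≼z = ⊥-elim (out w refl (≼-trans w≼z z≼u))
    ... | inj₁ z≼w with proj₂ pw z z≼w
    ... | inj₁ refl = ⊥-elim (out w refl z≼u)
    ... | inj₂ z≼v = z≼v

  root-or-parent : ∀ {v h} → Selected v h → RootDominates v h ⊎ ParentDominates v h
  root-or-parent (_ , inj₁ (_ , d)) = d
  root-or-parent (_ , inj₂ c) = inj₁ (Cut⇒RootDominates c)

  -- In a component the hole itself exceeds all covered nodes; in a cut the path above the hole
  -- consists of the root alone, whose witness is part of the definition. Both kinds of context are
  -- handled uniformly through this property.
  dominator : ∀ {v w a} → Selected v (just w) → v ≼ a → a ≼ w → a ≢ w → ∃ λ e → w ≼ e × e ≻ a
  dominator {v} {w} {a} (_ , inj₁ (hd , _)) v≼a a≼w a≢w =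
    w , ≼-refl , hd w refl a (v≼a , λ { _ refl p → a≢w (≼-antisym a≼w p) })
  dominator (_ , inj₂ (w , refl , pw , u , w≼u , u≻v)) v≼a a≼w a≢w with proj₂ pw _ a≼w
  ... | inj₁ e = ⊥-elim (a≢w e)
  ... | inj₂ a≼v rewrite ≼-antisym a≼v v≼a = u , w≼u , u≻v

  -- Incomparable holes would branch at a node `a` that is exceeded by a node below either hole,
  -- although `a` is the lowest common ancestor of these two nodes.
  holes-comparable : ∀ {v w w'} → Selected v (just w) → Selected v (just w') → w ≼ w' ⊎ w' ≼ w
  holes-comparable {v} {w} {w'} s s' with w ≼? w' | w' ≼? w
  ... | yes p | _ = inj₁ p
  ... | no _ | yes q = inj₂ q
  ... | no np | no nq with lca w w'
  ... | a , i@((a≼w , a≼w') , m) with m v (proj₁ (proj₁ s w refl)) (proj₁ (proj₁ s' w' refl))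
  ... | v≼a with dominator s v≼a a≼w (λ { refl → np a≼w' }) | dominator s' v≼a a≼w' (λ { refl → nq a≼w })
  ... | e , w≼e , e≻a | e' , w'≼e' , e'≻a with lca-⪰ (lca-of-descendants np nq i w≼e w'≼e')
  ... | inj₁ p = ⊥-elim (e≻a p)
  ... | inj₂ p = ⊥-elim (e'≻a p)

  _⊆ᵖ_ : Fin n × Hole → Fin n × Hole → Set
  (v , h) ⊆ᵖ (v' , h') = ∀ {u} → In v h u → In v' h' u

  -- The second pattern lies inside the first unless it covers the hole `w` of the first. In that
  -- case a common root makes the holes comparable and reverses the inclusion. With different roots,
  -- `w` exceeds both `v'` and the parent of `v'`, yet one of these dominates all that the second
  -- pattern covers, including `w`; a cut has no node strictly between root and hole.
  nested : ∀ {v h v' h'} → Selected v h → Selected v' h' → v ≼ v' → In v h v' →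
    (v' , h') ⊆ᵖ (v , h) ⊎ (v , h) ⊆ᵖ (v' , h')
  nested {h = nothing} s s' v≼v' i = inj₁ λ (p , _) → ≼-trans v≼v' p , λ _ ()
  nested {v} {just w} {v'} {h'} s s' v≼v' (_ , out) with v' ≼? w | Outside? h' w
  ... | no np | _ = inj₁ λ {u} (p , _) → ≼-trans v≼v' p , λ { _ refl w≼u → [ out w refl , np ]′ (≼-chain w≼u p) }
  ... | yes _ | no no' = inj₁ λ {u} (p , o) → ≼-trans v≼v' p , λ { _ refl w≼u → no' (λ w' e q → o w' e (≼-trans q w≼u)) }
  ... | yes v'≼w | yes o' with v ≟F v'
  ... | yes refl = inj₂ λ {u} (p , o) → p , λ { w' refl w'≼u → [ (λ q → o w refl (≼-trans q w'≼u)) , o' w' refl ]′ (holes-comparable s s') }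
  ... | no ne = ⊥-elim (crossing (proj₂ s) (root-or-parent s'))
    where
    -- The hole of the outer pattern would lie properly inside the inner one.
    w∈ : In v' h' w
    w∈ = v'≼w , o'
    crossing : (HoleDominates v (just w) × _) ⊎ Cut v (just w) → RootDominates v' h' ⊎ ParentDominates v' h' → ⊥
    crossing (inj₂ (_ , refl , pw , _)) _ with proj₂ pw v' v'≼w
    ... | inj₁ refl = out w refl ≼-refl
    ... | inj₂ q = ne (≼-antisym v≼v' q)
    crossing (inj₁ (hd , _)) (inj₁ rd) = hd w refl v' (v≼v' , out) (rd w w∈)
    crossing (inj₁ (hd , _)) (inj₂ pd) with parent v≼v' ne
    ... | x , px , v≼x = pd x px w w∈ (≻⇒⪰ (hd w refl x (v≼x , λ { _ refl q → out w refl (≼-trans q (proj₁ (proj₁ px))) })))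

  laminar : ∀ {v h v' h'} → Selected v h → Selected v' h' →
    (∀ u → In v h u → ¬ In v' h' u) ⊎ ((v , h) ⊆ᵖ (v' , h') ⊎ (v' , h') ⊆ᵖ (v , h))
  laminar {v} {h} {v'} {h'} s s' with v ≼? v' | v' ≼? v
  ... | yes p | _ = cases (In? v h v')
    where
    cases : Dec (In v h v') → _
    cases (yes i) = inj₂ (swap (nested s s' p i))
    cases (no ni) = inj₁ λ u (_ , o) (q , _) → ni (p , λ w e r → o w e (≼-trans r q))
  ... | no _ | yes p = cases (In? v' h' v)
    where
    cases : Dec (In v' h' v) → _
    cases (yes i) = inj₂ (nested s' s p i)
    cases (no ni) = inj₁ λ u (q , _) (_ , o) → ni (p , λ w e r → o w e (≼-trans r q))
  ... | no np | no nq = inj₁ λ u (p , _) (q , _) → [ np , nq ]′ (≼-chain p q)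

  region-antisym : ∀ {v h v' h'} → Selected v h → Selected v' h' →
    (v , h) ⊆ᵖ (v' , h') → (v' , h') ⊆ᵖ (v , h) → v ≡ v' × h ≡ h'
  region-antisym {v} {h} {v'} {h'} s s' p q with ≼-antisym (proj₁ (q (root-In (proj₁ s')))) (proj₁ (p (root-In (proj₁ s))))
  ... | refl = refl , holes h h' s s' p q
    where
    hole≼ : ∀ {h w} → Selected v (just w) → (v , h) ⊆ᵖ (v , just w) → ∃ λ w' → h ≡ just w' × w' ≼ w
    hole≼ {nothing} {w} s p = ⊥-elim (proj₂ (p {w} (proj₁ (proj₁ s w refl) , λ _ ())) w refl ≼-refl)
    hole≼ {just w'} {w} s p with w' ≼? w
    ... | yes le = w' , refl , le
    ... | no nle = ⊥-elim (proj₂ (p {w} (proj₁ (proj₁ s w refl) , λ { _ refl → nle })) w refl ≼-refl)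
    holes : ∀ h h' → Selected v h → Selected v h' → (v , h) ⊆ᵖ (v , h') → (v , h') ⊆ᵖ (v , h) → h ≡ h'
    holes nothing nothing _ _ _ _ = refl
    holes h (just w) s s' p q with hole≼ {h} s' p
    ... | w' , refl , w'≼w with hole≼ {just w} s q
    ... | _ , refl , w≼w' = cong just (≼-antisym w'≼w w≼w')
    holes (just w) nothing s s' p q with hole≼ {nothing} s q
    ... | _ , () , _

  data Decomposition (v : Fin n) (h : Hole) : Set where
    split : ∀ t → v ≼ t → v ≢ t → In v h t → (∀ w → h ≡ just w → t ≼ w) →
      Selected v (just t) → Selected t h → Decomposition v h
    leaf : (∀ w → h ≡ just w → Par v w) → RootDominates v h →
      (∀ c → Par v c → h ≢ just c → Selected c nothing) → Decomposition v h

  maximum : ∀ {v h} → HoleBelow v h → ∃ λ t → In v h t × (∀ {u} → In v h u → t ⪰ u)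
  maximum {v} {h} hb = least {_R_ = _⪰_} (In? v h) ⪰-trans (λ {x} {y} _ _ → ⪰-total x y) (root-In hb)

  private
    leaf-children : ∀ {v h} → (∀ w → h ≡ just w → Par v w) → RootDominates v h →
      ∀ c → Par v c → h ≢ just c → Selected c nothing
    leaf-children {v} {h} holes rd c pc ne = (λ _ ()) , inj₁ ((λ _ ()) , inj₂ dom)
      where
      dom : ParentDominates c nothing
      dom x px u (c≼u , _) rewrite Par-unique px pc =
        ⪰∧≢⇒≻ (rd u (child-In holes pc ne c≼u)) (λ { refl → proj₂ (proj₁ pc) (≼-antisym (proj₁ (proj₁ pc)) c≼u) })

    mk-leaf : ∀ {v h} → (∀ w → h ≡ just w → Par v w) → RootDominates v h → Decomposition v h
    mk-leaf holes rd = leaf holes rd (leaf-children holes rd)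

    at-root : ∀ {v} h → HoleBelow v h → HoleDominates v h → RootDominates v h → Decomposition v h
    at-root nothing hb hd rd = mk-leaf (λ _ ()) rd
    at-root {v} (just w) hb hd rd with child (proj₁ (hb w refl)) (proj₂ (hb w refl))
    ... | c , pc , c≼w with c ≟F w
    ... | yes refl = mk-leaf (λ { _ refl → pc }) rd
    -- The root is highest, but the hole is further down than a child. Splitting at the child `c` on
    -- the way to `w` isolates the root with its other branches; the hole `w` is the node that
    -- justifies the `Cut`.
    ... | no c≢w = split c v≼c (proj₂ (proj₁ pc)) (v≼c , λ { _ refl p → c≢w (≼-antisym c≼w p) }) (λ { _ refl → c≼w })
        ((λ { _ refl → proj₁ pc }) , inj₂ (c , refl , pc , w , c≼w , hd w refl v (root-In hb)))
        ((λ { _ refl → c≼w , c≢w }) , inj₁ ((λ { _ refl u i → hd w refl u (In-lower-root v≼c i) }) , inj₂ dom))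
      where
      v≼c : v ≼ c
      v≼c = proj₁ (proj₁ pc)
      dom : ParentDominates c (just w)
      dom x px u i rewrite Par-unique px pc =
        ⪰∧≢⇒≻ (rd u (In-lower-root v≼c i)) (λ { refl → proj₂ (proj₁ pc) (≼-antisym v≼c (proj₁ i)) })

  decompose : ∀ {v h} → Selected v h → Decomposition v h
  decompose (_ , inj₂ c@(w , refl , pw , _)) = mk-leaf (λ { _ refl → pw }) (Cut⇒RootDominates c)
  decompose {v} {h} (hb , inj₁ (hd , d)) with maximum hb
  ... | t , t∈ , top with v ≟F t
  ... | yes refl = at-root h hb hd (λ u i → top i)
  ... | no v≢t = split t (proj₁ t∈) v≢t t∈ t≼hole
      ((λ { _ refl → proj₁ t∈ , v≢t }) , inj₁ ((λ { _ refl u i → ⪰∧≢⇒≻ (top (upper i)) λ { refl → proj₂ i t refl ≼-refl } }) , inj₂ (up d)))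
      ((λ w e → t≼hole w e , λ { refl → proj₂ t∈ w e ≼-refl }) ,
        inj₁ ((λ w e u i → hd w e u (In-lower-root (proj₁ t∈) i)) , inj₁ (λ u i → top (In-lower-root (proj₁ t∈) i))))
    where
    -- The lowest common ancestor `a` of `t` and the hole is covered, hence exceeded by the hole. So
    -- `lca-⪰` leaves only `a ⪰ t`, and as `t` is highest, `a` is `t`.
    t≼hole : ∀ w → h ≡ just w → t ≼ w
    t≼hole w refl with lca t w
    ... | a , i@((a≼t , a≼w) , m) = subst (_≼ w) (⪰-antisym a⪰t (top a∈)) a≼w
      where
      a∈ : In v h a
      a∈ = m v (proj₁ t∈) (proj₁ (hb w refl)) , λ { _ refl p → proj₂ t∈ w refl (≼-trans p a≼t) }
      a⪰t : a ⪰ t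
      a⪰t = [ id , (λ p → ⊥-elim (hd w refl a a∈ p)) ]′ (lca-⪰ i)
    upper : ∀ {u} → In v (just t) u → In v h u
    upper (p , o) = p , λ w e q → o t refl (≼-trans (t≼hole w e) q)
    up : RootDominates v h ⊎ ParentDominates v h → ParentDominates v (just t)
    up (inj₁ rd) = ⊥-elim (v≢t (⪰-antisym (rd t t∈) (top (root-In hb))))
    up (inj₂ pd) x px u i = pd x px u (upper i)

  -- Laminarity is applied to both parts. A pattern disjoint from one part lies in the other, and a
  -- pattern containing both would contain the whole. This shows at once that the parts are direct
  -- subpatterns and that there are no others.
  below-split : ∀ {v h t v' h'} → v ≼ t → In v h t → Selected v (just t) → Selected t h → Selected v' h' →
    (v' , h') ⊆ᵖ (v , h) → ¬ (v , h) ⊆ᵖ (v' , h') → (v' , h') ⊆ᵖ (v , just t) ⊎ (v' , h') ⊆ᵖ (t , h)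
  below-split {v} {h} {t} {v'} {h'} v≼t t∈ s₁ s₂ s r⊆ ¬⊇ with laminar s s₁ | laminar s s₂
  ... | inj₂ (inj₁ p) | _ = inj₁ p
  ... | _ | inj₂ (inj₁ p) = inj₂ p
  ... | inj₁ d | _ = inj₂ λ {u} i → lower u i (r⊆ i)
    where
    lower : ∀ u → In v' h' u → In v h u → In t h u
    lower u i (p , o) with t ≼? u
    ... | yes q = q , o
    ... | no nq = ⊥-elim (d u i (p , λ { _ refl → nq }))
  ... | _ | inj₁ d = inj₁ λ {u} i → let (p , o) = r⊆ i in p , λ { _ refl q → d u i (q , o) }
  ... | inj₂ (inj₂ p) | inj₂ (inj₂ q) = ⊥-elim (¬⊇ λ {u} → both u)
    where
    both : ∀ u → In v h u → In v' h' u
    both u (a , o) with t ≼? u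
    ... | yes b = q (b , o)
    ... | no nb = p (a , λ { _ refl → nb })

  -- A subpattern that keeps the root `v` is the whole pattern. If `h` is empty, a hole would come
  -- with a node exceeding `v`, against `RootDominates`; if `h` is a child of `v`, a hole above it
  -- and properly below `v` can only be that child.
  below-leaf : ∀ {v h v' h'} → Selected v h → (∀ w → h ≡ just w → Par v w) → RootDominates v h → Selected v' h' →
    (v' , h') ⊆ᵖ (v , h) → ¬ (v , h) ⊆ᵖ (v' , h') → ∃ λ c → (Par v c × h ≢ just c) × (v' , h') ⊆ᵖ (c , nothing)
  below-leaf {v} {h} {v'} {h'} s holes rd s' r⊆ ¬⊇ with v ≟F v'
  ... | yes refl = ⊥-elim (¬⊇ (same-root h h' holes rd s' r⊆))
    where
    same-root : ∀ h h' → (∀ w → h ≡ just w → Par v w) → RootDominates v h → Selected v h' →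
      (v , h') ⊆ᵖ (v , h) → (v , h) ⊆ᵖ (v , h')
    same-root h nothing _ _ _ _ (p , _) = p , λ _ ()
    same-root nothing (just w') _ rd s' _ with proj₁ s' w' refl
    ... | v≼w' , ne with dominator s' ≼-refl v≼w' ne
    ... | e , w'≼e , e≻v = ⊥-elim (e≻v (rd e (≼-trans v≼w' w'≼e , λ _ ())))
    same-root (just w) (just w') holes rd s' r⊆ {u} (p , o) = p , λ { _ refl q → o w refl (≼-trans w≼w' q) }
      where
      w'≼w : w' ≼ w
      w'≼w with w' ≼? w
      ... | yes q = q
      ... | no nq = ⊥-elim (proj₂ (r⊆ {w} (proj₁ (proj₁ (holes w refl)) , λ { _ refl → nq })) w refl ≼-refl)
      w≼w' : w ≼ w'
      w≼w' with proj₂ (holes w refl) w' w'≼w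
      ... | inj₁ refl = ≼-refl
      ... | inj₂ q = ⊥-elim (proj₂ (proj₁ s' w' refl) (≼-antisym (proj₁ (proj₁ s' w' refl)) q))
  ... | no ne with r⊆ (root-In (proj₁ s'))
  ... | v≼v' , o with child v≼v' ne
  ... | c , pc , c≼v' = c , (pc , λ { refl → o c refl c≼v' }) , λ (p , _) → ≼-trans c≼v' p , λ _ ()

  below-child : ∀ {c v' h' w'} → Selected v' h' → h' ≡ just w' → (v' , h') ⊆ᵖ (c , nothing) → ¬ (c , nothing) ⊆ᵖ (v' , h')
  below-child {c} {v'} {h'} {w'} s' refl r⊆ ⊇ =
    proj₂ (⊇ {w'} (≼-trans (proj₁ (r⊆ (root-In (proj₁ s')))) (proj₁ (proj₁ s' w' refl)) , λ _ ())) w' refl ≼-refl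

-- The hierarchical definition and its normal form.

pat : ∀ {n} → Fin n → Maybe (Fin n) → Pat n
pat v nothing = spat v
pat v (just w) = cpat v w

patRoot-pat : ∀ {n} (v : Fin n) h → patRoot (pat v h) ≡ v
patRoot-pat v nothing = refl
patRoot-pat v (just w) = refl

module HierarchicalDefinition {k L n : ℕ} (B : Struct (HSig k L) n) (K : IsKOTree (reduct B))
    (R : Priority (FromTree.order (reduct B) K)) where
  open TreeOrder (FromTree.order (reduct B) K)
  open Priority R
  open Selection (FromTree.order (reduct B) K) R

  Cov⇒In : ∀ {v} h {u} → Cov B (pat v h) u → In v h u
  Cov⇒In nothing p = p , λ _ ()
  Cov⇒In (just w) (p , q) = p , λ { _ refl → q }

  In⇒Cov : ∀ {v} h {u} → In v h u → Cov B (pat v h) u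
  In⇒Cov nothing (p , _) = p
  In⇒Cov (just w) (p , o) = p , o w refl

  ≤P⇒⊆ : ∀ {v v'} h h' → _≤P_ B (pat v h) (pat v' h') → (v , h) ⊆ᵖ (v' , h')
  ≤P⇒⊆ h h' p i = Cov⇒In h' (p _ (In⇒Cov h i))

  ⊆⇒≤P : ∀ {v v'} h h' → (v , h) ⊆ᵖ (v' , h') → _≤P_ B (pat v h) (pat v' h')
  ⊆⇒≤P h h' p _ i = In⇒Cov h' (p (Cov⇒In h i))

  Cov? : ∀ p u → Dec (Cov B p u)
  Cov? (spat v) u = v ≼? u
  Cov? (cpat v w) u = (v ≼? u) ×-dec ¬? (w ≼? u)

  ≤P? : ∀ q p → Dec (_≤P_ B q p)
  ≤P? q p = all? λ u → Cov? q u →-dec Cov? p u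

  data AsPat : Pat n → Set where
    mk : ∀ v h → AsPat (pat v h)

  asPat : ∀ p → AsPat p
  asPat (spat v) = mk v nothing
  asPat (cpat v w) = mk v (just w)

  module _ (inP : ∀ v h → InP B (pat v h) ⇔ Selected v h) where
    selected : ∀ {v} h → InP B (pat v h) → Selected v h
    selected h = proj₁ (inP _ h)

    isHierDef : IsHierDef B
    isHierDef = record
      { ctxWF = λ v w i → proj₁ (selected (just w) i) w refl
      -- The whole tree counts as a component: its root has no parent, so `ParentDominates` is
      -- vacuous.
      ; rootIn = λ r top → proj₂ (inP r nothing) ((λ _ ()) , inj₁ ((λ _ ()) , inj₂
          λ x px u _ → ⊥-elim (proj₂ (proj₁ px) (≼-antisym (proj₁ (proj₁ px)) (top x)))))
      ; laminar = lam }
      where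
      lam : ∀ p q → InP B p → InP B q → DisjointP B p q ⊎ (_≤P_ B p q ⊎ _≤P_ B q p)
      lam p q i j with asPat p | asPat q
      ... | mk v h | mk v' h' with laminar (selected h i) (selected h' j)
      ... | inj₁ d = inj₁ λ u a b → d u (Cov⇒In h a) (Cov⇒In h' b)
      ... | inj₂ (inj₁ s) = inj₂ (inj₁ (⊆⇒≤P h h' s))
      ... | inj₂ (inj₂ s) = inj₂ (inj₂ (⊆⇒≤P h' h s))

    ≤P-antisym : ∀ {p q} → InP B p → InP B q → _≤P_ B p q → _≤P_ B q p → p ≡ q
    ≤P-antisym {p} {q} i j p≤q q≤p with asPat p | asPat q
    ... | mk v h | mk v' h' with region-antisym (selected h i) (selected h' j) (≤P⇒⊆ h h' p≤q) (≤P⇒⊆ h' h q≤p)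
    ... | refl , refl = refl

    private
      split-NF2 : ∀ {v h t} → v ≼ t → v ≢ t → In v h t → (∀ w → h ≡ just w → t ≼ w) →
        Selected v (just t) → Selected t h → InP B (pat v h) → NF2 B (pat v h)
      split-NF2 {v} {h} {t} v≼t v≢t t∈ t≼hole s₁ s₂ i =
        upper , lower , direct-upper , direct-lower , (λ e → v≢t (root-≡ h e)) , only , cover , apart
        where
        upper lower : Pat n
        upper = cpat v t
        lower = pat t h
        root-≡ : ∀ h → cpat v t ≡ pat t h → v ≡ t
        root-≡ (just _) refl = refl
        v∉ : ¬ In t h v
        v∉ (p , _) = v≢t (≼-antisym v≼t p)
        cover : ∀ u → Cov B (pat v h) u ⇔ (Cov B upper u ⊎ Cov B lower u)
        cover u = to , [ (λ (p , q) → In⇒Cov h (p , λ w e r → q (≼-trans (t≼hole w e) r)))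
                       , (λ c → In⇒Cov h (In-lower-root v≼t (Cov⇒In h c))) ]′
          where
          to : Cov B (pat v h) u → Cov B upper u ⊎ Cov B lower u
          to c with Cov⇒In h c | t ≼? u
          ... | p , o | yes q = inj₂ (In⇒Cov h (q , o))
          ... | p , o | no nq = inj₁ (p , nq)
        apart : DisjointP B upper lower
        apart u (_ , q) c = q (proj₁ (Cov⇒In h c))
        upper< : _<P_ B upper (pat v h)
        upper< = (λ u c → proj₂ (cover u) (inj₁ c)) , λ p → proj₂ (p t (In⇒Cov h t∈)) ≼-refl
        lower< : _<P_ B lower (pat v h)
        lower< = (λ u c → proj₂ (cover u) (inj₂ c)) , λ p → v∉ (Cov⇒In h (p v (In⇒Cov h (root-In (proj₁ (selected h i))))))
        parts : ∀ r → InP B r → _<P_ B r (pat v h) → _≤P_ B r upper ⊎ _≤P_ B r lower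
        parts r j (p , q) with asPat r
        ... | mk v' h' = ⊎-map (⊆⇒≤P h' (just t)) (⊆⇒≤P h' h)
          (below-split v≼t t∈ s₁ s₂ (selected h' j) (≤P⇒⊆ h' h p) (λ z → q (⊆⇒≤P h h' z)))
        inUpper : InP B upper
        inUpper = proj₂ (inP v (just t)) s₁
        inLower : InP B lower
        inLower = proj₂ (inP t h) s₂
        direct-upper : Direct B upper (pat v h)
        direct-upper = inUpper , upper< , λ (r , j , (ur , ¬ru) , r<) → [ ¬ru ,
          (λ rl → v∉ (Cov⇒In h (rl v (ur v (≼-refl , λ p → v≢t (≼-antisym v≼t p)))))) ]′ (parts r j r<)
        direct-lower : Direct B lower (pat v h)
        direct-lower = inLower , lower< , λ (r , j , (lr , ¬rl) , r<) → [
          (λ ru → proj₂ (ru t (lr t (In⇒Cov h (root-In (proj₁ s₂))))) ≼-refl) , ¬rl ]′ (parts r j r<)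
        only : ∀ q → Direct B q (pat v h) → q ≡ upper ⊎ q ≡ lower
        only q (j , q< , none) = ⊎-map (exactly upper inUpper upper<) (exactly lower inLower lower<) (parts q j q<)
          where
          exactly : ∀ r → InP B r → _<P_ B r (pat v h) → _≤P_ B q r → q ≡ r
          exactly r jr r< q≤r with ≤P? r q
          ... | yes r≤q = ≤P-antisym j jr q≤r r≤q
          ... | no ¬r≤q = ⊥-elim (none (r , jr , (q≤r , ¬r≤q) , r<))

      leaf-NF1 : ∀ {v h} → (∀ w → h ≡ just w → Par v w) → RootDominates v h →
        (∀ c → Par v c → h ≢ just c → Selected c nothing) → InP B (pat v h) → NF1 B (pat v h)
      leaf-NF1 {v} {h} holes rd children i = (λ u → boundary⇒ u , λ { refl → root-boundary }) , subtree
        where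
        s = selected h i
        v∈ : Cov B (pat v h) (patRoot (pat v h))
        v∈ = subst (Cov B (pat v h)) (sym (patRoot-pat v h)) (In⇒Cov h (root-In (proj₁ s)))
        below : ∀ q → InP B q → _<P_ B q (pat v h) → ∃ λ c → (Par v c × h ≢ just c) × _≤P_ B q (spat c)
        below q j (p , np) with asPat q
        ... | mk v' h' with below-leaf s holes rd (selected h' j) (≤P⇒⊆ h' h p) (λ z → np (⊆⇒≤P h h' z))
        ... | c , pc , z = c , pc , ⊆⇒≤P h' nothing z
        child< : ∀ {c} → Par v c → h ≢ just c → _<P_ B (spat c) (pat v h)
        child< {c} pc ne = (λ u p → In⇒Cov h (child-In holes pc ne p)) ,
          λ p → proj₂ (proj₁ pc) (≼-antisym (proj₁ (proj₁ pc)) (p v (In⇒Cov h (root-In (proj₁ s)))))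
        child-direct : ∀ {c} → Par v c → h ≢ just c → Direct B (spat c) (pat v h)
        child-direct {c} pc ne = proj₂ (inP c nothing) (children c pc ne) , child< pc ne , none
          where
          none : ¬ _
          none (r , j , (c≤r , ¬r≤c) , r<) with below r j r<
          ... | c' , (pc' , _) , r≤c' with siblings-incomparable pc' pc (r≤c' c (c≤r c ≼-refl))
          ... | refl = ¬r≤c r≤c'
        root-boundary : Boundary B (pat v h) (patRoot (pat v h))
        root-boundary = v∈ , λ q (j , q< , _) cq → let (c , (pc , _) , q≤c) = below q j q< in
          proj₂ (proj₁ pc) (≼-antisym (proj₁ (proj₁ pc)) (subst (c ≼_) (patRoot-pat v h) (q≤c _ cq)))
        boundary⇒ : ∀ u → Boundary B (pat v h) u → u ≡ patRoot (pat v h)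
        boundary⇒ u (cu , nd) with v ≟F u
        ... | yes e = trans (sym e) (sym (patRoot-pat v h))
        ... | no ne with Cov⇒In h cu
        ... | v≼u , o with child v≼u ne
        ... | c , pc , c≼u = ⊥-elim (nd (spat c) (child-direct pc λ { refl → o c refl c≼u }) c≼u)
        subtree : ∀ q → Direct B q (pat v h) → IsSubtreePat q
        subtree (spat _) _ = tt
        -- A context inside a leaf pattern lies in the subtree of some child, and properly so
        -- because of its hole. The subtree pattern of that child is then strictly between.
        subtree q@(cpat v' w') (j , q< , none) with below q j q<
        ... | c , (pc , ne) , q≤c = none (spat c , proj₂ (inP c nothing) (children c pc ne) ,
          (q≤c , λ z → below-child (selected (just w') j) refl (≤P⇒⊆ (just w') nothing q≤c) (≤P⇒⊆ nothing (just w') z)) ,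
          child< pc ne)

    normalForm : NormalForm B
    normalForm p i with asPat p
    ... | mk v h with decompose (selected h i)
    ... | split t v≼t v≢t t∈ t≼hole s₁ s₂ = inj₂ (split-NF2 v≼t v≢t t∈ t≼hole s₁ s₂ i)
    ... | leaf holes rd children = inj₁ (leaf-NF1 holes rd children i)

-- Nodes and patterns counted by level.

module Sizes {n : ℕ} (O : TreeOrder n) where
  open TreeOrder O
  open Preorder O
  open Marks O using (Mark; Mark?; Convex; convex-unmarked; convex-marks; atMost-marks)
  open Levels O
  open Priority priority
  open Selection O priority

  -- Below a node x of level l that carries no mark, m₀ is the first mark and m is the first mark in another branch.
  record Branching (l : ℕ) (x m₀ c m : Fin n) : Set where
    constructor branching
    field
      c-child  : Par x c
      m₀-mark  : Mark l m₀
      c≼m₀     : c ≼ m₀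
      m₀-first : ∀ {u} → Mark l u → x ≼ u → m₀ ⊑ u
      m-mark   : Mark l m
      x≼m      : x ≼ m
      c⋠m      : ¬ c ≼ m
      m-first  : ∀ {u} → Mark l u → x ≼ u → ¬ c ≼ u → m ⊑ u

  branches : ∀ {l x} → Level l x → ¬ Mark l x → ∃ λ m₀ → ∃ λ c → ∃ λ m → Branching l x m₀ c m
  branches {l} {x} (m₁ , m₂ , (k₁ , k₂) , (x≼m₁ , x≼m₂) , lowest-common) unmarked
    with least {P = λ u → Mark l u × x ≼ u} {_R_ = _⊑_} (λ u → Mark? l u ×-dec (x ≼? u)) ⊑-trans (λ {u} {v} _ _ → ⊑-total u v) (k₁ , x≼m₁)
  ... | m₀ , (k₀ , x≼m₀) , first with child x≼m₀ (λ { refl → unmarked k₀ })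
  ... | c , pc , c≼m₀ = let (u , good) = other (c ≼? m₁) (c ≼? m₂) in
      second (least {P = Other} {_R_ = _⊑_} (λ u → (Mark? l u ×-dec (x ≼? u)) ×-dec ¬? (c ≼? u)) ⊑-trans (λ {u} {v} _ _ → ⊑-total u v) {u} good)
    where
    Other : Fin n → Set
    Other u = (Mark l u × x ≼ u) × ¬ c ≼ u
    other : Dec (c ≼ m₁) → Dec (c ≼ m₂) → ∃ Other
    other (no p) _ = m₁ , (k₁ , x≼m₁) , p
    other (yes _) (no p) = m₂ , (k₂ , x≼m₂) , p
    other (yes p) (yes q) = ⊥-elim (proj₂ (proj₁ pc) (≼-antisym (proj₁ (proj₁ pc)) (lowest-common c p q)))
    second : (∃ λ m → Other m × (∀ {u} → Other u → m ⊑ u)) → ∃ λ m₀ → ∃ λ c → ∃ λ m → Branching l x m₀ c m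
    second (m , ((k , x≼m) , c⋠m) , first') = m₀ , c , m ,
      branching pc k₀ c≼m₀ (λ a b → first (a , b)) k x≼m c⋠m (λ a b d → first' ((a , b) , d))

  module _ {l : ℕ} {v : Fin n} {h : Hole} where
    private
      -- A marked node is charged to itself and an unmarked one to its second mark `m`. If `m` has
      -- fallen into the hole, `m₀` is charged instead: `m₀` is still covered, since the hole cannot
      -- contain marks of two branches of a covered node.
      Kind : Fin 3 → Fin n → Fin n → Set
      Kind zero x b = x ≡ b
      Kind (suc zero) x b = ∃ λ m₀ → ∃ λ c → Branching l x m₀ c b
      Kind (suc (suc _)) x b = In v h x × ∃ λ c → ∃ λ m → Branching l x b c m × ¬ In v h m

      hole≼ : ∀ {x m} → In v h x → x ≼ m → ¬ In v h m → ∃ λ w → h ≡ just w × w ≼ m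
      hole≼ {x} {m} (v≼x , _) x≼m out = at h out
        where
        at : ∀ h → ¬ In v h m → ∃ λ w → h ≡ just w × w ≼ m
        at nothing out = ⊥-elim (out (≼-trans v≼x x≼m , λ _ ()))
        at (just w) out with w ≼? m
        ... | yes p = w , refl , p
        ... | no np = ⊥-elim (out (≼-trans v≼x x≼m , λ { _ refl → np }))

      child≼ : ∀ {x c x'} → Par x c → x ≼ x' → x ≢ x' → c ≼ x' ⊎ x' ≼ c → c ≼ x'
      child≼ pc x≼x' ne (inj₁ p) = p
      child≼ pc x≼x' ne (inj₂ p) with proj₂ pc _ p
      ... | inj₁ refl = ≼-refl
      ... | inj₂ q = ⊥-elim (ne (≼-antisym x≼x' q))

      -- Suppose `x` is properly above `x'`. As `m` is below `x'`, the node `x'` lies outside the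
      -- branch `c`, so `m₀'` is among the marks of which `m` is the first; conversely `m₀'` is the
      -- first mark below `x'`. Hence `m₀'` is `m`, although the two lie in different branches of
      -- `x'`.
      unique₁ : ∀ {x x' m₀ c m₀' c' m} → Branching l x m₀ c m → Branching l x' m₀' c' m → x ≼ x' → x ≡ x'
      unique₁ {x} {x'} {m₀} {c} {m₀'} {c'} {m} b b' x≼x' with x ≟F x'
      ... | yes e = e
      ... | no ne = ⊥-elim (Branching.c⋠m b' (subst (c' ≼_) m₀'≡m (Branching.c≼m₀ b')))
        where
        x'≼m₀' : x' ≼ m₀'
        x'≼m₀' = ≼-trans (proj₁ (proj₁ (Branching.c-child b'))) (Branching.c≼m₀ b')
        c⋠m₀' : ¬ c ≼ m₀'
        c⋠m₀' p = Branching.c⋠m b (≼-trans (child≼ (Branching.c-child b) x≼x' ne (≼-chain p x'≼m₀')) (Branching.x≼m b'))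
        m₀'≡m : m₀' ≡ m
        m₀'≡m = ⊑-antisym (Branching.m₀-first b' (Branching.m-mark b') (Branching.x≼m b'))
          (Branching.m-first b (Branching.m₀-mark b') (≼-trans x≼x' x'≼m₀') c⋠m₀')

      -- Suppose `x` is properly above `x'`. The branch `c` leads through `x'` to `m₀`. Since `m'`
      -- lies in the hole, the hole is below `x'` and thus in the branch `c`; but it also contains
      -- `m`, which is not in this branch.
      unique₂ : ∀ {x x' m₀ c c' m m'} → In v h x → In v h x' → Branching l x m₀ c m → Branching l x' m₀ c' m' →
        ¬ In v h m → ¬ In v h m' → x ≼ x' → x ≡ x'
      unique₂ {x} {x'} i i' b b' o o' x≼x' with x ≟F x'
      ... | yes e = e
      ... | no ne with hole≼ i (Branching.x≼m b) o | hole≼ i' (Branching.x≼m b') o'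
      ... | w , refl , w≼m | _ , refl , w≼m' with ≼-chain (Branching.x≼m b') w≼m'
      ... | inj₂ w≼x' = ⊥-elim (proj₂ i' w refl w≼x')
      ... | inj₁ x'≼w = ⊥-elim (Branching.c⋠m b (≼-trans (≼-trans c≼x' x'≼w) w≼m))
        where
        c≼x' = child≼ (Branching.c-child b) x≼x' ne
          (≼-chain (Branching.c≼m₀ b) (≼-trans (proj₁ (proj₁ (Branching.c-child b'))) (Branching.c≼m₀ b')))

      ordered : ∀ {x x' m} → x ≼ m → x' ≼ m → (x ≼ x' → x ≡ x') → (x' ≼ x → x' ≡ x) → x ≡ x'
      ordered p p' f g = [ f , sym ∘ g ]′ (≼-chain p p')

      unique : ∀ i {x x' b} → Kind i x b → Kind i x' b → x ≡ x'
      unique zero refl refl = refl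
      unique (suc zero) (_ , _ , b) (_ , _ , b') = ordered (Branching.x≼m b) (Branching.x≼m b') (unique₁ b b') (unique₁ b' b)
      unique (suc (suc _)) (i , _ , _ , b , o) (i' , _ , _ , b' , o') =
        ordered (x≼m₀ b) (x≼m₀ b') (unique₂ i i' b b' o o') (unique₂ i' i b' b o' o)
        where
        x≼m₀ : ∀ {x m₀ c m} → Branching l x m₀ c m → x ≼ m₀
        x≼m₀ b = ≼-trans (proj₁ (proj₁ (Branching.c-child b))) (Branching.c≼m₀ b)

      kind : ∀ {x} → In v h x × Level l x → Σ (Fin 3) λ i → Σ (Fin n) λ b → (In v h b × Mark l b) × Kind i x b
      kind {x} (i , lx) = cases (Mark? l x)
        where
        by-position : (∃ λ m₀ → ∃ λ c → ∃ λ m → Branching l x m₀ c m) → Σ (Fin 3) λ i → Σ (Fin n) λ b → (In v h b × Mark l b) × Kind i x b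
        by-position (m₀ , c , m , b) with In? v h m
        ... | yes im = suc zero , m , (im , Branching.m-mark b) , m₀ , c , b
        ... | no om = suc (suc zero) , m₀ , ((v≼m₀ , outside) , Branching.m₀-mark b) , i , c , m , b , om
          where
          x≼c = proj₁ (proj₁ (Branching.c-child b))
          v≼m₀ : v ≼ m₀
          v≼m₀ = ≼-trans (proj₁ i) (≼-trans x≼c (Branching.c≼m₀ b))
          outside : Outside h m₀
          outside w e w≼m₀ with hole≼ i (Branching.x≼m b) om
          ... | w' , e' , w'≼m with trans (sym e) e'
          ... | refl with ≼-chain w≼m₀ (Branching.c≼m₀ b)
          ... | inj₂ c≼w = Branching.c⋠m b (≼-trans c≼w w'≼m)
          ... | inj₁ w≼c with proj₂ (Branching.c-child b) w w≼c
          ... | inj₁ refl = Branching.c⋠m b w'≼m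
          ... | inj₂ w≼x = proj₂ i w e w≼x
        cases : Dec (Mark l x) → Σ (Fin 3) λ i → Σ (Fin n) λ b → (In v h b × Mark l b) × Kind i x b
        cases (yes k) = zero , x , (i , k) , refl
        cases (no nk) = by-position (branches lx nk)

    atMost-levels : ∀ {m} → AtMost (λ x → In v h x × Mark l x) m → AtMost (λ x → In v h x × Level l x) (3 * m)
    atMost-levels = atMost-fibred Kind kind (λ i → unique i)

  -- In preorder a pattern consists of two intervals, one on either side of its hole.
  module _ {v : Fin n} {h : Hole} where
    private
      First Second : Fin n → Set
      First u = In v h u × ∃ λ w → h ≡ just w × u ⊑ w
      Second u = In v h u × ∀ w → h ≡ just w → w ⊑ u

      first-or-second : ∀ {u} → In v h u → First u ⊎ Second u
      first-or-second {u} i = at h refl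
        where
        at : ∀ h' → h ≡ h' → First u ⊎ Second u
        at nothing refl = inj₂ (i , λ _ ())
        at (just w) refl = ⊎-map (λ p → i , w , refl , p) (λ p → i , λ { _ refl → p }) (⊑-total u w)

      First? : ∀ u → Dec (First u)
      First? u = In? v h u ×-dec any? λ w → (≡-dec _≟F_ h (just w)) ×-dec (u ⊑? w)

      Second? : ∀ u → Dec (Second u)
      Second? u = In? v h u ×-dec all? λ w → (≡-dec _≟F_ h (just w)) →-dec (w ⊑? u)

      First-convex : Convex First
      First-convex {u} {z} {x} (iu , _) (ix , w , e , x⊑w) u⊑z z⊑x =
        (⊑-convex (⊑-trans (inj₁ (proj₁ iu)) u⊑z) z⊑x (proj₁ ix) , outside) , w , e , ⊑-trans z⊑x x⊑w
        where
        outside : Outside h z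
        outside w' e' w'≼z with trans (sym e) e'
        ... | refl = proj₂ ix w e (subst (_≼ x) (⊑-antisym x⊑w (⊑-trans (inj₁ w'≼z) z⊑x)) ≼-refl)

      Second-convex : Convex Second
      Second-convex {u} {z} {x} (iu , w⊑u) (ix , _) u⊑z z⊑x =
        (⊑-convex (⊑-trans (inj₁ (proj₁ iu)) u⊑z) z⊑x (proj₁ ix) , outside) , λ w e → ⊑-trans (w⊑u w e) u⊑z
        where
        outside : Outside h z
        outside w e w≼z = proj₂ iu w e (⊑-convex (w⊑u w e) u⊑z w≼z)

    atMost-unmarked : ∀ {l} → (∀ {x} → In v h x → ¬ Mark l x) → AtMost (In v h) (2 * suc (2 ^ l) + 2 * suc (2 ^ l))
    atMost-unmarked un = atMost-∪ first-or-second
      (convex-unmarked First-convex First? (un ∘ proj₁)) (convex-unmarked Second-convex Second? (un ∘ proj₁))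

    atMost-marks-In : ∀ {l} → (∀ {x} → In v h x → ¬ Mark (suc l) x) → AtMost (λ x → In v h x × Mark l x) 4
    atMost-marks-In un = atMost-∪ (λ (i , k) → ⊎-map (_, k) (_, k) (first-or-second i))
      (convex-marks First-convex (un ∘ proj₁)) (convex-marks Second-convex (un ∘ proj₁))

    -- Two intervals with one mark per class in each make four marks, and each mark is charged in
    -- three ways.
    atMost-levels-In : ∀ {l} → (∀ {x} → In v h x → ¬ Level (suc l) x) → AtMost (λ x → In v h x × Level l x) 12
    atMost-levels-In un = atMost-levels (atMost-marks-In (λ i k → un i (Mark⇒Level k)))

  Region : Set
  Region = Fin n × Hole

  SelectedR : Region → Set
  SelectedR (v , h) = Selected v h

  Top : Region → Fin n → Set
  Top (v , h) t = In v h t × ∀ {u} → In v h u → t ⪰ u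

  -- The patterns with a given highest node `t` are the component split at `t`, its part below `t`,
  -- and the cut at `t`. In the first two cases the hole exceeds `t`, so no other pattern with
  -- highest node `t` can cover it; the same holds for the parent of the root of a component. Two
  -- different cuts would have nodes exceeding `t` in two branches of `t`, against `lca-⪰`.
  atMost-by-top : ∀ {P : Region → Set} {Q : Fin n → Set} {m} → (∀ {p} → P p → SelectedR p) →
    (∀ {p t} → P p → Top p t → Q t) → AtMost Q m → AtMost P (3 * m)
  atMost-by-top {P} {Q} sel top = atMost-fibred Kind kind (λ i → unique i)
    where
    Kind : Fin 3 → Region → Fin n → Set
    Kind zero p t = (SelectedR p × Top p t) × proj₁ p ≢ t
    Kind (suc zero) p t = (SelectedR p × Top p t) × proj₁ p ≡ t × HoleDominates (proj₁ p) (proj₂ p)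
    Kind (suc (suc _)) p t = Top p t × proj₁ p ≡ t × Cut (proj₁ p) (proj₂ p)
    kind : ∀ {p} → P p → Σ (Fin 3) λ i → Σ (Fin n) λ t → Q t × Kind i p t
    kind {v , h} x with maximum (proj₁ (sel x))
    ... | t , mx with v ≟F t | proj₂ (sel x)
    ... | no ne | _ = zero , t , top x mx , (sel x , mx) , ne
    ... | yes e | inj₁ (hd , _) = suc zero , t , top x mx , (sel x , mx) , e , hd
    ... | yes e | inj₂ c = suc (suc zero) , t , top x mx , mx , e , c
    same-hole : ∀ {v t} h h' → Top (v , h) t → Top (v , h') t → HoleBelow v h → HoleBelow v h' →
      HoleDominates v h → HoleDominates v h' → h ≡ h'
    same-hole nothing nothing _ _ _ _ _ _ = refl
    same-hole nothing (just w) (_ , mx) (i , _) _ hb _ hd = ⊥-elim (hd w refl _ i (mx (proj₁ (hb w refl) , λ _ ())))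
    same-hole (just w) nothing (i , _) (_ , mx) hb _ hd _ = ⊥-elim (hd w refl _ i (mx (proj₁ (hb w refl) , λ _ ())))
    same-hole (just w) (just w') (i , mx) (i' , mx') hb hb' hd hd' =
      cong just (≼-antisym (side i' mx hb' hd') (side i mx' hb hd))
      where
      side : ∀ {v t w w'} → In v (just w') t → (∀ {u} → In v (just w) u → t ⪰ u) → HoleBelow v (just w') → HoleDominates v (just w') → w ≼ w'
      side {w = w} {w'} i mx hb hd with w ≼? w'
      ... | yes p = p
      ... | no np = ⊥-elim (hd w' refl _ i (mx (proj₁ (hb w' refl) , λ { _ refl → np })))
    unpack : ∀ {v h t} → Selected v h → Top (v , h) t → v ≢ t → HoleDominates v h × ParentDominates v h
    unpack (hb , inj₂ c) (i , mx) ne = ⊥-elim (ne (⪰-antisym (Cut⇒RootDominates c _ i) (mx (root-In hb))))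
    unpack (hb , inj₁ (_ , inj₁ rd)) (i , mx) ne = ⊥-elim (ne (⪰-antisym (rd _ i) (mx (root-In hb))))
    unpack (hb , inj₁ (hd , inj₂ pd)) _ _ = hd , pd
    higher-root : ∀ {v h t v' h'} → HoleBelow v h → Top (v , h) t → In v' h' t → ParentDominates v' h' → v ≼ v' → v ≡ v'
    higher-root {v} {h} {t} {v'} hb (i , mx) i' pd' v≼v' with v ≟F v'
    ... | yes e = e
    ... | no ne with parent v≼v' ne
    ... | x , px , v≼x = ⊥-elim (pd' x px t i' (mx (v≼x , λ w e w≼x → proj₂ i w e (≼-trans w≼x (≼-trans (proj₁ (proj₁ px)) (proj₁ i'))))))
    unique : ∀ i {p p' t} → Kind i p t → Kind i p' t → p ≡ p'
    unique zero {v , h} {v' , h'} ((s , tp) , ne) ((s' , tp') , ne') with unpack s tp ne | unpack s' tp' ne'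
    ... | hd , pd | hd' , pd' with roots
      where
      roots : v ≡ v'
      roots = [ higher-root (proj₁ s) tp (proj₁ tp') pd' , (λ q → sym (higher-root (proj₁ s') tp' (proj₁ tp) pd q)) ]′
        (≼-chain (proj₁ (proj₁ tp)) (proj₁ (proj₁ tp')))
    ... | refl = cong (v ,_) (same-hole h h' tp tp' (proj₁ s) (proj₁ s') hd hd')
    unique (suc zero) {v , h} {.v , h'} ((s , tp) , refl , hd) ((s' , tp') , refl , hd') =
      cong (v ,_) (same-hole h h' tp tp' (proj₁ s) (proj₁ s') hd hd')
    unique (suc (suc _)) {v , h} {.v , h'} (tp , refl , w , refl , pw , u , w≼u , u≻v) (tp' , refl , w' , refl , pw' , u' , w'≼u' , u'≻v) with w ≟F w'
    ... | yes refl = refl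
    ... | no ne with lca-⪰ (lca-of-descendants (λ p → ne (siblings-incomparable pw pw' p)) (λ p → ne (sym (siblings-incomparable pw' pw p)))
          ((proj₁ (proj₁ pw) , proj₁ (proj₁ pw')) , λ z p q → below z p q) w≼u w'≼u')
      where
      below : ∀ z → z ≼ w → z ≼ w' → z ≼ v
      below z p q with proj₂ pw z p
      ... | inj₂ r = r
      ... | inj₁ refl = ⊥-elim (ne (siblings-incomparable pw pw' q))
    ... | inj₁ p = ⊥-elim (u≻v p)
    ... | inj₂ p = ⊥-elim (u'≻v p)

-- Depth, and the numbers of large patterns and of nodes in small ones.

module Ranks {n : ℕ} (O : TreeOrder n)
    (Selected? : ∀ v h → Dec (Selection.Selected O (Levels.priority O) v h)) where
  open TreeOrder O
  open Levels O
  open Marks O using (Mark; atMost-marks)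
  open Priority priority
  open Selection O priority
  open Sizes O
  open +-*-Solver using (con; _:*_; _:=_)

  Hits : ℕ → Region → Set
  Hits l (v , h) = ∃ λ u → In v h u × Level l u

  abstract
    Hits? : ∀ l p → Dec (Hits l p)
    Hits? l (v , h) = any? λ u → In? v h u ×-dec Level? l u

  Hits-⊆ : ∀ {l p q} → p ⊆ᵖ q → Hits l p → Hits l q
  Hits-⊆ s (u , i , c) = u , s i , c

  hits : Region → Fin n → Bool
  hits p l = isYes (Hits? (toℕ l) p)

  abstract
    rank : Region → ℕ
    rank p = # (hits p)

    rank-mono : ∀ {p q} → p ⊆ᵖ q → rank p ≤ rank q
    rank-mono {p} {q} s = count-mono (hits p) (hits q) (λ l t → fromWitness (Hits-⊆ s (toWitness t))) (allFin n)

    rank-≡ : ∀ {p q} → p ⊆ᵖ q → rank p ≡ rank q → ∀ {l} → Hits l q → Hits l p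
    rank-≡ {p} {q} s e {l} hq = cases (Hits? l p)
      where
      l<n : l < n
      l<n = Level⇒<n (proj₂ (proj₂ hq))
      cases : Dec (Hits l p) → Hits l p
      cases (yes hp) = hp
      cases (no np) = ⊥-elim (<⇒≢ (count-strict (hits p) (hits q)
        (λ l t → fromWitness (Hits-⊆ s (toWitness t))) (∈-allFin (fromℕ< l<n))
        (λ t → np (subst (λ k → Hits k p) (toℕ-fromℕ< l<n) (toWitness t)))
        (fromWitness (subst (λ k → Hits k q) (sym (toℕ-fromℕ< l<n)) hq))) e)

    rank≤ : ∀ p → rank p ≤ suc ⌊log₂ n ⌋
    rank≤ p = #≤ {f = hits p} (atMost-ℕ (λ {l} _ → toℕ l)
      (λ {l} t → s≤s (≤-trans (≤-reflexive (sym (⌊log₂[2^n]⌋≡n (toℕ l))))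
        (⌊log₂⌋-mono-≤ (Level⇒2^l≤n (proj₂ (proj₂ (toWitness t)))))))
      (λ _ _ → toℕ-injective))

  highest-hit : ∀ p → (∀ l → ¬ Hits l p) ⊎ ∃ λ l → Hits l p × ¬ Hits (suc l) p
  highest-hit p = search n (λ (_ , _ , c) → <-irrefl refl (Level⇒<n c))
    where
    search : ∀ l → ¬ Hits l p → (∀ l → ¬ Hits l p) ⊎ ∃ λ l → Hits l p × ¬ Hits (suc l) p
    search zero nh = inj₁ λ l (u , i , c) → nh (u , i , Level-down z≤n c)
    search (suc l) nh with Hits? l p
    ... | yes h = inj₂ (l , h , nh)
    ... | no nh' = search l nh'

  Peer : Region → Region → Set
  Peer p q = SelectedR q × (q ⊆ᵖ p × rank q ≡ rank p)

  Peer? : ∀ p q → Dec (Peer p q)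
  Peer? p@(v , h) q@(v' , h') = Selected? v' h' ×-dec
    (map′ (λ f {u} → f u) (λ f u → f {u}) (all? λ u → In? v' h' u →-dec In? v h u) ×-dec (rank q ≟ rank p))

  -- Let `l` be the highest level met by `p`. Peers meet the same levels, so their highest nodes
  -- have level `l`; `p` contains at most 12 such nodes, each of which is highest in at most three
  -- patterns. If no level is met, `p` has no mark of level `0`, hence at most 8 nodes and 24 peers.
  atMost-peers : ∀ p → AtMost (Peer p) 36
  atMost-peers p = cases (highest-hit p)
    where
    cases : (∀ l → ¬ Hits l p) ⊎ (∃ λ l → Hits l p × ¬ Hits (suc l) p) → AtMost (Peer p) 36
    cases (inj₁ none) = atMost-≤ (m≤m+n 24 12) (atMost-by-top {Q = In (proj₁ p) (proj₂ p)} proj₁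
      (λ (_ , s , _) (i , _) → s i) (atMost-unmarked {l = 0} (λ i k → none 0 (_ , i , Mark⇒Level k))))
    cases (inj₂ (l , hit , miss)) = atMost-by-top {Q = λ t → In (proj₁ p) (proj₂ p) t × Level l t} proj₁
      (λ {q} {t} (_ , s , e) (i , mx) → s i , level mx (rank-≡ s e hit)) (atMost-levels-In (λ i c → miss (_ , i , c)))
      where
      level : ∀ {q t} → (∀ {u} → In (proj₁ q) (proj₂ q) u → t ⪰ u) → Hits l q → Level l t
      level mx (u , i , c) = Level-⪰ (mx i) c

  regions : List Region
  regions = cartesianProduct (allFin n) (nothing ∷ map just (allFin n))

  ∈-regions : ∀ p → p ∈ regions
  ∈-regions (v , nothing) = ∈-cartesianProduct⁺ (∈-allFin v) (here refl)
  ∈-regions (v , just w) = ∈-cartesianProduct⁺ (∈-allFin v) (there (∈-map⁺ just (∈-allFin w)))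

  private
    regions-unique : Unique regions
    regions-unique = cartesianProduct⁺ (allFin⁺ n) (All-map⁺ (universal (λ _ ()) (allFin n)) ∷ map⁺ just-injective (allFin⁺ n))

  peer : Region → Region → Bool
  peer p q = isYes (Peer? p q)

  private
    peers≤36 : ∀ p → count (peer p) regions ≤ 36
    peers≤36 p = count≤ (peer p) (atMost-⊆ (λ t → toWitness t) (atMost-peers p)) regions regions-unique

  abstract
    potential : Region → ℕ
    potential p = count (peer p) regions + 36 * rank p

    potential≤ : ∀ p → potential p ≤ 36 + 36 * suc ⌊log₂ n ⌋
    potential≤ p = +-mono-≤ (peers≤36 p) (*-monoʳ-≤ 36 (rank≤ p))

    -- If the rank drops, the 36 lost outweigh the at most 36 peers of `q`, because `p` is a peer of
    -- itself. At equal rank the peers of `q` are peers of `p`, and `p` is one more.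
    potential-strict : ∀ {p q} → SelectedR p → SelectedR q → q ⊆ᵖ p → ¬ p ⊆ᵖ q → potential q < potential p
    potential-strict {p} {q} sp sq q⊆p p⊈q = cases (m≤n⇒m<n∨m≡n (rank-mono q⊆p))
      where
      self : T (peer p p)
      self = fromWitness (sp , (λ {u} i → i) , refl)
      cases : rank q < rank p ⊎ rank q ≡ rank p → potential q < potential p
      cases (inj₁ lt) = ≤-trans (s≤s (+-monoˡ-≤ (36 * rank q) (peers≤36 q)))
        (≤-trans (s≤s (≤-trans (≤-reflexive (sym (*-suc 36 (rank q)))) (*-monoʳ-≤ 36 lt)))
          (+-monoˡ-≤ (36 * rank p) (count-positive (peer p) (∈-regions p) self)))
      cases (inj₂ e) = +-mono-≤ (count-strict (peer q) (peer p)
        (λ r t → let (s , r⊆q , e') = toWitness t in fromWitness (s , (λ {u} i → q⊆p (r⊆q i)) , trans e' e))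
        (∈-regions p) (λ t → p⊈q (proj₁ (proj₂ (toWitness t)))) self) (≤-reflexive (cong (36 *_) e))

  -- The factor 18 consists of three patterns per highest node, three nodes of level `l` per mark,
  -- and two classes of marks.
  atMost-large : ∀ l {m} → n < suc m * 2 ^ l → AtMost (λ p → SelectedR p × Hits l p) (18 * m)
  atMost-large l {m} n< = atMost-≤ {m = 3 * (3 * (2 * m))}
    (≤-reflexive (+-*-Solver.solve 1 (λ m → con 3 :* (con 3 :* (con 2 :* m)) := con 18 :* m) refl m))
    (atMost-by-top {Q = λ t → In rt nothing t × Level l t} proj₁
      (λ (_ , u , i , c) (_ , mx) → (rt≼ _ , λ _ ()) , Level-⪰ (mx i) c)
      (atMost-levels (atMost-⊆ proj₂ (atMost-marks l {m} n<))))

  atMost-small : ∀ {l v h} → ¬ Hits l (v , h) → AtMost (In v h) (8 * 2 ^ l)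
  atMost-small {l} {v} {h} miss = atMost-≤ bound (atMost-unmarked (λ i k → miss (_ , i , Mark⇒Level k)))
    where
    open ≤-Reasoning
    bound : 2 * suc (2 ^ l) + 2 * suc (2 ^ l) ≤ 8 * 2 ^ l
    bound = begin
      2 * suc (2 ^ l) + 2 * suc (2 ^ l)              ≤⟨ +-mono-≤ twice twice ⟩
      4 * 2 ^ l + 4 * 2 ^ l                          ≡⟨ *-distribʳ-+ (2 ^ l) 4 4 ⟨
      8 * 2 ^ l                                      ∎
      where
      twice : 2 * suc (2 ^ l) ≤ 4 * 2 ^ l
      twice = begin
        2 * suc (2 ^ l)              ≤⟨ *-monoʳ-≤ 2 (+-monoˡ-≤ (2 ^ l) (m^n>0 2 l)) ⟩
        2 * (2 ^ l + 2 ^ l)          ≡⟨ cong (λ k → 2 * (2 ^ l + k)) (+-identityʳ (2 ^ l)) ⟨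
        2 * (2 * 2 ^ l)              ≡⟨ *-assoc 2 2 (2 ^ l) ⟨
        4 * 2 ^ l                    ∎

-- Codes of patterns, and the isomorphism between patterns with equal codes.

-- Prefix-free codes for the entries give a prefix-free code for sequences of fixed length.
concat-cancel : ∀ {A : Set} {m} {g g' : Fin m → List A} {P : Fin m → Set} →
  (∀ i {xs xs'} → g i ++ xs ≡ g' i ++ xs' → P i × xs ≡ xs') →
  ∀ {xs xs'} → concat (tabulate g) ++ xs ≡ concat (tabulate g') ++ xs' → (∀ i → P i) × xs ≡ xs'
concat-cancel {m = zero} h e = (λ ()) , e
concat-cancel {m = suc m} {g} {g'} h {xs} {xs'} e
  with h zero (trans (sym (++-assoc (g zero) _ xs)) (trans e (++-assoc (g' zero) _ xs')))
... | p , e' with concat-cancel (h ∘ suc) e'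
... | ps , e'' = (λ { zero → p ; (suc i) → ps i }) , e''

length-concat-tabulate : ∀ {A B : Set} {m} c d (g : Fin m → List A) (g' : Fin m → List B) →
  (∀ i → length (g i) ≤ c + d * length (g' i)) →
  length (concat (tabulate g)) ≤ m * c + d * length (concat (tabulate g'))
length-concat-tabulate {m = zero} c d g g' h = z≤n
length-concat-tabulate {m = suc m} c d g g' h = begin
  length (g zero ++ rest)                                    ≡⟨ length-++ (g zero) ⟩
  length (g zero) + length rest                              ≤⟨ +-mono-≤ (h zero) (length-concat-tabulate c d (g ∘ suc) (g' ∘ suc) (h ∘ suc)) ⟩
  (c + d * a) + (m * c + d * b)                              ≡⟨ rearrange c d m a b ⟩
  suc m * c + d * (a + b)                                    ≡⟨ cong (λ k → suc m * c + d * k) (length-++ (g' zero)) ⟨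
  suc m * c + d * length (g' zero ++ rest')                  ∎
  where
  open ≤-Reasoning
  open +-*-Solver
  rest = concat (tabulate (g ∘ suc))
  rest' = concat (tabulate (g' ∘ suc))
  a = length (g' zero)
  b = length rest'
  rearrange : ∀ c d m a b → (c + d * a) + (m * c + d * b) ≡ suc m * c + d * (a + b)
  rearrange = solve 5 (λ c d m a b → (c :+ d :* a) :+ (m :* c :+ d :* b) := (con 1 :+ m) :* c :+ d :* (a :+ b)) refl

module Encoding {k L n : ℕ} (B : Struct (HSig k L) n) (K : IsKOTree (reduct B))
    (R : Priority (FromTree.order (reduct B) K)) where
  open IsKOTree K using (parentUniq; childUniq)
  open FromTree (reduct B) K using (Edge⇒Par; Par⇒Edge)
  open TreeOrder (FromTree.order (reduct B) K)
  open Selection (FromTree.order (reduct B) K) R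
  open HierarchicalDefinition B K R

  Eᴮ : Fin k → Fin n → Fin n → Set
  Eᴮ = E (reduct B)

  label : Fin n → Fin L → Bool
  label v a = B (tsym (lab a)) (v ∷ [])

  E⇒Par : ∀ {i x y} → Eᴮ i x y → Par x y
  E⇒Par e = Edge⇒Par (_ , e)

  record Splits (v : Fin n) (h : Hole) (t : Fin n) : Set where
    field
      sel    : Selected v h
      v≼t    : v ≼ t
      v≢t    : v ≢ t
      t∈     : In v h t
      t≼hole : ∀ w → h ≡ just w → t ≼ w
      upper  : Selected v (just t)
      lower  : Selected t h

  record IsLeaf (v : Fin n) (h : Hole) : Set where
    field
      sel   : Selected v h
      holes : ∀ w → h ≡ just w → Par v w
      dominates : RootDominates v h

  -- The recursion hidden in `decompose`, unfolded once and for all. Its termination rests on the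
  -- number of covered nodes; everything after `build` is structural.
  data Term : Fin n → Hole → Set
  data Slot (v : Fin n) (h : Hole) (i : Fin k) : Set

  data Term where
    split : ∀ {v h} t → Splits v h t → Term v (just t) → Term t h → Term v h
    leaf  : ∀ {v h} → IsLeaf v h → (∀ i → Slot v h i) → Term v h

  data Slot v h i where
    absent : (∀ c → ¬ Eᴮ i v c) → Slot v h i
    hole   : ∀ c → Eᴮ i v c → h ≡ just c → Slot v h i
    sub    : ∀ c → Eᴮ i v c → h ≢ just c → Selected c nothing → Term c nothing → Slot v h i

  private
    member : Fin n → Hole → Fin n → Bool
    member v h u = isYes (In? v h u)

    smaller : ∀ {v h v' h' u} → (v' , h') ⊆ᵖ (v , h) → In v h u → ¬ In v' h' u → # (member v' h') < # (member v h)
    smaller {v} {h} {v'} {h'} {u} s i o = count-strict (member v' h') (member v h) (λ x t → fromWitness (s (toWitness t)))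
      (∈-allFin u) (λ t → o (toWitness t)) (fromWitness i)

    build : ∀ m {v h} → # (member v h) < m → Selected v h → Term v h
    build (suc m) {v} {h} (s≤s le) s with decompose s
    ... | split t v≼t v≢t t∈ t≼hole s₁ s₂ =
      split t (record { sel = s ; v≼t = v≼t ; v≢t = v≢t ; t∈ = t∈ ; t≼hole = t≼hole ; upper = s₁ ; lower = s₂ })
        (build m (≤-trans (smaller {v} {h} {v} {just t} up t∈ (λ (_ , o) → o t refl ≼-refl)) le) s₁)
        (build m (≤-trans (smaller {v} {h} {t} {h} (In-lower-root v≼t) (root-In (proj₁ s)) (λ (p , _) → v≢t (≼-antisym v≼t p))) le) s₂)
      where
      up : (v , just t) ⊆ᵖ (v , h)
      up (p , o) = p , λ w e q → o t refl (≼-trans (t≼hole w e) q)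
    ... | leaf holes rd children = leaf (record { sel = s ; holes = holes ; dominates = rd }) (λ i → slot i (any? λ c → T? _))
      where
      slot : ∀ i → Dec (∃ λ c → Eᴮ i v c) → Slot v h i
      slot i (no none) = absent λ c e → none (c , e)
      slot i (yes (c , e)) with ≡-dec _≟F_ h (just c)
      ... | yes p = hole c e p
      ... | no np = sub c e np sc (build m (≤-trans (smaller {v} {h} {c} {nothing} (λ (p , _) → child-In holes pc np p) (root-In (proj₁ s))
            (λ (p , _) → proj₂ (proj₁ pc) (≼-antisym (proj₁ (proj₁ pc)) p))) le) sc)
        where
        pc = E⇒Par e
        sc = children c pc np

  term : ∀ {v h} → Selected v h → Term v h
  term {v} {h} = build (suc (# (member v h))) (n<1+n _)

  -- Nodes are not recorded, so the code depends on the shape and the labels only. It is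
  -- prefix-free: one tag for split or leaf, a fixed number of label bits, and the slot tags `00`,
  -- `01` and `1`.
  code : ∀ {v h} → Term v h → List Bool
  slot-code : ∀ {v h i} → Slot v h i → List Bool
  code (split t _ a b) = true ∷ code a ++ code b
  code (leaf {v} _ slots) = false ∷ concat (tabulate (λ a → label v a ∷ [])) ++ concat (tabulate (λ i → slot-code (slots i)))
  slot-code (absent _) = false ∷ false ∷ []
  slot-code (hole _ _ _) = false ∷ true ∷ []
  slot-code (sub _ _ _ _ t) = true ∷ code t

  nodes : ∀ {v h} → Term v h → List (Fin n)
  slot-nodes : ∀ {v h i} → Slot v h i → List (Fin n)
  nodes (split t _ a b) = nodes a ++ nodes b
  nodes (leaf {v} _ slots) = v ∷ concat (tabulate (λ i → slot-nodes (slots i)))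
  slot-nodes (absent _) = []
  slot-nodes (hole _ _ _) = []
  slot-nodes (sub _ _ _ _ t) = nodes t

  data Same : ∀ {v h v' h'} → Term v h → Term v' h' → Set
  data SameSlot {v h v' h' i} : Slot v h i → Slot v' h' i → Set

  data Same where
    split : ∀ {v h v' h' t t'} {p : Splits v h t} {p' : Splits v' h' t'} {a b a' b'} →
      Same a a' → Same b b' → Same (split t p a b) (split t' p' a' b')
    leaf : ∀ {v h v' h'} {p : IsLeaf v h} {p' : IsLeaf v' h'} {slots slots'} →
      (∀ a → label v a ≡ label v' a) → (∀ i → SameSlot (slots i) (slots' i)) → Same (leaf p slots) (leaf p' slots')

  data SameSlot {v} {h} {v'} {h'} {i} where
    absent : ∀ {p p'} → SameSlot (absent p) (absent p')
    hole : ∀ {c c' e e' p p'} → SameSlot (hole c e p) (hole c' e' p')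
    sub : ∀ {c c' e e' p p' s s' t t'} → Same t t' → SameSlot (sub c e p s t) (sub c' e' p' s' t')

  -- The arbitrary continuations `xs` and `xs'` let the induction read a code off the front of a
  -- concatenation, which is prefix-freeness.
  code-cancel : ∀ {v h v' h'} (t : Term v h) (t' : Term v' h') {xs xs'} →
    code t ++ xs ≡ code t' ++ xs' → Same t t' × xs ≡ xs'
  slot-cancel : ∀ {v h v' h' i} (s : Slot v h i) (s' : Slot v' h' i) {xs xs'} →
    slot-code s ++ xs ≡ slot-code s' ++ xs' → SameSlot s s' × xs ≡ xs'
  code-cancel (split t p a b) (split t' p' a' b') {xs} {xs'} e
    with code-cancel a a' (trans (sym (++-assoc (code a) (code b) xs)) (trans (proj₂ (∷-injective e)) (++-assoc (code a') (code b') xs')))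
  ... | s , e' with code-cancel b b' e'
  ... | s' , e'' = split s s' , e''
  code-cancel (leaf {v} p slots) (leaf {v'} p' slots') {xs} {xs'} e
    with concat-cancel {g = λ a → label v a ∷ []} {g' = λ a → label v' a ∷ []} {P = λ a → label v a ≡ label v' a} (λ a → ∷-injective)
      (trans (sym (++-assoc (concat (tabulate (λ a → label v a ∷ []))) _ xs)) (trans (proj₂ (∷-injective e)) (++-assoc (concat (tabulate (λ a → label v' a ∷ []))) _ xs')))
  ... | ls , e' with concat-cancel {g = λ i → slot-code (slots i)} {g' = λ i → slot-code (slots' i)} {P = λ i → SameSlot (slots i) (slots' i)} (λ i → slot-cancel (slots i) (slots' i)) e'
  ... | ss , e'' = leaf ls ss , e''
  code-cancel (split _ _ _ _) (leaf _ _) ()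
  code-cancel (leaf _ _) (split _ _ _ _) ()
  slot-cancel (absent _) (absent _) refl = absent , refl
  slot-cancel (hole _ _ _) (hole _ _ _) refl = hole , refl
  slot-cancel (sub _ _ _ _ t) (sub _ _ _ _ t') e with code-cancel t t' (proj₂ (∷-injective e))
  ... | s , e' = sub s , e'
  slot-cancel (absent _) (hole _ _ _) ()
  slot-cancel (absent _) (sub _ _ _ _ _) ()
  slot-cancel (hole _ _ _) (absent _) ()
  slot-cancel (hole _ _ _) (sub _ _ _ _ _) ()
  slot-cancel (sub _ _ _ _ _) (absent _) ()
  slot-cancel (sub _ _ _ _ _) (hole _ _ _) ()

  code-injective : ∀ {v h v' h'} (t : Term v h) (t' : Term v' h') → code t ≡ code t' → Same t t'
  code-injective t t' e = proj₁ (code-cancel t t' (cong (_++ []) e))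

  same-sym : ∀ {v h v' h'} {t : Term v h} {t' : Term v' h'} → Same t t' → Same t' t
  slot-sym : ∀ {v h v' h' i} {s : Slot v h i} {s' : Slot v' h' i} → SameSlot s s' → SameSlot s' s
  same-sym (split s s') = split (same-sym s) (same-sym s')
  same-sym (leaf ls ss) = leaf (λ a → sym (ls a)) (λ i → slot-sym (ss i))
  slot-sym absent = absent
  slot-sym hole = hole
  slot-sym (sub s) = sub (same-sym s)

  -- The correspondence of nodes induced by equally shaped terms; it includes the holes.
  data Corr : ∀ {v h v' h'} {t : Term v h} {t' : Term v' h'} → Same t t' → Fin n → Fin n → Set
  data SlotCorr {v h v' h' i} : ∀ {s : Slot v h i} {s' : Slot v' h' i} → SameSlot s s' → Fin n → Fin n → Set

  data Corr where
    left : ∀ {v h v' h' t t' p p' a b a' b' s s' u u'} → Corr s u u' →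
      Corr (split {v} {h} {v'} {h'} {t} {t'} {p} {p'} {a} {b} {a'} {b'} s s') u u'
    right : ∀ {v h v' h' t t' p p' a b a' b' s s' u u'} → Corr s' u u' →
      Corr (split {v} {h} {v'} {h'} {t} {t'} {p} {p'} {a} {b} {a'} {b'} s s') u u'
    root : ∀ {v h v' h' p p' slots slots' ls ss} → Corr (leaf {v} {h} {v'} {h'} {p} {p'} {slots} {slots'} ls ss) v v'
    slot : ∀ {v h v' h' p p' slots slots' ls ss u u'} i → SlotCorr (ss i) u u' →
      Corr (leaf {v} {h} {v'} {h'} {p} {p'} {slots} {slots'} ls ss) u u'

  data SlotCorr {v} {h} {v'} {h'} {i} where
    hole : ∀ {c c' e e' p p'} → SlotCorr (hole {c = c} {c'} {e} {e'} {p} {p'}) c c'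
    sub : ∀ {c c' e e' p p' x x' t t' s u u'} → Corr s u u' → SlotCorr (sub {c = c} {c'} {e} {e'} {p} {p'} {x} {x'} {t} {t'} s) u u'

  corr-sym : ∀ {v h v' h'} {t : Term v h} {t' : Term v' h'} {s : Same t t'} {u u'} → Corr s u u' → Corr (same-sym s) u' u
  slotcorr-sym : ∀ {v h v' h' i} {s : Slot v h i} {s' : Slot v' h' i} {ss : SameSlot s s'} {u u'} →
    SlotCorr ss u u' → SlotCorr (slot-sym ss) u' u
  corr-sym (left c) = left (corr-sym c)
  corr-sym (right c) = right (corr-sym c)
  corr-sym root = root
  corr-sym (slot i c) = slot i (slotcorr-sym c)
  slotcorr-sym hole = hole
  slotcorr-sym (sub c) = sub (corr-sym c)

  -- Applying `corr-sym` twice does not help here: `same-sym` is not an involution by computation.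
  corr-unsym : ∀ {v h v' h'} {t : Term v h} {t' : Term v' h'} (s : Same t t') {u u'} → Corr (same-sym s) u' u → Corr s u u'
  slotcorr-unsym : ∀ {v h v' h' i} {s : Slot v h i} {s' : Slot v' h' i} (ss : SameSlot s s') {u u'} →
    SlotCorr (slot-sym ss) u' u → SlotCorr ss u u'
  corr-unsym (split s s') (left c) = left (corr-unsym s c)
  corr-unsym (split s s') (right c) = right (corr-unsym s' c)
  corr-unsym (leaf _ _) root = root
  corr-unsym (leaf _ ss) (slot i c) = slot i (slotcorr-unsym (ss i) c)
  slotcorr-unsym hole hole = hole
  slotcorr-unsym (sub s) (sub c) = sub (corr-unsym s c)

  corr-root : ∀ {v h v' h'} {t : Term v h} {t' : Term v' h'} (s : Same t t') → Corr s v v'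
  corr-root (split s s') = left (corr-root s)
  corr-root (leaf _ _) = root

  corr-hole : ∀ {v h v' h' w} {t : Term v h} {t' : Term v' h'} (s : Same t t') → h ≡ just w →
    ∃ λ w' → h' ≡ just w' × Corr s w w'
  corr-hole (split s s') e with corr-hole s' e
  ... | w' , e' , c = w' , e' , right c
  corr-hole {v} {h} {v'} {h'} {w} (leaf {p = p} {p'} {slots} {slots'} ls ss) e with Par⇒Edge (IsLeaf.holes p w e)
  ... | i , ew = at (slots i) (slots' i) (ss i) (λ c → slot i c)
    where
    Goal : Set
    Goal = ∃ λ w' → h' ≡ just w' × Corr (leaf {p = p} {p'} {slots} {slots'} ls ss) w w'
    at : (s : Slot v h i) (s' : Slot v' h' i) (q : SameSlot s s') →
      (∀ {w'} → SlotCorr q w w' → Corr (leaf {p = p} {p'} {slots} {slots'} ls ss) w w') → Goal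
    at _ _ (absent {p = none}) _ = ⊥-elim (none w ew)
    at _ _ (hole {c} {c'} {p = q} {p' = q'}) f with trans (sym e) q
    ... | refl = c' , q' , f hole
    at _ _ (sub {c} {e = e'} {p = q} _) _ = ⊥-elim (q (trans e (cong just (childUniq _ _ _ _ ew e'))))

  corr-hole' : ∀ {v v' t t'} {a : Term v (just t)} {a' : Term v' (just t')} (s : Same a a') → Corr s t t'
  corr-hole' s with corr-hole s refl
  ... | _ , refl , c = c

  -- The covered nodes together with the hole itself, the nodes that `Corr` relates. The two parts
  -- of a split share the node `t` as hole of the upper and root of the lower part, and all
  -- relations across a split are traced through it.
  Closure : Fin n → Hole → Fin n → Set
  Closure v h u = v ≼ u × ∀ w → h ≡ just w → w ≼ u → u ≡ w

  corr-in : ∀ {v h v' h'} {t : Term v h} {t' : Term v' h'} {s : Same t t'} {u u'} → Corr s u u' → Closure v h u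
  slotcorr-child : ∀ {v h v' h' i} {s : Slot v h i} {s' : Slot v' h' i} {ss : SameSlot s s'} {u u'} →
    SlotCorr ss u u' → ∃ λ c → Eᴮ i v c × c ≼ u × (h ≡ just c → u ≡ c)
  corr-in {h = h} {u = u} (left {t = t} {p = p} c) with corr-in c
  ... | v≼u , m = v≼u , at
    where
    at : ∀ w → h ≡ just w → w ≼ u → u ≡ w
    at w e w≼u with m t refl (≼-trans (Splits.t≼hole p w e) w≼u)
    ... | refl = ≼-antisym (Splits.t≼hole p w e) w≼u
  corr-in (right {p = p} c) with corr-in c
  ... | t≼u , m = ≼-trans (Splits.v≼t p) t≼u , m
  corr-in (root {p = p}) = ≼-refl , λ w e q → ⊥-elim (proj₂ (proj₁ (IsLeaf.holes p w e)) (≼-antisym (proj₁ (proj₁ (IsLeaf.holes p w e))) q))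
  corr-in {h = h} {u = u} (slot {p = p} i c) with slotcorr-child c
  ... | d , e , d≼u , m = ≼-trans (proj₁ (proj₁ (E⇒Par e))) d≼u , at
    where
    at : ∀ w → h ≡ just w → w ≼ u → u ≡ w
    at w eq w≼u with siblings d≼u w≼u
      where
      siblings : d ≼ u → w ≼ u → d ≡ w
      siblings p₁ p₂ with ≼-chain p₁ p₂
      ... | inj₁ q = siblings-incomparable (E⇒Par e) (IsLeaf.holes p w eq) q
      ... | inj₂ q = sym (siblings-incomparable (IsLeaf.holes p w eq) (E⇒Par e) q)
    ... | refl = m eq
  slotcorr-child (hole {c} {e = e}) = c , e , ≼-refl , λ _ → refl
  slotcorr-child (sub {c} {e = e} {p = np} x) = c , e , proj₁ (corr-in x) , λ q → ⊥-elim (np q)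

  corr-in' : ∀ {v h v' h'} {t : Term v h} {t' : Term v' h'} {s : Same t t'} {u u'} → Corr s u u' → Closure v' h' u'
  corr-in' c = corr-in (corr-sym c)

  -- The critical case has `u` in the upper and `z` in the lower part of a split. Then `u ≼ t` and
  -- `t ≼ z`, and as hole and root `t` corresponds to the splitting node of the other term.
  corr-≼ : ∀ {v h v' h'} {t : Term v h} {t' : Term v' h'} (s : Same t t') {u u' z z'} →
    Corr s u u' → Corr s z z' → u ≼ z → u' ≼ z'
  slotcorr-≼ : ∀ {v h v' h' i} {s : Slot v h i} {s' : Slot v' h' i} (ss : SameSlot s s') {u u' z z'} →
    SlotCorr ss u u' → SlotCorr ss z z' → u ≼ z → u' ≼ z'
  -- Order preservation applied to `u ≼ u` in both directions. Conversely `corr-≼` needs this for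
  -- subterms, at the node shared by the parts of a split.
  corr-functional : ∀ {v h v' h'} {t : Term v h} {t' : Term v' h'} (s : Same t t') {u u' u''} →
    Corr s u u' → Corr s u u'' → u' ≡ u''

  same-slot : ∀ {v i j c d u} → Eᴮ i v c → c ≼ u → Eᴮ j v d → d ≼ u → i ≡ j
  same-slot {c = c} {d} e c≼u e' d≼u with ≼-chain c≼u d≼u
  ... | inj₁ q = proj₁ (parentUniq _ _ _ _ _ e (subst (Eᴮ _ _) (sym (siblings-incomparable (E⇒Par e) (E⇒Par e') q)) e'))
  ... | inj₂ q = proj₁ (parentUniq _ _ _ _ _ e (subst (Eᴮ _ _) (siblings-incomparable (E⇒Par e') (E⇒Par e) q) e'))

  corr-≼ (split s s') (left x) (left y) q = corr-≼ s x y q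
  corr-≼ (split s s') (right x) (right y) q = corr-≼ s' x y q
  corr-≼ (split s s') {u} (left {t = t} x) (right y) q with corr-in x | corr-in y
  ... | _ , m | t≼z , _ = ≼-trans (corr-≼ s x (corr-hole' s) u≼t) (proj₁ (corr-in' y))
    where
    u≼t : u ≼ t
    u≼t with ≼-chain q t≼z
    ... | inj₁ r = r
    ... | inj₂ r = subst (_≼ t) (sym (m t refl r)) ≼-refl
  -- Now `u` is at or below `t` and `z` is in the closed upper part, so `u ≼ z` forces both to be
  -- `t`.
  corr-≼ (split s s') (right x) (left {t = t} y) q with corr-in x | corr-in y
  ... | t≼u , _ | _ , m with m t refl (≼-trans t≼u q)
  ... | refl with ≼-antisym t≼u q
  ... | refl with corr-functional s y (corr-hole' s) | corr-functional s' x (corr-root s')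
  ... | refl | refl = ≼-refl
  corr-≼ (leaf _ _) root y q = proj₁ (corr-in' y)
  corr-≼ (leaf _ _) (slot i x) root q with slotcorr-child x
  ... | d , e , d≼u , _ = ⊥-elim (proj₂ (proj₁ (E⇒Par e)) (≼-antisym (proj₁ (proj₁ (E⇒Par e))) (≼-trans d≼u q)))
  corr-≼ (leaf _ ss) (slot i x) (slot j y) q with slotcorr-child x | slotcorr-child y
  ... | d , e , d≼u , _ | d' , e' , d'≼z , _ with same-slot e (≼-trans d≼u q) e' d'≼z
  ... | refl = slotcorr-≼ (ss i) x y q
  slotcorr-≼ hole hole hole q = ≼-refl
  slotcorr-≼ (sub s) (sub x) (sub y) q = corr-≼ s x y q
  corr-functional s x y = ≼-antisym (corr-≼ s x y ≼-refl) (corr-≼ s y x ≼-refl)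

  corr-E : ∀ {v h v' h'} {t : Term v h} {t' : Term v' h'} (s : Same t t') {i u u' z z'} →
    Corr s u u' → Corr s z z' → Eᴮ i u z → Eᴮ i u' z'
  slotcorr-E : ∀ {v h v' h' j} {s : Slot v h j} {s' : Slot v' h' j} (ss : SameSlot s s') {i u u' z z'} →
    SlotCorr ss u u' → SlotCorr ss z z' → Eᴮ i u z → Eᴮ i u' z'
  slotcorr-E-root : ∀ {v h v' h' i} {s : Slot v h i} {s' : Slot v' h' i} (ss : SameSlot s s') {z z'} →
    SlotCorr ss z z' → Eᴮ i v z → Eᴮ i v' z'
  corr-E (split s s') (left x) (left y) q = corr-E s x y q
  corr-E (split s s') (right x) (right y) q = corr-E s' x y q
  -- An edge from the upper to the lower part has `t` as one of its ends, so it lies entirely in one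
  -- closed part.
  corr-E (split s s') {u = u} {z = z} (left {t = t} x) (right y) q with corr-in x | corr-in y | E⇒Par q
  ... | _ , m | t≼z , _ | (u≼z , u≢z) , pz with pz t t≼z
  ... | inj₁ refl with corr-functional s' y (corr-root s')
  ... | refl = corr-E s x (corr-hole' s) q
  corr-E (split s s') {u = u} {z = z} (left {t = t} x) (right y) q | _ , m | t≼z , _ | (u≼z , u≢z) , pz | inj₂ t≼u
    with m t refl t≼u
  ... | refl with corr-functional s x (corr-hole' s)
  ... | refl = corr-E s' (corr-root s') y q
  corr-E (split s s') (right x) (left {t = t} y) q with corr-in x | corr-in y | E⇒Par q
  ... | t≼u , _ | _ , m | (u≼z , u≢z) , _ with m t refl (≼-trans t≼u u≼z)
  ... | refl = ⊥-elim (u≢z (≼-antisym u≼z t≼u))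
  corr-E (leaf _ _) root root q = ⊥-elim (proj₂ (proj₁ (E⇒Par q)) refl)
  corr-E (leaf _ ss) root (slot j y) q with slotcorr-child y
  ... | d , e , d≼z , _ with same-slot q ≼-refl e d≼z
  ... | refl = slotcorr-E-root (ss j) y q
  corr-E (leaf _ _) (slot i x) root q with slotcorr-child x | E⇒Par q
  ... | d , e , d≼u , _ | (u≼v , u≢v) , _ = ⊥-elim (u≢v (≼-antisym u≼v (≼-trans (proj₁ (proj₁ (E⇒Par e))) d≼u)))
  corr-E (leaf _ ss) (slot i x) (slot j y) q with slotcorr-child x | slotcorr-child y
  ... | d , e , d≼u , _ | d' , e' , d'≼z , _ with same-slot e (≼-trans d≼u (proj₁ (proj₁ (E⇒Par q)))) e' d'≼z
  ... | refl = slotcorr-E (ss i) x y q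
  slotcorr-E hole hole hole q = ⊥-elim (proj₂ (proj₁ (E⇒Par q)) refl)
  slotcorr-E (sub s) (sub x) (sub y) q = corr-E s x y q
  slotcorr-E-root (hole {e' = e'}) hole q = e'
  slotcorr-E-root (sub {e = e} {e'} s) (sub y) q with childUniq _ _ _ _ e q
  ... | refl with corr-functional s y (corr-root s)
  ... | refl = e'

  -- Stated for covered nodes because a code does not record the label of the hole. The splitting
  -- node `t` gets its label from the lower part.
  corr-label : ∀ {v h v' h'} {t : Term v h} {t' : Term v' h'} (s : Same t t') {u u'} → In v h u → Corr s u u' →
    ∀ a → label u a ≡ label u' a
  slotcorr-label : ∀ {v h v' h' i} {s : Slot v h i} {s' : Slot v' h' i} (ss : SameSlot s s') {u u'} → In v h u → SlotCorr ss u u' →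
    ∀ a → label u a ≡ label u' a
  corr-label (split s s') {u} (v≼u , o) (left {t = t} c) with t ≼? u
  ... | no np = corr-label s (v≼u , λ { _ refl → np }) c
  ... | yes p with proj₂ (corr-in c) t refl p
  ... | refl with corr-functional s c (corr-hole' s)
  ... | refl = corr-label s' (≼-refl , o) (corr-root s')
  corr-label (split s s') (_ , o) (right c) = corr-label s' (proj₁ (corr-in c) , o) c
  corr-label (leaf ls _) _ root = ls
  corr-label (leaf _ ss) i (slot j c) = slotcorr-label (ss j) i c
  slotcorr-label (hole {p = p}) (_ , o) hole = ⊥-elim (o _ p ≼-refl)
  slotcorr-label (sub s) _ (sub c) = corr-label s (proj₁ (corr-in c) , λ _ ()) c

  corr-total : ∀ {v h v' h'} {t : Term v h} {t' : Term v' h'} (s : Same t t') {u} → In v h u →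
    ∃ λ u' → In v' h' u' × Corr s u u'
  slotcorr-total : ∀ {v h v' h' i} {s : Slot v h i} {s' : Slot v' h' i} (ss : SameSlot s s') → IsLeaf v' h' →
    ∀ {c u} → Eᴮ i v c → c ≼ u → In v h u → ∃ λ u' → In v' h' u' × SlotCorr ss u u'
  corr-total (split {t = t} {p' = p'} s s') {u} (v≼u , o) with t ≼? u
  ... | yes q = let (u' , i , c) = corr-total s' (q , o) in u' , In-lower-root (Splits.v≼t p') i , right c
  ... | no nq = let (u' , (q , o') , c) = corr-total s (v≼u , λ { _ refl → nq })
    in u' , (q , λ w e r → o' _ refl (≼-trans (Splits.t≼hole p' w e) r)) , left c
  corr-total {v} (leaf {p' = p'} ls ss) {u} i with v ≟F u
  ... | yes refl = _ , root-In (proj₁ (IsLeaf.sel p')) , root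
  ... | no ne with child (proj₁ i) ne
  ... | c , pc , c≼u with Par⇒Edge pc
  ... | j , e = let (u' , i' , x) = slotcorr-total (ss j) p' e c≼u i in u' , i' , slot j x
  slotcorr-total (absent {none}) p' e c≼u i = ⊥-elim (none _ e)
  slotcorr-total (hole {e = e'} {p = q}) p' e c≼u (_ , o) = ⊥-elim (o _ q (subst (_≼ _) (childUniq _ _ _ _ e e') c≼u))
  slotcorr-total (sub {c} {c'} {e₀} {e'} {p' = np'} s) p' e c≼u i with childUniq _ _ _ _ e e₀
  ... | refl = let (u' , (q , _) , x) = corr-total s (c≼u , λ _ ()) in
    u' , child-In (IsLeaf.holes p') (E⇒Par e') np' q , sub x

  _≈[_]_ : ∀ {v h v' h'} {t : Term v h} {t' : Term v' h'} → Fin n × Hole → Same t t' → Fin n × Hole → Set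
  _≈[_]_ {v} {h} (v₁ , h₁) s (v₂ , h₂) = ∀ {u u'} → In v h u → Corr s u u' → In v₁ h₁ u ⇔ In v₂ h₂ u'

  Matched : ∀ {v h v' h'} {t : Term v h} {t' : Term v' h'} → Same t t' → Fin n → Hole → Set
  Matched {v' = v'} {h'} s v₁ h₁ = ∃ λ v₂ → ∃ λ h₂ → Selected v₂ h₂ × (v₂ , h₂) ⊆ᵖ (v' , h') × (v₁ , h₁) ≈[ s ] (v₂ , h₂)

  term-selected : ∀ {v h} → Term v h → Selected v h
  term-selected (split _ p _ _) = Splits.sel p
  term-selected (leaf p _) = IsLeaf.sel p

  corr-into : ∀ {v h v' h'} {t : Term v h} {t' : Term v' h'} (s : Same t t') {u u'} → In v h u → Corr s u u' → In v' h' u'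
  corr-into s i c with corr-total s i
  ... | u'' , i'' , c'' rewrite corr-functional s c c'' = i''

  -- The whole pattern is matched with the whole. A proper subpattern descends into a part of a
  -- split by `below-split` or into a slot by `below-leaf`, where the induction hypothesis supplies
  -- its partner.
  corr-patterns : ∀ {v h v' h'} {t : Term v h} {t' : Term v' h'} (s : Same t t') {v₁ h₁} →
    Selected v₁ h₁ → (v₁ , h₁) ⊆ᵖ (v , h) → Matched s v₁ h₁
  corr-proper : ∀ {v h v' h'} {t : Term v h} {t' : Term v' h'} (s : Same t t') {v₁ h₁} →
    Selected v₁ h₁ → (v₁ , h₁) ⊆ᵖ (v , h) → ¬ (v , h) ⊆ᵖ (v₁ , h₁) → Matched s v₁ h₁
  slotcorr-patterns : ∀ {v h v' h' i} {sl : Slot v h i} {sl' : Slot v' h' i} (ss : SameSlot sl sl') {v₁ h₁ c} →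
    Eᴮ i v c → h ≢ just c → Selected v₁ h₁ → (v₁ , h₁) ⊆ᵖ (c , nothing) →
    ∃ λ c' → ∃ λ v₂ → ∃ λ h₂ → (Eᴮ i v' c' × h' ≢ just c') × Selected v₂ h₂ × (v₂ , h₂) ⊆ᵖ (c' , nothing) ×
      (∀ {u u'} → SlotCorr ss u u' → In v₁ h₁ u ⇔ In v₂ h₂ u')
  corr-patterns {v} {h} {v'} {h'} {t' = t'} s {v₁} {h₁} sel sub⊆ = whole? (all? λ u → In? v h u →-dec In? v₁ h₁ u)
    where
    whole? : Dec (∀ u → In v h u → In v₁ h₁ u) → Matched s v₁ h₁
    whole? (yes all) = v' , h' , term-selected t' , (λ {u} i → i) , λ i c → (λ _ → corr-into s i c) , (λ _ → all _ i)
    whole? (no ¬all) = corr-proper s sel sub⊆ (λ f → ¬all λ u i → f {u} i)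
  corr-proper {v} {h} {v'} {h'} (split {t = t} {t'} {p} {p'} s s') {v₁} {h₁} sel sub⊆ ¬⊇
    with below-split (Splits.v≼t p) (Splits.t∈ p) (Splits.upper p) (Splits.lower p) sel sub⊆ ¬⊇
  ... | inj₁ below = let (v₂ , h₂ , sel₂ , sub₂ , eq) = corr-patterns s sel below in
      v₂ , h₂ , sel₂ , (λ {u} i → let (q , o) = sub₂ i in q , λ w e r → o t' refl (≼-trans (Splits.t≼hole p' w e) r)) ,
      λ { {u} {u'} (q , o) (left c) → at-upper sub₂ eq q c (t ≼? u)
        ; {u} {u'} i (right c) → (λ j → ⊥-elim (proj₂ (below j) t refl (proj₁ (corr-in c)))) ,
                       (λ j → ⊥-elim (proj₂ (sub₂ j) t' refl (proj₁ (corr-in' c)))) }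
    where
    -- The node `t` is covered by the split pattern but is only the hole of the upper part, so the
    -- induction hypothesis says nothing about it. It belongs to neither of the two matched
    -- patterns.
    at-upper : ∀ {v₂ h₂ u u'} → (v₂ , h₂) ⊆ᵖ (v' , just t') → (v₁ , h₁) ≈[ s ] (v₂ , h₂) → v ≼ u → Corr s u u' → Dec (t ≼ u) →
      In v₁ h₁ u ⇔ In v₂ h₂ u'
    at-upper sub₂ eq q c (no np) = eq (q , λ { _ refl → np }) c
    at-upper sub₂ eq q c (yes r) with proj₂ (corr-in c) t refl r
    ... | refl with corr-functional s c (corr-hole' s)
    ... | refl = (λ j → ⊥-elim (proj₂ (below j) t refl ≼-refl)) , (λ j → ⊥-elim (proj₂ (sub₂ j) t' refl ≼-refl))
  ... | inj₂ below = let (v₂ , h₂ , sel₂ , sub₂ , eq) = corr-patterns s' sel below in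
      v₂ , h₂ , sel₂ , (λ {u} i → In-lower-root (Splits.v≼t p') (sub₂ i)) ,
      λ { {u} {u'} (_ , o) (right c) → eq (proj₁ (corr-in c) , o) c
        ; {u} {u'} (_ , o) (left c) → at-lower sub₂ eq o c (t ≼? u) }
    where
    at-lower : ∀ {v₂ h₂ u u'} → (v₂ , h₂) ⊆ᵖ (t' , h') → (v₁ , h₁) ≈[ s' ] (v₂ , h₂) → Outside h u → Corr s u u' → Dec (t ≼ u) →
      In v₁ h₁ u ⇔ In v₂ h₂ u'
    at-lower sub₂ eq o c (yes r) with proj₂ (corr-in c) t refl r
    ... | refl with corr-functional s c (corr-hole' s)
    ... | refl = eq (≼-refl , o) (corr-root s')
    at-lower sub₂ eq o c (no np) = (λ j → ⊥-elim (np (proj₁ (below j)))) , λ j → ⊥-elim (np (back (proj₁ (sub₂ j))))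
      where
      back : t' ≼ _ → t ≼ _
      back r with proj₂ (corr-in' c) t' refl r
      ... | refl with corr-functional (same-sym s) (corr-sym c) (corr-sym (corr-hole' s))
      ... | refl = ≼-refl
  corr-proper {v} {h} {v'} {h'} (leaf {p = p} {p'} ls ss) {v₁} {h₁} sel sub⊆ ¬⊇
    with below-leaf (IsLeaf.sel p) (IsLeaf.holes p) (IsLeaf.dominates p) sel sub⊆ ¬⊇
  ... | c , (pc , ne) , below with Par⇒Edge pc
  ... | j , e with slotcorr-patterns (ss j) e ne sel below
  ... | c' , v₂ , h₂ , (e' , ne') , sel₂ , sub₂ , eq = v₂ , h₂ , sel₂ ,
      (λ {u} i → child-In (IsLeaf.holes p') (E⇒Par e') ne' (proj₁ (sub₂ i))) , agree
    where
    agree : (v₁ , h₁) ≈[ leaf {p = p} {p'} ls ss ] (v₂ , h₂)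
    agree i root = (λ q → ⊥-elim (proj₂ (proj₁ pc) (≼-antisym (proj₁ (proj₁ pc)) (proj₁ (below q))))) ,
      (λ q → ⊥-elim (proj₂ (proj₁ (E⇒Par e')) (≼-antisym (proj₁ (proj₁ (E⇒Par e'))) (proj₁ (sub₂ q)))))
    agree {u} {u'} i (slot j' x) = to , from
      where
      to : In v₁ h₁ u → In v₂ h₂ u'
      to q with slotcorr-child x
      ... | d , f , d≼u , _ with same-slot e (proj₁ (below q)) f d≼u
      ... | refl = proj₁ (eq x) q
      from : In v₂ h₂ u' → In v₁ h₁ u
      from q with slotcorr-child (slotcorr-sym x)
      ... | d , f , d≼u , _ with same-slot e' (proj₁ (sub₂ q)) f d≼u
      ... | refl = proj₂ (eq x) q
  slotcorr-patterns (absent {none}) e _ _ _ = ⊥-elim (none _ e)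
  slotcorr-patterns (hole {e = e₀} {p = q}) e ne _ _ = ⊥-elim (ne (trans q (cong just (childUniq _ _ _ _ e₀ e))))
  slotcorr-patterns (sub {c} {c'} {e₀} {e'} {p' = ne'} s) e ne sel sub⊆ with childUniq _ _ _ _ e e₀
  ... | refl = let (v₂ , h₂ , sel₂ , sub₂ , eq) = corr-patterns s sel sub⊆ in
    c' , v₂ , h₂ , (e' , ne') , sel₂ , sub₂ , λ { (sub x) → eq (proj₁ (corr-in x) , λ _ ()) x }

  module _ (inP : ∀ v h → InP B (pat v h) ⇔ Selected v h) where
    module _ {v h v' h'} {t : Term v h} {t' : Term v' h'} (s : Same t t') where
      private
        image : ∀ u → Dec (In v h u) → Fin n
        image u (yes i) = proj₁ (corr-total s i)
        -- A dummy value: `Equiv` constrains the maps on covered nodes only.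
        image u (no _) = u

      transport : Fin n → Fin n
      transport u = image u (In? v h u)

      transport-spec : ∀ {u} → In v h u → In v' h' (transport u) × Corr s u (transport u)
      transport-spec {u} i = at (In? v h u)
        where
        at : (d : Dec (In v h u)) → In v' h' (image u d) × Corr s u (image u d)
        at (yes j) = proj₂ (corr-total s j)
        at (no nj) = ⊥-elim (nj i)

      transport-patterns : ∀ q → InP B q → _≤P_ B q (pat v h) → Σ (Pat n) λ q' → InP B q' × _≤P_ B q' (pat v' h') ×
        (∀ u → Cov B (pat v h) u → Cov B q u ⇔ Cov B q' (transport u))
      transport-patterns q i q≤ with asPat q
      ... | mk v₁ h₁ with corr-patterns s (proj₁ (inP v₁ h₁) i) (≤P⇒⊆ h₁ h q≤)
      ... | v₂ , h₂ , sel₂ , sub₂ , eq = pat v₂ h₂ , proj₂ (inP v₂ h₂) sel₂ , ⊆⇒≤P h₂ h' sub₂ , λ u c →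
        let (f , g) = eq (Cov⇒In h c) (proj₂ (transport-spec (Cov⇒In h c))) in
        (λ x → In⇒Cov h₂ (f (Cov⇒In h₁ x))) , (λ x → In⇒Cov h₁ (g (Cov⇒In h₂ x)))

    transport-inverse : ∀ {v h v' h'} {t : Term v h} {t' : Term v' h'} (s : Same t t') {u} → In v h u →
      transport (same-sym s) (transport s u) ≡ u
    transport-inverse s i = let (i' , c) = transport-spec s i in
      corr-functional (same-sym s) (proj₂ (transport-spec (same-sym s) i')) (corr-sym c)

    same⇒Equiv : ∀ {v h v' h'} {t : Term v h} {t' : Term v' h'} → Same t t' → Equiv B (pat v h) (pat v' h')
    same⇒Equiv {v} {h} {v'} {h'} s = transport s , transport (same-sym s) ,
      (λ u c → In⇒Cov h' (proj₁ (transport-spec s (Cov⇒In h c))) , transport-inverse s (Cov⇒In h c)) ,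
      (λ u c → In⇒Cov h (proj₁ (transport-spec (same-sym s) (Cov⇒In h' c))) , back (Cov⇒In h' c)) ,
      (λ u u' c c' → let x = proj₂ (transport-spec s (Cov⇒In h c)) ; y = proj₂ (transport-spec s (Cov⇒In h c')) in
        (corr-≼ s x y , corr-≼ (same-sym s) (corr-sym x) (corr-sym y)) ,
        λ i → corr-E s x y , corr-E (same-sym s) (corr-sym x) (corr-sym y)) ,
      (λ u c a → let e = corr-label s (Cov⇒In h c) (proj₂ (transport-spec s (Cov⇒In h c))) a in subst T e , subst T (sym e)) ,
      transport-patterns s , transport-patterns (same-sym s)
      where
      back : ∀ {u} → In v' h' u → transport s (transport (same-sym s) u) ≡ u
      back {u} i = let (i' , c) = transport-spec (same-sym s) i in
        corr-functional s (proj₂ (transport-spec s i')) (corr-unsym s c)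

-- Code lengths and the number of classes.

-- The end of the list becomes a leading one, so that lists of different lengths have different
-- values.
binary : List Bool → ℕ
binary [] = 1
binary (true ∷ bs) = suc (2 * binary bs)
binary (false ∷ bs) = 2 * binary bs

binary-positive : ∀ bs → 0 < binary bs
binary-positive [] = s≤s z≤n
binary-positive (true ∷ bs) = s≤s z≤n
binary-positive (false ∷ bs) = ≤-trans (binary-positive bs) (m≤m+n _ _)

binary< : ∀ bs → binary bs < 2 ^ suc (length bs)
binary< [] = s≤s (s≤s z≤n)
binary< (true ∷ bs) = ≤-trans (≤-reflexive (sym (*-suc 2 (binary bs)))) (*-monoʳ-≤ 2 (binary< bs))
binary< (false ∷ bs) = ≤-trans (n≤1+n _) (≤-trans (≤-reflexive (sym (*-suc 2 (binary bs)))) (*-monoʳ-≤ 2 (binary< bs)))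

binary-injective : ∀ bs bs' → binary bs ≡ binary bs' → bs ≡ bs'
binary-injective [] [] e = refl
binary-injective (true ∷ bs) (true ∷ bs') e = cong (true ∷_) (binary-injective bs bs' (*-cancelˡ-≡ _ _ 2 (suc-injective e)))
binary-injective (false ∷ bs) (false ∷ bs') e = cong (false ∷_) (binary-injective bs bs' (*-cancelˡ-≡ _ _ 2 e))
binary-injective [] (true ∷ bs) e = ⊥-elim (<⇒≢ (binary-positive bs) (*-cancelˡ-≡ 0 _ 2 (suc-injective e)))
binary-injective (true ∷ bs) [] e = ⊥-elim (<⇒≢ (binary-positive bs) (*-cancelˡ-≡ 0 _ 2 (suc-injective (sym e))))
binary-injective [] (false ∷ bs) e = ⊥-elim (even≢odd (binary bs) 0 (sym e))
binary-injective (false ∷ bs) [] e = ⊥-elim (even≢odd (binary bs) 0 e)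
binary-injective (true ∷ bs) (false ∷ bs') e = ⊥-elim (even≢odd (binary bs') (binary bs) (sym e))
binary-injective (false ∷ bs) (true ∷ bs') e = ⊥-elim (even≢odd (binary bs) (binary bs') e)

representatives : ∀ {A : Set} {M} {P : A → Set} (class : ∀ {a} → P a → Fin M) →
  (∀ j → Dec (∃ λ a → Σ (P a) λ p → class p ≡ j)) →
  Σ (List A) λ reps → length reps ≤ M × All P reps × (∀ {a} (p : P a) → Any (λ r → Σ (P r) λ q → class p ≡ class q) reps)
representatives {A} {M} {P} class dec = let (reps , len , ps , found) = collect M (λ j a → Σ (P a) λ p → class p ≡ j) dec in
    reps , len , mapAll (λ (_ , p , _) → p) ps , λ p → mapAny (λ (q , e) → q , sym e) (found (class p) (_ , p , refl))
  where
  collect : ∀ m (Q : Fin m → A → Set) → (∀ j → Dec (∃ (Q j))) →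
    Σ (List A) λ reps → length reps ≤ m × All (λ a → ∃ λ j → Q j a) reps × (∀ j → ∃ (Q j) → Any (Q j) reps)
  collect zero Q dec = [] , z≤n , [] , λ ()
  collect (suc m) Q dec with collect m (Q ∘ suc) (dec ∘ suc) | dec zero
  ... | reps , len , qs , found | yes (a , q) = a ∷ reps , s≤s len , (zero , q) ∷ mapAll (λ (j , q) → suc j , q) qs ,
      λ { zero _ → here q ; (suc j) x → there (found j x) }
  ... | reps , len , qs , found | no none = reps , m≤n⇒m≤1+n len , mapAll (λ (j , q) → suc j , q) qs ,
      λ { zero x → ⊥-elim (none x) ; (suc j) x → found j x }

module CodeLength {k L n : ℕ} (B : Struct (HSig k L) n) (K : IsKOTree (reduct B))
    (R : Priority (FromTree.order (reduct B) K)) where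
  open TreeOrder (FromTree.order (reduct B) K)
  open Selection (FromTree.order (reduct B) K) R
  open Encoding B K R

  nodes-In : ∀ {v h} (t : Term v h) → All (In v h) (nodes t)
  slot-nodes-below : ∀ {v h i} (s : Slot v h i) → All (λ u → ∃ λ c → Eᴮ i v c × h ≢ just c × c ≼ u) (slot-nodes s)
  nodes-In (split t p a b) = All-++⁺
    (mapAll (λ (q , o) → q , λ w e r → o t refl (≼-trans (Splits.t≼hole p w e) r)) (nodes-In a))
    (mapAll (In-lower-root (Splits.v≼t p)) (nodes-In b))
  nodes-In (leaf p slots) = root-In (proj₁ (IsLeaf.sel p)) ∷
    All-concat⁺ (All-tabulate⁺ λ i → mapAll (λ (c , e , ne , q) → child-In (IsLeaf.holes p) (E⇒Par e) ne q) (slot-nodes-below (slots i)))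
  slot-nodes-below (absent _) = []
  slot-nodes-below (hole _ _ _) = []
  slot-nodes-below (sub c e ne _ t) = mapAll (λ (q , _) → c , e , ne , q) (nodes-In t)

  nodes-unique : ∀ {v h} (t : Term v h) → Unique (nodes t)
  slot-nodes-unique : ∀ {v h i} (s : Slot v h i) → Unique (slot-nodes s)
  nodes-unique (split t p a b) = Unique-++⁺ (nodes-unique a) (nodes-unique b)
    (λ (x , y) → proj₂ (lookupAll (nodes-In a) x) t refl (proj₁ (lookupAll (nodes-In b) y)))
  nodes-unique (leaf {v} p slots) =
    All-concat⁺ (All-tabulate⁺ λ i → mapAll (λ (c , e , _ , q) v≡u → proj₂ (proj₁ (E⇒Par e)) (≼-antisym (proj₁ (proj₁ (E⇒Par e))) (subst (c ≼_) (sym v≡u) q))) (slot-nodes-below (slots i))) ∷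
    Unique-concat⁺ (All-tabulate⁺ λ i → slot-nodes-unique (slots i))
      (AllPairs-tabulate⁺ λ {i} {j} i≢j (x , y) →
        let (c , e , _ , q) = lookupAll (slot-nodes-below (slots i)) x
            (c' , e' , _ , q') = lookupAll (slot-nodes-below (slots j)) y in i≢j (same-slot e q e' q'))
  slot-nodes-unique (absent _) = []
  slot-nodes-unique (hole _ _ _) = []
  slot-nodes-unique (sub _ _ _ _ t) = nodes-unique t

  bits : ℕ
  bits = 2 + L + k * 2

  -- The budget per leaf node is one tag, `L` label bits, two bits per slot and one bit of credit.
  -- The `suc` is that credit. Two credits meet at a split and pay for its tag while one is passed
  -- on; in a slot the credit pays for the tag `true`.
  code-length : ∀ {v h} (t : Term v h) → suc (length (code t)) ≤ bits * length (nodes t)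
  slot-code-length : ∀ {v h i} (s : Slot v h i) → length (slot-code s) ≤ 2 + bits * length (slot-nodes s)
  code-length (split t p a b) = begin
    2 + length (code a ++ code b)                            ≡⟨ cong (2 +_) (length-++ (code a)) ⟩
    2 + (length (code a) + length (code b))                  ≡⟨ cong suc (+-suc (length (code a)) (length (code b))) ⟨
    suc (length (code a)) + suc (length (code b))            ≤⟨ +-mono-≤ (code-length a) (code-length b) ⟩
    bits * length (nodes a) + bits * length (nodes b)        ≡⟨ *-distribˡ-+ bits (length (nodes a)) _ ⟨
    bits * (length (nodes a) + length (nodes b))             ≡⟨ cong (bits *_) (length-++ (nodes a)) ⟨
    bits * length (nodes a ++ nodes b)                       ∎
    where open ≤-Reasoning
  code-length (leaf {v} p slots) = begin
    2 + length (labels ++ rest)                              ≡⟨ cong (2 +_) (length-++ labels) ⟩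
    2 + (length labels + length rest)                        ≤⟨ +-monoʳ-≤ 2 (+-mono-≤ labels≤
                                                                 (length-concat-tabulate 2 bits _ (λ i → slot-nodes (slots i)) (λ i → slot-code-length (slots i)))) ⟩
    2 + (L + (k * 2 + bits * S))                             ≡⟨ cong (2 +_) (+-assoc L (k * 2) _) ⟨
    bits + bits * S                                          ≡⟨ *-suc bits S ⟨
    bits * suc S                                             ∎
    where
    open ≤-Reasoning
    labels = concat (tabulate (λ a → label v a ∷ []))
    rest = concat (tabulate (λ i → slot-code (slots i)))
    noBits : List Bool
    noBits = []
    S = length (concat (tabulate (λ i → slot-nodes (slots i))))
    labels≤ : length labels ≤ L
    labels≤ = ≤-trans (length-concat-tabulate 1 0 (λ a → label v a ∷ []) (λ _ → noBits) (λ _ → s≤s z≤n))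
      (≤-reflexive (trans (+-identityʳ (L * 1)) (*-identityʳ L)))
  slot-code-length (absent _) = s≤s (s≤s z≤n)
  slot-code-length (hole _ _ _) = s≤s (s≤s z≤n)
  slot-code-length (sub _ _ _ _ t) = ≤-trans (code-length t) (≤-trans (n≤1+n _) (n≤1+n _))

  code-binary< : ∀ {v h m} (t : Term v h) → AtMost (In v h) m → binary (code t) < 2 ^ (bits * m)
  code-binary< {m = m} t M = <-≤-trans (binary< (code t)) (^-monoʳ-≤ 2 (≤-trans (code-length t)
    (*-monoʳ-≤ bits (length≤ M (nodes t) (nodes-unique t) (nodes-In t)))))

region : ∀ {n} → Pat n → Fin n × Maybe (Fin n)
region (spat v) = v , nothing
region (cpat v w) = v , just w

region-pat : ∀ {n} (p : Pat n) → pat (proj₁ (region p)) (proj₂ (region p)) ≡ p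
region-pat (spat v) = refl
region-pat (cpat v w) = refl

module Classification {k L n : ℕ} (B : Struct (HSig k L) n) (K : IsKOTree (reduct B))
    (R : Priority (FromTree.order (reduct B) K))
    (inP : ∀ v h → InP B (pat v h) ⇔ Selection.Selected (FromTree.order (reduct B) K) R v h) where
  open Selection (FromTree.order (reduct B) K) R
  open Encoding B K R

  InP? : ∀ p → Dec (InP B p)
  InP? (spat v) = T? _
  InP? (cpat v w) = T? _

  InP-irrelevant : ∀ p (i j : InP B p) → i ≡ j
  InP-irrelevant (spat v) = T-irrelevant
  InP-irrelevant (cpat v w) = T-irrelevant

  Selected? : ∀ v h → Dec (Selected v h)
  Selected? v h = map′ (proj₁ (inP v h)) (proj₂ (inP v h)) (InP? (pat v h))

  InP⇒Selected : ∀ p → InP B p → Selected (proj₁ (region p)) (proj₂ (region p))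
  InP⇒Selected (spat v) i = proj₁ (inP v nothing) i
  InP⇒Selected (cpat v w) i = proj₁ (inP v (just w)) i

  termOf : ∀ p → InP B p → Term (proj₁ (region p)) (proj₂ (region p))
  termOf p i = term (InP⇒Selected p i)

  module _ {Large : Pat n → Set} (Large? : ∀ p → Dec (Large p)) {M₁ M₂ : ℕ}
      (large : AtMost (λ p → InP B p × Large p) M₁)
      (small : ∀ p (i : InP B p) → ¬ Large p → binary (code (termOf p i)) < M₂) where
    private
      classify : ∀ p → InP B p → Dec (Large p) → Fin (M₁ + M₂)
      classify p i (yes h) = AtMost.idx large {p} (i , h) ↑ˡ M₂
      classify p i (no nh) = M₁ ↑ʳ fromℕ< (small p i nh)

      class : ∀ p → InP B p → Fin (M₁ + M₂)
      class p i = classify p i (Large? p)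

      apart : ∀ {i : Fin M₁} {j : Fin M₂} → i ↑ˡ M₂ ≢ M₁ ↑ʳ j
      apart {i} {j} e with trans (sym (splitAt-↑ˡ M₁ i M₂)) (trans (cong (splitAt M₁) e) (splitAt-↑ʳ M₁ M₂ j))
      ... | ()

      by-term : ∀ p q (i : InP B p) (j : InP B q) → code (termOf p i) ≡ code (termOf q j) → Equiv B p q
      by-term p q i j e = subst₂ (Equiv B) (region-pat p) (region-pat q) (same⇒Equiv inP (code-injective (termOf p i) (termOf q j) e))

      classify⇒Equiv : ∀ p q (i : InP B p) (j : InP B q) (d : Dec (Large p)) (d' : Dec (Large q)) →
        classify p i d ≡ classify q j d' → Equiv B p q
      classify⇒Equiv p q i j (yes h) (yes h') e =
        -- Equal indices of large patterns mean equal patterns, and `Equiv` is reflexive because a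
        -- code equals itself.
        subst (Equiv B p) (AtMost.inj large {p} {q} (i , h) (j , h') (↑ˡ-injective M₂ _ _ e)) (by-term p p i i refl)
      classify⇒Equiv p q i j (no _) (no _) e = by-term p q i j (binary-injective _ _ (fromℕ<-injective _ _ _ _ (↑ʳ-injective M₁ _ _ e)))
      classify⇒Equiv p q i j (yes _) (no _) e = ⊥-elim (apart e)
      classify⇒Equiv p q i j (no _) (yes _) e = ⊥-elim (apart (sym e))

      At : Fin (M₁ + M₂) → Pat n → Set
      At j p = Σ (InP B p) λ i → class p i ≡ j

      at? : ∀ j p → Dec (At j p)
      at? j p = by-membership (InP? p)
        where
        by-membership : Dec (InP B p) → Dec (At j p)
        by-membership (no ni) = no (ni ∘ proj₁)
        by-membership (yes i) = map′ (i ,_) (λ (i' , e) → trans (cong (class p) (InP-irrelevant p i i')) e) (class p i ≟F j)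

      class? : ∀ j → Dec (∃ (At j))
      class? j = map′ from to ((any? λ v → at? j (spat v)) ⊎-dec (any? λ v → any? λ w → at? j (cpat v w)))
        where
        from : (∃ λ v → At j (spat v)) ⊎ (∃ λ v → ∃ λ w → At j (cpat v w)) → ∃ (At j)
        from (inj₁ (v , x)) = spat v , x
        from (inj₂ (v , w , x)) = cpat v w , x
        to : ∃ (At j) → (∃ λ v → At j (spat v)) ⊎ (∃ λ v → ∃ λ w → At j (cpat v w))
        to (spat v , x) = inj₁ (v , x)
        to (cpat v w , x) = inj₂ (v , w , x)

    classification : AtMostClasses B (M₁ + M₂)
    classification = let (reps , len , ps , found) = representatives {P = InP B} (λ {p} → class p) class? in
      reps , len , ps , λ p i → mapAny (λ {q} (j , e) → classify⇒Equiv p q i j (Large? p) (Large? q) e) (found {p} i)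

module Classes {k L n : ℕ} (B : Struct (HSig k L) n) (K : IsKOTree (reduct B))
    (inP : ∀ v h → InP B (pat v h) ⇔ Selection.Selected (FromTree.order (reduct B) K) (Levels.priority (FromTree.order (reduct B) K)) v h) where
  O : TreeOrder n
  O = FromTree.order (reduct B) K
  R : Priority O
  R = Levels.priority O
  open Selection O R
  open HierarchicalDefinition B K R
  open CodeLength B K R
  open Classification B K R inP
  open Ranks O Selected?

  -- Every step to a direct subpattern lowers `potential`, which bounds the length of a chain.
  depth : DepthLE B (36 + 36 * suc ⌊log₂ n ⌋)
  depth p m i c = ≤-trans (chain p m i c) (potential≤ (region p))
    where
    decrease′ : ∀ v h v' h' → InP B (pat v h) → Direct B (pat v' h') (pat v h) → potential (v' , h') < potential (v , h)
    decrease′ v h v' h' i (j , (q≤p , ¬p≤q) , _) = potential-strict (proj₁ (inP v h) i) (proj₁ (inP v' h') j)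
      (≤P⇒⊆ h' h q≤p) (λ s → ¬p≤q (⊆⇒≤P h h' s))
    decrease : ∀ p q → InP B p → Direct B q p → potential (region q) < potential (region p)
    decrease (spat v) (spat v') = decrease′ v nothing v' nothing
    decrease (spat v) (cpat v' w') = decrease′ v nothing v' (just w')
    decrease (cpat v w) (spat v') = decrease′ v (just w) v' nothing
    decrease (cpat v w) (cpat v' w') = decrease′ v (just w) v' (just w')
    chain : ∀ p m → InP B p → Chain B p m → m ≤ potential (region p)
    chain p zero i here = z≤n
    chain p (suc m) i (step {q = q} d c) = ≤-trans (s≤s (chain q m (proj₁ d) c)) (decrease p q i d)

  classes : ∀ l {m} → n < suc m * 2 ^ l → AtMostClasses B (18 * m + 2 ^ (bits * (8 * 2 ^ l)))
  classes l {m} n< = classification (λ p → Hits? l (region p)) large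
    (λ p i miss → code-binary< (termOf p i) (atMost-small {l} miss))
    where
    large : AtMost (λ p → InP B p × Hits l (region p)) (18 * m)
    large = record
      { idx = λ {p} (i , h) → AtMost.idx numbered {region p} (InP⇒Selected p i , h)
      ; inj = λ {p} {q} (i , h) (j , h') e → trans (sym (region-pat p)) (trans
          (cong (λ r → pat (proj₁ r) (proj₂ r)) (AtMost.inj numbered {region p} {region q} (InP⇒Selected p i , h) (InP⇒Selected q j , h') e)) (region-pat q)) }
      where
      numbered = atMost-large l {m} n<

-- The defining formulas and their semantics.

infixr 4 _⇒F_
_⇒F_ : ∀ {σ m} → Fm σ m → Fm σ m → Fm σ m
φ ⇒F ψ = orF (negF φ) ψ

module Formulas {k L : ℕ} where
  F : ℕ → Set
  F = Fm (TreeSig k L)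

  private
    variable
      m : ℕ

  #0 : Fin (suc m)
  #0 = zero
  #1 : Fin (suc (suc m))
  #1 = suc zero
  ↑_ : Fin m → Fin (suc m)
  ↑_ = suc

  ancF properF parF siblingF beforeF sameClassF majorityF onesF markF levelF priorityF : Fin m → Fin m → F m
  oddF : Fin m → F m
  lcaF : Fin m → Fin m → Fin m → F m

  ancF x y = rel anc (x ∷ y ∷ [])
  properF x y = andF (ancF x y) (negF (eqF x y))
  parF x v = andF (properF x v) (allF (ancF #0 (↑ v) ⇒F orF (eqF #0 (↑ v)) (ancF #0 (↑ x))))
  siblingF a b = allF (andF (properF #0 (↑ a) ⇒F properF #0 (↑ b)) (properF #0 (↑ b) ⇒F properF #0 (↑ a)))
  beforeF x y = orF (ancF x y)
    (exF (exF (andF (andF (ancF #1 (↑ ↑ x)) (ancF #0 (↑ ↑ y))) (andF (siblingF #1 #0) (ltF #1 #0)))))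
  -- The variable `#0` is forced to be the least element, which has number 0, so the lowest bit is
  -- tested.
  oddF x = exF (andF (allF (negF (ltF #0 #1))) (bitF (↑ x) #0))
  sameClassF x y = andF (oddF x ⇒F oddF y) (oddF y ⇒F oddF x)
  majorityF v y = majF (orF (andF (sameClassF #0 (↑ v)) (beforeF #0 (↑ v)))
                            (andF (negF (sameClassF #0 (↑ v))) (negF (ltF #0 (↑ y)))))
  onesF l y = allF (ltF #0 (↑ l) ⇒F bitF (↑ y) #0)
  markF l v = exF (andF (onesF (↑ l) #0) (andF (majorityF (↑ v) #0)
    (allF (andF (andF (sameClassF #0 (↑ ↑ v)) (beforeF #0 (↑ ↑ v))) (majorityF #0 #1) ⇒F eqF #0 (↑ ↑ v)))))
  lcaF a x y = andF (andF (ancF a x) (ancF a y)) (allF (ancF #0 (↑ x) ⇒F ancF #0 (↑ y) ⇒F ancF #0 (↑ a)))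
  levelF l x = exF (exF (andF (andF (markF (↑ ↑ l) #1) (markF (↑ ↑ l) #0)) (lcaF (↑ ↑ x) #1 #0)))
  priorityF x y = orF (exF (andF (levelF #0 (↑ x)) (negF (levelF #0 (↑ y)))))
                      (andF (allF (levelF #0 (↑ y) ⇒F levelF #0 (↑ x))) (beforeF x y))

  -- The argument inF expresses that the innermost variable is covered by the pattern with root v.
  rootDominatesF : Fin m → F (suc m) → F m
  rootDominatesF v inF = allF (inF ⇒F priorityF (↑ v) #0)
  parentDominatesF : Fin m → F (suc (suc m)) → F m
  parentDominatesF v inF = allF (parF #0 (↑ v) ⇒F allF (inF ⇒F negF (priorityF #0 #1)))

  subtreeF : Fin m → F m
  subtreeF v = orF (rootDominatesF v (ancF (↑ v) #0)) (parentDominatesF v (ancF (↑ ↑ v) #0))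

  contextF : Fin m → Fin m → F m
  contextF v w = andF (properF v w)
    (orF (andF (allF (inF ⇒F negF (priorityF #0 (↑ w)))) (orF (rootDominatesF v inF) (parentDominatesF v inF')))
         (andF (parF v w) (exF (andF (ancF (↑ w) #0) (negF (priorityF (↑ v) #0))))))
    where
    inF = andF (ancF (↑ v) #0) (negF (ancF (↑ w) #0))
    inF' = andF (ancF (↑ ↑ v) #0) (negF (ancF (↑ ↑ w) #0))

module Semantics {k L n : ℕ} (A : Struct (TreeSig k L) n) (K : IsKOTree A) where
  open Formulas {k} {L}
  O : TreeOrder n
  O = FromTree.order A K
  open TreeOrder O
  open Preorder O
  open Marks O
  open Levels O

  record _⊨_∶_ {m} (ρ : Fin m → Fin n) (φ : F m) (P : Set) : Set where
    constructor sem
    field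
      sem-⇔ : T (eval A ρ φ) ⇔ P
  open _⊨_∶_ public

  private
    variable
      m : ℕ
      ρ : Fin m → Fin n
      φ ψ : F m
      P Q : Set

  sem-map : P ⇔ Q → ρ ⊨ φ ∶ P → ρ ⊨ φ ∶ Q
  sem-map (f , g) (sem (to , from)) = sem (f ∘ to , from ∘ g)

  sem-neg : ρ ⊨ φ ∶ P → ρ ⊨ negF φ ∶ (¬ P)
  sem-neg {ρ = ρ} {φ} (sem (to , from)) = sem (neg (eval A ρ φ) to from)
    where
    neg : ∀ b {P} → (T b → P) → (P → T b) → T (not b) ⇔ (¬ P)
    neg true to from = (λ ()) , λ np → np (to tt)
    neg false to from = (λ _ p → from p) , λ _ → tt

  sem-and : ρ ⊨ φ ∶ P → ρ ⊨ ψ ∶ Q → ρ ⊨ andF φ ψ ∶ (P × Q)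
  sem-and (sem (to , from)) (sem (to' , from')) =
    sem ((λ t → let (a , b) = Equivalence.to T-∧ t in to a , to' b) , λ (p , q) → Equivalence.from T-∧ (from p , from' q))

  sem-or : ρ ⊨ φ ∶ P → ρ ⊨ ψ ∶ Q → ρ ⊨ orF φ ψ ∶ (P ⊎ Q)
  sem-or (sem (to , from)) (sem (to' , from')) =
    sem ((λ t → ⊎-map to to' (Equivalence.to T-∨ t)) , λ s → Equivalence.from T-∨ (⊎-map from from' s))

  sem-imp : ρ ⊨ φ ∶ P → ρ ⊨ ψ ∶ Q → ρ ⊨ (φ ⇒F ψ) ∶ (P → Q)
  sem-imp {ρ = ρ} {φ} {P} {ψ} {Q} (sem (to , from)) (sem (to' , from')) = sem (imp (eval A ρ φ) (eval A ρ ψ) to from to' from')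
    where
    imp : ∀ b c {P Q} → (T b → P) → (P → T b) → (T c → Q) → (Q → T c) → T (not b ∨ c) ⇔ (P → Q)
    imp true c to from to' from' = (λ t _ → to' t) , λ f → from' (f (to tt))
    imp false c to from to' from' = (λ _ p → ⊥-elim (from p)) , λ _ → tt

  sem-ex : {P : Fin n → Set} {φ : F (suc m)} → (∀ x → extend x ρ ⊨ φ ∶ P x) → ρ ⊨ exF φ ∶ ∃ P
  sem-ex {ρ = ρ} {P} {φ} h = sem ((λ t → let (x , e) = satisfied (any⁻ _ (allFin n) t) in x , proj₁ (sem-⇔ (h x)) e)
                , λ (x , p) → any⁺ _ (lose (∈-allFin x) (proj₂ (sem-⇔ (h x)) p)))

  sem-all : {P : Fin n → Set} {φ : F (suc m)} → (∀ x → extend x ρ ⊨ φ ∶ P x) → ρ ⊨ allF φ ∶ (∀ x → P x)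
  sem-all h = sem ((λ t x → proj₁ (sem-⇔ (h x)) (lookupAll (all⁺ _ (allFin n) t) (∈-allFin x)))
                 , λ f → all⁻ _ (universal (λ x → proj₂ (sem-⇔ (h x)) (f x)) (allFin n)))

  sem-eq : ∀ i j → ρ ⊨ eqF i j ∶ (ρ i ≡ ρ j)
  sem-eq i j = sem ((λ t → toℕ-injective (≡ᵇ⇒≡ _ _ t)) , λ e → ≡⇒≡ᵇ _ _ (cong toℕ e))

  sem-lt : ∀ i j → ρ ⊨ ltF i j ∶ (toℕ (ρ i) < toℕ (ρ j))
  sem-lt i j = sem (<ᵇ⇒< _ _ , <⇒<ᵇ)

  sem-bit : ∀ i j → ρ ⊨ bitF i j ∶ T (testBit (toℕ (ρ i)) (toℕ (ρ j)))
  sem-bit i j = sem (id , id)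

  sem-anc : ∀ x y → ρ ⊨ ancF x y ∶ (ρ x ≼ ρ y)
  sem-anc x y = sem (id , id)

  sem-proper : ∀ x y → ρ ⊨ properF x y ∶ (ρ x ≺ ρ y)
  sem-proper x y = sem-and (sem-anc x y) (sem-neg (sem-eq x y))

  sem-par : ∀ x v → ρ ⊨ parF x v ∶ Par (ρ x) (ρ v)
  sem-par x v = sem-and (sem-proper x v) (sem-all λ z → sem-imp (sem-anc #0 (↑ v)) (sem-or (sem-eq #0 (↑ v)) (sem-anc #0 (↑ x))))

  sem-sibling : ∀ a b → ρ ⊨ siblingF a b ∶ Sibling (ρ a) (ρ b)
  sem-sibling a b = sem-all λ z → sem-and (sem-imp (sem-proper #0 (↑ a)) (sem-proper #0 (↑ b))) (sem-imp (sem-proper #0 (↑ b)) (sem-proper #0 (↑ a)))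

  sem-before : ∀ x y → ρ ⊨ beforeF x y ∶ (ρ x ⊑ ρ y)
  sem-before x y = sem-or (sem-anc x y) (sem-ex λ a → sem-ex λ b →
    sem-and (sem-and (sem-anc #1 (↑ ↑ x)) (sem-anc #0 (↑ ↑ y))) (sem-and (sem-sibling #1 #0) (sem-lt #1 #0)))

  sem-odd : ∀ x → ρ ⊨ oddF x ∶ T (class (ρ x))
  sem-odd {ρ = ρ} x = sem-map (to , from) (sem-ex λ z → sem-and (sem-all λ w → sem-neg (sem-lt #0 #1)) (sem-bit (↑ x) #0))
    where
    0<n : 0 < n
    0<n = ≤-<-trans z≤n (toℕ<n (ρ x))
    to : (∃ λ z → (∀ w → ¬ toℕ w < toℕ z) × T (testBit (toℕ (ρ x)) (toℕ z))) → T (class (ρ x))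
    to (z , least , b) = subst (T ∘ testBit (toℕ (ρ x))) z≡0 b
      where
      z≡0 : toℕ z ≡ 0
      z≡0 with m≤n⇒m<n∨m≡n (z≤n {toℕ z})
      ... | inj₁ lt = ⊥-elim (least (fromℕ< 0<n) (subst (_< toℕ z) (sym (toℕ-fromℕ< 0<n)) lt))
      ... | inj₂ e = sym e
    from : T (class (ρ x)) → ∃ λ z → (∀ w → ¬ toℕ w < toℕ z) × T (testBit (toℕ (ρ x)) (toℕ z))
    from t = fromℕ< 0<n , (λ w lt → <⇒≱ lt (≤-trans (≤-reflexive (toℕ-fromℕ< 0<n)) z≤n)) ,
      subst (T ∘ testBit (toℕ (ρ x))) (sym (toℕ-fromℕ< 0<n)) t

  sem-sameClass : ∀ x y → ρ ⊨ sameClassF x y ∶ (ρ x ~ ρ y)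
  sem-sameClass x y = sem-map (same-class , class-⇔) (sem-and (sem-imp (sem-odd x) (sem-odd y)) (sem-imp (sem-odd y) (sem-odd x)))

  sem-majority : ∀ v y → ρ ⊨ majorityF v y ∶ Majority (ρ v) (toℕ (ρ y))
  sem-majority {ρ = ρ} v y = sem ((λ t → subst (λ c → n < 2 * c) total (<ᵇ⇒< _ _ t)) , λ p → <⇒<ᵇ (subst (λ c → n < 2 * c) (sym total) p))
    where
    body = orF (andF (sameClassF #0 (↑ v)) (beforeF #0 (↑ v))) (andF (negF (sameClassF #0 (↑ v))) (negF (ltF #0 (↑ y))))
    sem-body : ∀ x → extend x ρ ⊨ body ∶ ((x ~ ρ v × x ⊑ ρ v) ⊎ (¬ x ~ ρ v × toℕ (ρ y) ≤ toℕ x))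
    sem-body x = sem-map (⊎-map id (λ (a , b) → a , ≮⇒≥ b) , ⊎-map id (λ (a , b) → a , λ lt → <⇒≱ lt b))
      (sem-or (sem-and (sem-sameClass #0 (↑ v)) (sem-before #0 (↑ v))) (sem-and (sem-neg (sem-sameClass #0 (↑ v))) (sem-neg (sem-lt #0 (↑ y)))))
    total : # (λ x → eval A (extend x ρ) body) ≡ position (ρ v) + padding (ρ v) (toℕ (ρ y))
    total = position+padding (ρ v) (toℕ (ρ y)) _ (λ x → sem-⇔ (sem-body x))

  sem-ones : ∀ l y → ρ ⊨ onesF l y ∶ Ones (toℕ (ρ l)) (toℕ (ρ y))
  sem-ones {ρ = ρ} l y = sem-map ((λ h j j<l → let j<n = <-trans j<l (toℕ<n (ρ l)) in
        subst (T ∘ testBit (toℕ (ρ y))) (toℕ-fromℕ< j<n) (h (fromℕ< j<n) (subst (_< toℕ (ρ l)) (sym (toℕ-fromℕ< j<n)) j<l))) ,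
      λ h j → h (toℕ j)) (sem-all λ j → sem-imp (sem-lt #0 (↑ l)) (sem-bit (↑ y) #0))

  sem-mark : ∀ l v → ρ ⊨ markF l v ∶ Mark (toℕ (ρ l)) (ρ v)
  sem-mark l v = sem-ex λ y → sem-and (sem-ones (↑ l) #0) (sem-and (sem-majority (↑ v) #0)
    (sem-all λ u → sem-imp (sem-and (sem-and (sem-sameClass #0 (↑ ↑ v)) (sem-before #0 (↑ ↑ v))) (sem-majority #0 #1)) (sem-eq #0 (↑ ↑ v))))

  sem-lca : ∀ a x y → ρ ⊨ lcaF a x y ∶ IsLca (ρ a) (ρ x) (ρ y)
  sem-lca a x y = sem-and (sem-and (sem-anc a x) (sem-anc a y))
    (sem-all λ z → sem-imp (sem-anc #0 (↑ x)) (sem-imp (sem-anc #0 (↑ y)) (sem-anc #0 (↑ a))))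

  sem-level : ∀ l x → ρ ⊨ levelF l x ∶ Level (toℕ (ρ l)) (ρ x)
  sem-level l x = sem-ex λ a → sem-ex λ b → sem-and (sem-and (sem-mark (↑ ↑ l) #1) (sem-mark (↑ ↑ l) #0)) (sem-lca (↑ ↑ x) #1 #0)

  sem-priority : ∀ x y → ρ ⊨ priorityF x y ∶ (ρ x ⪰ˡ ρ y)
  sem-priority x y = sem-or (sem-ex λ l → sem-and (sem-level #0 (↑ x)) (sem-neg (sem-level #0 (↑ y))))
    (sem-and (sem-all λ l → sem-imp (sem-level #0 (↑ y)) (sem-level #0 (↑ x))) (sem-before x y))

  open Selection O priority

  sem-rootDominates : ∀ {In' : Fin n → Set} v {inF : F (suc m)} → (∀ u → extend u ρ ⊨ inF ∶ In' u) →
    ρ ⊨ rootDominatesF v inF ∶ (∀ u → In' u → ρ v ⪰ˡ u)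
  sem-rootDominates v h = sem-all λ u → sem-imp (h u) (sem-priority (↑ v) #0)

  sem-parentDominates : ∀ {In' : Fin n → Set} v {inF : F (suc (suc m))} → (∀ x u → extend u (extend x ρ) ⊨ inF ∶ In' u) →
    ρ ⊨ parentDominatesF v inF ∶ (∀ x → Par x (ρ v) → ∀ u → In' u → ¬ u ⪰ˡ x)
  sem-parentDominates v h = sem-all λ x → sem-imp (sem-par #0 (↑ v)) (sem-all λ u → sem-imp (h x u) (sem-neg (sem-priority #0 #1)))

  sem-subtree : ∀ v → ρ ⊨ subtreeF v ∶ Selected (ρ v) nothing
  sem-subtree {ρ = ρ} v = sem-map (to , from)
    (sem-or (sem-rootDominates v (λ u → sem-anc (↑ v) #0)) (sem-parentDominates v (λ x u → sem-anc (↑ ↑ v) #0)))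
    where
    to : _ → Selected (ρ v) nothing
    to s = (λ _ ()) , inj₁ ((λ _ ()) , ⊎-map (λ f u i → f u (proj₁ i)) (λ f x px u i → f x px u (proj₁ i)) s)
    from : Selected (ρ v) nothing → _
    from (_ , inj₁ (_ , s)) = ⊎-map (λ f u i → f u (i , λ _ ())) (λ f x px u i → f x px u (i , λ _ ())) s
    from (_ , inj₂ (_ , () , _))

  sem-context : ∀ v w → ρ ⊨ contextF v w ∶ Selected (ρ v) (just (ρ w))
  sem-context {ρ = ρ} v w = sem-map (to , from) (sem-and (sem-proper v w)
    (sem-or (sem-and (sem-all λ u → sem-imp (sem-in u) (sem-neg (sem-priority #0 (↑ w))))
                     (sem-or (sem-rootDominates v sem-in) (sem-parentDominates v sem-in')))
            (sem-and (sem-par v w) (sem-ex λ u → sem-and (sem-anc (↑ w) #0) (sem-neg (sem-priority (↑ v) #0))))))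
    where
    sem-in : ∀ u → _ ⊨ _ ∶ (ρ v ≼ u × ¬ ρ w ≼ u)
    sem-in u = sem-and (sem-anc (↑ v) #0) (sem-neg (sem-anc (↑ w) #0))
    sem-in' : ∀ x u → _ ⊨ _ ∶ (ρ v ≼ u × ¬ ρ w ≼ u)
    sem-in' x u = sem-and (sem-anc (↑ ↑ v) #0) (sem-neg (sem-anc (↑ ↑ w) #0))
    inside : ∀ {u} → In (ρ v) (just (ρ w)) u → ρ v ≼ u × ¬ ρ w ≼ u
    inside (p , o) = p , o _ refl
    outside : ∀ {u} → ρ v ≼ u × ¬ ρ w ≼ u → In (ρ v) (just (ρ w)) u
    outside (p , o) = p , λ { _ refl → o }
    to : _ → Selected (ρ v) (just (ρ w))
    to (p , inj₁ (hd , s)) = (λ { _ refl → p }) , inj₁ ((λ { _ refl u i → hd u (inside i) }) ,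
      ⊎-map (λ f u i → f u (inside i)) (λ f x px u i → f x px u (inside i)) s)
    to (p , inj₂ (pw , u , w≼u , u≻v)) = (λ { _ refl → p }) , inj₂ (ρ w , refl , pw , u , w≼u , u≻v)
    from : Selected (ρ v) (just (ρ w)) → _
    from (hb , inj₁ (hd , s)) = hb _ refl , inj₁ ((λ u i → hd _ refl u (outside i)) ,
      ⊎-map (λ f u i → f u (outside i)) (λ f x px u i → f x px u (outside i)) s)
    from (hb , inj₂ (_ , refl , pw , u , w≼u , u≻v)) = hb _ refl , inj₂ (pw , u , w≼u , u≻v)

-- The interpretation and its output structure.

module _ {σ : Sig} {n : ℕ} {A A' : Struct σ n} (A≗A' : ∀ s xs → A s xs ≡ A' s xs) where
  -- The tree part of the output agrees with the input pointwise only. Without function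
  -- extensionality, formulas and tree axioms have to be transported along this agreement by hand.
  eval-cong : ∀ {m} (ρ : Fin m → Fin n) (φ : Fm σ m) → eval A ρ φ ≡ eval A' ρ φ
  eval-cong ρ (rel s xs) = A≗A' s (vmap ρ xs)
  eval-cong ρ (eqF x y) = refl
  eval-cong ρ (ltF x y) = refl
  eval-cong ρ (bitF x y) = refl
  eval-cong ρ (negF φ) = cong not (eval-cong ρ φ)
  eval-cong ρ (andF φ ψ) = cong₂ _∧_ (eval-cong ρ φ) (eval-cong ρ ψ)
  eval-cong ρ (orF φ ψ) = cong₂ _∨_ (eval-cong ρ φ) (eval-cong ρ ψ)
  eval-cong ρ (exF φ) = cong or (map-cong (λ x → eval-cong (extend x ρ) φ) (allFin n))
  eval-cong ρ (allF φ) = cong and (map-cong (λ x → eval-cong (extend x ρ) φ) (allFin n))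
  eval-cong ρ (majF φ) = cong (λ bs → n <ᵇ 2 * countTrue bs) (map-cong (λ x → eval-cong (extend x ρ) φ) (allFin n))

module _ {k L n : ℕ} {A A' : Struct (TreeSig k L) n} (A≗A' : ∀ s xs → A s xs ≡ A' s xs) where
  private
    T⇒ : ∀ s xs → T (A s xs) → T (A' s xs)
    T⇒ s xs = subst T (A≗A' s xs)
    T⇐ : ∀ s xs → T (A' s xs) → T (A s xs)
    T⇐ s xs = subst T (sym (A≗A' s xs))
    star⇒ : ∀ {x y} → Star (Edge A) x y → Star (Edge A') x y
    star⇒ ε = ε
    star⇒ ((i , e) ◅ s) = (i , T⇒ _ _ e) ◅ star⇒ s
    star⇐ : ∀ {x y} → Star (Edge A') x y → Star (Edge A) x y
    star⇐ ε = ε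
    star⇐ ((i , e) ◅ s) = (i , T⇐ _ _ e) ◅ star⇐ s

  isKOTree-cong : IsKOTree A → IsKOTree A'
  isKOTree-cong K = record
    { root = root
    ; rootAnc = λ v → T⇒ _ _ (rootAnc v)
    ; rootNoPar = λ i x e → rootNoPar i x (T⇐ _ _ e)
    ; parent = λ v ne → let (i , x , e) = parent v ne in i , x , T⇒ _ _ e
    ; parentUniq = λ i j x y v e e' → parentUniq i j x y v (T⇐ _ _ e) (T⇐ _ _ e')
    ; childUniq = λ i x y z e e' → childUniq i x y z (T⇐ _ _ e) (T⇐ _ _ e')
    ; ancIsStar = λ x y → (λ a → star⇒ (proj₁ (ancIsStar x y) (T⇐ _ _ a))) , λ s → T⇒ _ _ (proj₂ (ancIsStar x y) (star⇐ s)) }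
    where open IsKOTree K

  treeIso-id : TreeIso A A'
  treeIso-id = id , id , (λ _ → refl) , (λ _ → refl) , (λ _ _ → T⇒ _ _ , T⇐ _ _) , (λ _ _ _ → T⇒ _ _ , T⇐ _ _) , λ _ _ → T⇒ _ _ , T⇐ _ _

interp : (k L : ℕ) → Interp (TreeSig k L) (HSig k L)
interp k L = record { dim = 1 ; domF = eqF zero zero ; relF = relations }
  where
  relations : (s : HSym k L) → Fm (TreeSig k L) (har s * 1)
  relations (tsym anc) = rel anc (zero ∷ suc zero ∷ [])
  relations (tsym (edge i)) = rel (edge i) (zero ∷ suc zero ∷ [])
  relations (tsym (lab a)) = rel (lab a) (zero ∷ [])
  relations subS = Formulas.subtreeF zero
  relations ctxS = Formulas.contextF zero (suc zero)

singleton : ∀ {n} → Fin n → Vec (Fin n) 1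
singleton x = x ∷ []

outList-interp : ∀ {k L n} (A : Struct (TreeSig k L) n) → outList (interp k L) A ≡ tabulate singleton
outList-interp {n = n} A = trans (filter-id _ reflexive (allTuples n 1))
    (trans (singletons (allFin n)) (map-tabulate id singleton))
  where
  reflexive : ∀ (t : Vec (Fin n) 1) → (toℕ (vlookup t zero) ≡ᵇ toℕ (vlookup t zero)) ≡ true
  reflexive t = Equivalence.to T-≡ (≡⇒≡ᵇ (toℕ (vlookup t zero)) _ refl)
  filter-id : ∀ {A : Set} (p : A → Bool) → (∀ x → p x ≡ true) → ∀ xs → filterB p xs ≡ xs
  filter-id p h [] = refl
  filter-id p h (x ∷ xs) rewrite h x = cong (x ∷_) (filter-id p h xs)
  nil : List (Vec (Fin n) 0)
  nil = [] ∷ []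
  singletons : ∀ (xs : List (Fin n)) → concatMap (λ x → map (x ∷_) nil) xs ≡ map singleton xs
  singletons [] = refl
  singletons (x ∷ xs) = cong (singleton x ∷_) (singletons xs)

lookup-tabulate : ∀ {A : Set} {n} (f : Fin n → A) i → lookup (tabulate f) i ≡ f (cast (length-tabulate f) i)
lookup-tabulate {n = suc n} f zero = refl
lookup-tabulate {n = suc n} f (suc i) = lookup-tabulate (f ∘ suc) i

outDomain : ∀ {k L n} (A : Struct (TreeSig k L) n) → Σ (outSize (interp k L) A ≡ n) λ e →
  ∀ i → lookup (outList (interp k L) A) i ≡ singleton (cast e i)
outDomain {n = n} A = at (outList-interp A)
  where
  at : ∀ {xs} → xs ≡ tabulate {n = n} singleton → Σ (length xs ≡ n) λ e → ∀ i → lookup xs i ≡ singleton (cast e i)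
  at refl = length-tabulate singleton , lookup-tabulate singleton

-- Choice of the level that separates large from small patterns, and the constants.

2^⌊log₂n⌋≤n : ∀ n → 0 < n → 2 ^ ⌊log₂ n ⌋ ≤ n
2^⌊log₂n⌋≤n n = go n n ≤-refl
  where
  open ≤-Reasoning
  go : ∀ fuel n → n ≤ fuel → 0 < n → 2 ^ ⌊log₂ n ⌋ ≤ n
  go (suc fuel) (suc zero) _ _ = s≤s z≤n
  go (suc fuel) (suc (suc n)) (s≤s le) _ = step-down ⌊log₂ 2 + n ⌋ (⌊log₂⌊n/2⌋⌋≡⌊log₂n⌋∸1 (2 + n))
    where
    half = suc ⌊ n /2⌋
    ih : 2 ^ ⌊log₂ half ⌋ ≤ half
    ih = go fuel half (≤-trans (s≤s (⌊n/2⌋≤n n)) le) (s≤s z≤n)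
    step-down : ∀ d → ⌊log₂ half ⌋ ≡ d ∸ 1 → 2 ^ d ≤ 2 + n
    step-down zero _ = s≤s z≤n
    step-down (suc d) e = begin
      2 * 2 ^ d              ≡⟨ cong (λ j → 2 * 2 ^ j) e ⟨
      2 * 2 ^ ⌊log₂ half ⌋   ≤⟨ *-monoʳ-≤ 2 ih ⟩
      half + (half + 0)      ≡⟨ cong (half +_) (+-identityʳ half) ⟩
      half + half            ≤⟨ +-monoʳ-≤ half (⌊n/2⌋≤⌈n/2⌉ (2 + n)) ⟩
      half + ⌈ 2 + n /2⌉     ≡⟨ ⌊n/2⌋+⌈n/2⌉≡n (2 + n) ⟩
      2 + n                  ∎

dyadic-scale : ∀ d x → 0 < d → d ≤ x → ∃ λ l → d * 2 ^ l ≤ x × x < 2 * (d * 2 ^ l)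
dyadic-scale d x 0<d d≤x = search x 0 (≤-trans (≤-reflexive (*-identityʳ d)) d≤x) (≤-trans (≤-reflexive (+-comm 1 x)) (+-monoʳ-≤ x (*-mono-≤ 0<d (s≤s z≤n))))
  where
  open ≤-Reasoning
  search : ∀ fuel l → d * 2 ^ l ≤ x → x < fuel + d * 2 ^ l → ∃ λ l → d * 2 ^ l ≤ x × x < 2 * (d * 2 ^ l)
  search zero l lo hi = ⊥-elim (<⇒≱ hi lo)
  search (suc fuel) l lo hi with x <? 2 * (d * 2 ^ l)
  ... | yes p = l , lo , p
  ... | no np = search fuel (suc l) (≤-trans (≤-reflexive double) (≮⇒≥ np)) (begin
      suc x                                    ≤⟨ hi ⟩
      suc fuel + d * 2 ^ l                     ≡⟨ +-suc fuel (d * 2 ^ l) ⟨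
      fuel + suc (d * 2 ^ l)                   ≤⟨ +-monoʳ-≤ fuel (+-monoˡ-≤ (d * 2 ^ l) positive) ⟩
      fuel + (d * 2 ^ l + d * 2 ^ l)           ≡⟨ cong (λ j → fuel + (d * 2 ^ l + j)) (+-identityʳ (d * 2 ^ l)) ⟨
      fuel + 2 * (d * 2 ^ l)                   ≡⟨ cong (fuel +_) double ⟨
      fuel + d * 2 ^ suc l                     ∎)
    where
    double : d * 2 ^ suc l ≡ 2 * (d * 2 ^ l)
    double = trans (sym (*-assoc d 2 (2 ^ l))) (trans (cong (_* 2 ^ l) (*-comm d 2)) (*-assoc 2 d (2 ^ l)))
    positive : 1 ≤ d * 2 ^ l
    positive = *-mono-≤ 0<d (m^n>0 2 l)

a≤2^a : ∀ a → a ≤ 2 ^ a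
a≤2^a zero = z≤n
a≤2^a (suc a) = +-mono-≤ (m^n>0 2 a) (≤-trans (a≤2^a a) (≤-reflexive (sym (+-identityʳ _))))

-- With 2 ^ l of order log n, the large patterns number O(n / 2 ^ l) and the codes of small patterns O(√ n).
class-bound : ∀ b n l λ' m → 16 * b * 2 ^ l ≤ λ' → λ' < 2 * (16 * b * 2 ^ l) → 2 ^ λ' ≤ n → m * 2 ^ l ≤ n →
  (18 * m + 2 ^ (b * (8 * 2 ^ l))) * λ' ≤ (576 * b + 108) * n
class-bound b n l λ' m lo hi 2^λ≤n m≤ = begin
  (18 * m + X) * λ'                                    ≡⟨ *-distribʳ-+ λ' (18 * m) X ⟩
  18 * m * λ' + X * λ'                                 ≤⟨ +-mono-≤ large small ⟩
  576 * b * n + 108 * n                                ≡⟨ *-distribʳ-+ n (576 * b) 108 ⟨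
  (576 * b + 108) * n                                  ∎
  where
  open ≤-Reasoning
  open +-*-Solver
  P = 2 ^ l
  a = b * (8 * P)
  X = 2 ^ a
  large : 18 * m * λ' ≤ 576 * b * n
  large = begin
    18 * m * λ'                      ≤⟨ *-monoʳ-≤ (18 * m) (<⇒≤ hi) ⟩
    18 * m * (2 * (16 * b * P))      ≡⟨ solve 3 (λ m b p → con 18 :* m :* (con 2 :* (con 16 :* b :* p)) := con 576 :* b :* (m :* p)) refl m b P ⟩
    576 * b * (m * P)                ≤⟨ *-monoʳ-≤ (576 * b) m≤ ⟩
    576 * b * n                      ∎
  -- The 16 is twice the 8 from the size bound of small patterns. It makes the square of the number
  -- of codes at most `2 ^ λ'`, hence at most `n`.
  a+a≤λ : a + a ≤ λ'
  a+a≤λ = ≤-trans (≤-reflexive (solve 2 (λ b p → b :* (con 8 :* p) :+ b :* (con 8 :* p) := con 16 :* b :* p) refl b P)) lo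
  -- The number of codes also bounds the logarithm up to a factor 4, so one more factor `X` absorbs
  -- `λ'`.
  λ≤4X : λ' ≤ 4 * X
  λ≤4X = begin
    λ'                       ≤⟨ <⇒≤ hi ⟩
    2 * (16 * b * P)         ≡⟨ solve 2 (λ b p → con 2 :* (con 16 :* b :* p) := con 4 :* (b :* (con 8 :* p))) refl b P ⟩
    4 * a                    ≤⟨ *-monoʳ-≤ 4 (a≤2^a a) ⟩
    4 * X                    ∎
  small : X * λ' ≤ 108 * n
  small = begin
    X * λ'                   ≤⟨ *-monoʳ-≤ X λ≤4X ⟩
    X * (4 * X)              ≡⟨ solve 1 (λ x → x :* (con 4 :* x) := con 4 :* (x :* x)) refl X ⟩
    4 * (X * X)              ≡⟨ cong (4 *_) (^-distribˡ-+-* 2 a a) ⟨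
    4 * 2 ^ (a + a)          ≤⟨ *-monoʳ-≤ 4 (≤-trans (^-monoʳ-≤ 2 a+a≤λ) 2^λ≤n) ⟩
    4 * n                    ≤⟨ *-monoˡ-≤ n (m≤m+n 4 104) ⟩
    108 * n                  ∎

module _ {k L n : ℕ} (A : Struct (TreeSig k L) n) (K : IsKOTree A) where
  private
    b c : ℕ
    b = 2 + L + k * 2
    -- One constant for both bounds: `576 * b` pays for the large patterns, and `108 = 72 + 36`
    -- comes from the depth.
    c = 576 * b + 108

  Conclusion : ∀ {N} → Struct (HSig k L) N → Set
  Conclusion B = TreeIso (reduct B) A × IsHierDef B × NormalForm B ×
    (2 ^ (16 * b) ≤ n → DepthLE B (c * ⌊log₂ n ⌋) ×
      Σ ℕ λ M → (M * ⌊log₂ n ⌋ ≤ c * n) × AtMostClasses B M)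

  -- The size of the output equals `n` only propositionally. Stating the result for any size `N` and
  -- any enumeration `h` of singletons allows this equation to be matched with `refl`.
  conclusion : ∀ {N} (e : N ≡ n) (h : Fin N → Vec (Fin n) 1) → (∀ i → h i ≡ singleton (cast e i)) →
    Conclusion (λ s xs → eval A (vlookup (vconcat (vmap h xs))) (relF (interp k L) s))
  conclusion refl h h≡ = treeIso-id {A = reduct B} same , isHierDef inP , normalForm inP , bounds
    where
    B : Struct (HSig k L) n
    B s xs = eval A (vlookup (vconcat (vmap h xs))) (relF (interp k L) s)
    h-id : ∀ x → h x ≡ x ∷ []
    h-id x = trans (h≡ x) (cong singleton (cast-is-id refl x))
    env₁ : ∀ x → vconcat (vmap h (x ∷ [])) ≡ x ∷ []
    env₁ x rewrite h-id x = refl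
    env₂ : ∀ x y → vconcat (vmap h (x ∷ y ∷ [])) ≡ x ∷ y ∷ []
    env₂ x y rewrite h-id x | h-id y = refl
    at-env : ∀ {m} (φ : Fm (TreeSig k L) m) {xs ys} → xs ≡ ys → eval A (vlookup xs) φ ≡ eval A (vlookup ys) φ
    at-env φ refl = refl
    same : ∀ s xs → reduct B s xs ≡ A s xs
    same anc (x ∷ y ∷ []) = at-env (rel anc (zero ∷ suc zero ∷ [])) (env₂ x y)
    same (edge i) (x ∷ y ∷ []) = at-env (rel (edge i) (zero ∷ suc zero ∷ [])) (env₂ x y)
    same (lab a) (x ∷ []) = at-env (rel (lab a) (zero ∷ [])) (env₁ x)
    K' : IsKOTree (reduct B)
    K' = isKOTree-cong (λ s xs → sym (same s xs)) K
    open Semantics (reduct B) K'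
    open Selection O (Levels.priority O)
    subS≡ : ∀ v → B subS (v ∷ []) ≡ eval (reduct B) (vlookup (v ∷ [])) (Formulas.subtreeF zero)
    subS≡ v = trans (at-env (Formulas.subtreeF zero) (env₁ v)) (eval-cong {A' = reduct B} (λ s xs → sym (same s xs)) (vlookup (v ∷ [])) (Formulas.subtreeF zero))
    ctxS≡ : ∀ v w → B ctxS (v ∷ w ∷ []) ≡ eval (reduct B) (vlookup (v ∷ w ∷ [])) (Formulas.contextF zero (suc zero))
    ctxS≡ v w = trans (at-env (Formulas.contextF zero (suc zero)) (env₂ v w)) (eval-cong {A' = reduct B} (λ s xs → sym (same s xs)) (vlookup (v ∷ w ∷ [])) (Formulas.contextF zero (suc zero)))
    inP : ∀ v h → InP B (pat v h) ⇔ Selected v h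
    inP v nothing = let (to , from) = sem-⇔ (sem-subtree {ρ = vlookup (v ∷ [])} zero) in
      (λ i → to (subst T (subS≡ v) i)) , λ s → subst T (sym (subS≡ v)) (from s)
    inP v (just w) = let (to , from) = sem-⇔ (sem-context {ρ = vlookup (v ∷ w ∷ [])} zero (suc zero)) in
      (λ i → to (subst T (ctxS≡ v w) i)) , λ s → subst T (sym (ctxS≡ v w)) (from s)
    open HierarchicalDefinition B K' (Levels.priority O)
    open Classes B K' inP using (depth; classes)
    open ≤-Reasoning
    bounds : 2 ^ (16 * b) ≤ n → DepthLE B (c * ⌊log₂ n ⌋) × Σ ℕ λ M → (M * ⌊log₂ n ⌋ ≤ c * n) × AtMostClasses B M
    bounds n₀≤n = (λ p m i ch → ≤-trans (depth p m i ch) depth≤) , _ ,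
      class-bound b n l ⌊log₂ n ⌋ q (proj₁ (proj₂ scale)) (proj₂ (proj₂ scale)) (2^⌊log₂n⌋≤n n (<-≤-trans (m^n>0 2 (16 * b)) n₀≤n))
        (m/n*n≤m n (2 ^ l) {{m^n≢0 2 l}}) , classes l {q} n<
      where
      -- The threshold on `n` is chosen for this inequality, which lets `dyadic-scale` start from
      -- level 0.
      16b≤log : 16 * b ≤ ⌊log₂ n ⌋
      16b≤log = ≤-trans (≤-reflexive (sym (⌊log₂[2^n]⌋≡n (16 * b)))) (⌊log₂⌋-mono-≤ n₀≤n)
      scale = dyadic-scale (16 * b) ⌊log₂ n ⌋ (s≤s z≤n) 16b≤log
      l = proj₁ scale
      q = (n / (2 ^ l)) {{m^n≢0 2 l}}
      n< : n < suc q * 2 ^ l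
      n< = begin-strict
        n                                             ≡⟨ m≡m%n+[m/n]*n n (2 ^ l) {{m^n≢0 2 l}} ⟩
        (n % (2 ^ l)) {{m^n≢0 2 l}} + q * 2 ^ l       <⟨ +-monoˡ-< (q * 2 ^ l) (m%n<n n (2 ^ l) {{m^n≢0 2 l}}) ⟩
        suc q * 2 ^ l                                 ∎
      1≤log : 1 ≤ ⌊log₂ n ⌋
      1≤log = ≤-trans (s≤s z≤n) 16b≤log
      depth≤ : 36 + 36 * suc ⌊log₂ n ⌋ ≤ c * ⌊log₂ n ⌋
      depth≤ = begin
        36 + 36 * suc ⌊log₂ n ⌋                       ≡⟨ cong (36 +_) (*-suc 36 ⌊log₂ n ⌋) ⟩
        72 + 36 * ⌊log₂ n ⌋                           ≤⟨ +-monoˡ-≤ (36 * ⌊log₂ n ⌋) (*-monoʳ-≤ 72 1≤log) ⟩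
        72 * ⌊log₂ n ⌋ + 36 * ⌊log₂ n ⌋               ≡⟨ *-distribʳ-+ ⌊log₂ n ⌋ 72 36 ⟨
        108 * ⌊log₂ n ⌋                               ≤⟨ *-monoˡ-≤ ⌊log₂ n ⌋ (m≤n+m 108 (576 * b)) ⟩
        c * ⌊log₂ n ⌋                                 ∎

theorem4p6 : (k L : ℕ) → 1 ≤ k →
    Σ (Interp (TreeSig k L) (HSig k L)) λ I →
    Σ ℕ λ c → Σ ℕ λ n₀ →
    (n : ℕ) (A : Struct (TreeSig k L) n) → IsKOTree A →
    TreeIso (reduct (outStruct I A)) A ×
    IsHierDef (outStruct I A) ×
    NormalForm (outStruct I A) ×
    (n₀ ≤ n →
    DepthLE (outStruct I A) (c * ⌊log₂ n ⌋) ×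
    Σ ℕ λ M → (M * ⌊log₂ n ⌋ ≤ c * n) × AtMostClasses (outStruct I A) M)
theorem4p6 k L 1≤k = interp k L , 576 * (2 + L + k * 2) + 108 , 2 ^ (16 * (2 + L + k * 2)) , λ n A K →
  let (e , h) = outDomain A in conclusion A K e (lookup (outList (interp k L) A)) h
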